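{- There is an absolute constant $C>0$ such that for every planar point-line system $(\mathcal{P},\mathcal{L})$ with $|\mathcal{P}|=N$ points (and any finite number $D$ of lines), $\mathrm{disc}(\mathbf{A}^{\mathcal{P},\mathcal{L}})\le C N^{1/6}$.
   Context: A planar point-line system $(\mathcal{P},\mathcal{L})$ consists of a finite set of $N$ points $\mathcal{P}\subseteq\mathbb{R}^2$ and a finite set $\mathcal{L}$ of $D$ lines in $\mathbb{R}^2$. Its adjacency matrix $\mathbf{A}^{\mathcal{P},\mathcal{L}}\in\{0,1\}^{\mathcal{L}\times\mathcal{P}}$ has entry $1$ at $(L,p)$ iff $p\in L$. For a matrix $\mathbf{A}$ with $N$ columns, $\mathrm{disc}(\mathbf{A}):=\min\{\|\mathbf{A}\mathbf{z}\|_\infty:\mathbf{z}\in\{ -1,+1\}^N\}$. -}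

module Defs where

open import Level using (0ℓ)
open import Algebra.Bundles using (CommutativeRing)
open import Relation.Binary.Structures using (IsStrictTotalOrder)
open import Relation.Nullary using (¬_; yes; no)
open import Data.Product using (_×_; ∃; Σ; _,_)
open import Data.Sum using (_⊎_)
open import Data.Nat as ℕ using (ℕ; zero; suc; _⊔_; _⊓_)
open import Data.Integer as ℤ using (ℤ; ∣_∣)
open import Data.Fin using (Fin; zero; suc)
open import Data.Bool using (Bool; true; false)
open import Data.Vec using (Vec; []; _∷_; lookup)
open import Data.List using (List; []; _∷_; map; _++_; foldr)
open import Relation.Binary.PropositionalEquality using (_≡_)

-- The real numbers, axiomatised as a Dedekind-complete ordered field.
-- (The standard library has no real numbers.  Any two complete ordered
-- fields are isomorphic, so quantifying over every model of these
-- axioms is the same as speaking about ℝ.)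

record RealField : Set₁ where
  field
    commutativeRing : CommutativeRing 0ℓ 0ℓ
  open CommutativeRing commutativeRing public
  field
    _<_                : Carrier → Carrier → Set
    isStrictTotalOrder : IsStrictTotalOrder _≈_ _<_
    0<1                : 0# < 1#
    +-mono-<           : ∀ {x y} z → x < y → (x + z) < (y + z)
    *-pos              : ∀ {x y} → 0# < x → 0# < y → 0# < (x * y)
    inverse            : ∀ x → ¬ (x ≈ 0#) → ∃ λ y → (x * y) ≈ 1#
  _≤_ : Carrier → Carrier → Set
  x ≤ y = (x < y) ⊎ (x ≈ y)
  field
    complete : (S : Carrier → Set) → ∃ S →
               (∃ λ b → ∀ x → S x → x ≤ b) →
               ∃ λ s → (∀ x → S x → x ≤ s) ×
                       (∀ b → (∀ x → S x → x ≤ b) → s ≤ b)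
  open IsStrictTotalOrder isStrictTotalOrder public using (_≟_)

module Plane (R : RealField) where
  open RealField R

  Point : Set
  Point = Carrier × Carrier

  -- The line { (x , y) | a x + b y = c } with (a , b) ≠ (0 , 0).
  record Line : Set where
    constructor line
    field
      a b c  : Carrier
      nondeg : ¬ ((a ≈ 0#) × (b ≈ 0#))

  _∈ᴸ_ : Point → Line → Set
  (x , y) ∈ᴸ line a b c _ = ((a * x) + (b * y)) ≈ c

  incidence : Line → Point → ℤ
  incidence (line a b c _) (x , y) with ((a * x) + (b * y)) ≟ c
  ... | yes _ = ℤ.+ 1
  ... | no  _ = ℤ.+ 0

  Distinct : ∀ {N} → (Fin N → Point) → Set
  Distinct {N} P = ∀ (i j : Fin N) →
    (Data.Product.proj₁ (P i) ≈ Data.Product.proj₁ (P j)) ×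
    (Data.Product.proj₂ (P i) ≈ Data.Product.proj₂ (P j)) → i ≡ j

  adjacency : ∀ {N D} → (Fin N → Point) → (Fin D → Line) → Fin D → Fin N → ℤ
  adjacency P L l p = incidence (L l) (P p)

sumFin : ∀ n → (Fin n → ℤ) → ℤ
sumFin zero    f = ℤ.+ 0
sumFin (suc n) f = f zero ℤ.+ sumFin n (λ j → f (suc j))

maxFin : ∀ n → (Fin n → ℕ) → ℕ
maxFin zero    f = 0
maxFin (suc n) f = f zero ⊔ maxFin n (λ i → f (suc i))

sign : Bool → ℤ
sign true  = ℤ.+ 1
sign false = ℤ.- (ℤ.+ 1)

supNormAz : ∀ {D N} → (Fin D → Fin N → ℤ) → Vec Bool N → ℕ
supNormAz {D} {N} A z =
  maxFin D (λ i → ∣ sumFin N (λ j → A i j ℤ.* sign (lookup z j)) ∣)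

allSigns : ∀ N → List (Vec Bool N)
allSigns zero    = [] ∷ []
allSigns (suc N) = map (true ∷_) (allSigns N) ++ map (false ∷_) (allSigns N)

allTrue : ∀ N → Vec Bool N
allTrue zero    = []
allTrue (suc N) = true ∷ allTrue N

disc : ∀ {D N} → (Fin D → Fin N → ℤ) → ℕ
disc {D} {N} A =
  foldr (λ z m → supNormAz A z ⊓ m) (supNormAz A (allTrue N)) (allSigns N)

{-# OPTIONS --safe #-}
module Submission where

-- Partial colouring.  It suffices to find two colourings x, y of the n points that differ in a positive
-- proportion of them and satisfy |χ_L(x) - χ_L(y)| = O(n^{1/6}) for every line L: then (x - y) / 2 colours
-- a positive proportion of the points, and the bounds of the successive rounds form a geometric series.
-- Round every χ_L(x) to a multiple of Δ ~ n^{1/6} and describe x by the rounded values, at a cost of c_L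
-- per unit on the line L, where 2 ^ c_L ~ (n^{1/3} / |L|)⁴.  Give a line the weight |L|⁴ / n^{4/3} if
-- |L| < n^{1/3} and |L| / n^{1/3} otherwise.  If the weights add up to O(n), then the second and tenth moments
-- of χ_L make the average cost a small multiple of n, and a Kraft inequality yields a class of 2 ^ (n - εn)
-- colourings with equal rounded values, too many for a Hamming ball of small radius.
-- The sum of the weights is bounded by the Szemerédi–Trotter theorem in the form e t² ≤ 3 n t³ + m²
-- (m lines, e pairs of consecutive points on them, any t ≥ 1), which follows from the linear bound on the
-- number of edges of a plane graph by sampling the points with probability 1 / t.

open import Defs
open import Data.Nat using (ℕ; zero; suc; _+_; _*_; _∸_; _^_; _≤_; _<_; _/_; _%_; _≤?_; _<?_; _⊓_; z≤n; s≤s; s≤s⁻¹; NonZero; nonZero; >-nonZero; >-nonZero⁻¹)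
open import Data.Nat.Properties
open import Data.Nat.DivMod using (m≡m%n+[m/n]*n; m%n<n; m/n*n≤m)
open import Data.Nat.Solver using (module +-*-Solver)
open import Data.Nat.Tactic.RingSolver using (solve-∀)
open import Data.Integer as ℤ using (ℤ; ∣_∣)
import Data.Integer.Properties as ℤ
import Data.Integer.Tactic.RingSolver as ℤ-Solver
import Data.Sign as Sign
open import Data.Bool using (Bool; true; false; not; if_then_else_; _∧_)
import Data.Bool.Properties as Bool
open import Data.Fin as Fin using (Fin; zero; suc; toℕ)
import Data.Fin.Properties as Fin
open import Data.Product using (∃; _×_; _,_; proj₁; proj₂)
open import Data.Sum using (_⊎_; inj₁; inj₂)
open import Data.Empty using (⊥; ⊥-elim)
open import Data.Maybe using (Maybe; just; nothing)
open import Data.Vec as Vec using (Vec; []; _∷_; lookup)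
import Data.Vec.Properties as Vec
open import Data.Vec.Relation.Unary.All using () renaming (All to VecAll; [] to []ᵃ; _∷_ to _∷ᵃ_)
import Data.Vec.Relation.Unary.All as VecAll
import Data.Vec.Relation.Unary.All.Properties as VecAll
open import Data.Vec.Relation.Unary.AllPairs as VecPairs using ([]; _∷_)
open import Data.Vec.Relation.Unary.AllPairs.Properties using () renaming (tabulate⁺ to AllPairs-tabulate⁺)
open import Data.Vec.Relation.Binary.Pointwise.Extensional using (ext; Pointwise-≡⇒≡)
open import Data.List as List using (List; []; _∷_; map; _++_; length; filter; foldr; downFrom; cartesianProduct; allFin)
import Data.List.Properties as List
open import Data.List.Membership.Propositional using (_∈_; find; lose)
open import Data.List.Membership.Propositional.Properties using
  ( ∈-∃++; ∈-++⁻; ∈-++⁺ˡ; ∈-++⁺ʳ; ∈-map⁺; ∈-map⁻; ∈-filter⁺; ∈-filter⁻; ∈-cartesianProduct⁺; ∈-cartesianProduct⁻; ∈-allFin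
  ; ∈-lookup; ∈-tabulate⁺; ∈-tabulate⁻; ∈-deduplicate⁺; ∈-deduplicate⁻ )
open import Data.List.Relation.Unary.All using (All; []; _∷_)
import Data.List.Relation.Unary.All as All
import Data.List.Relation.Unary.All.Properties as All
open import Data.List.Relation.Unary.Any using (here; there)
import Data.List.Relation.Unary.Any as Any
open import Data.List.Relation.Unary.Unique.Propositional using (Unique; []; _∷_)
import Data.List.Relation.Unary.Unique.Propositional.Properties as Unique
import Data.List.Relation.Unary.Unique.DecPropositional.Properties as DecUnique
open import Algebra.Bundles using (CommutativeRing)
import Algebra.Properties.Ring as RingProperties
import Algebra.Properties.Semiring.Mult.TCOptimised as Mult
import Algebra.Solver.Ring as RingSolver
open import Algebra.Solver.Ring.AlmostCommutativeRing using (fromCommutativeRing; _-Raw-AlmostCommutative⟶_)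
open import Function using (_∘_; id; case_of_)
open import Level using (0ℓ)
open import Relation.Binary.Definitions using (tri<; tri≈; tri>)
open import Relation.Binary.Structures using (IsStrictTotalOrder)
import Relation.Binary.Reasoning.Setoid as SetoidReasoning
open import Relation.Binary.PropositionalEquality using (_≡_; _≢_; refl; sym; trans; cong; cong₂; subst; subst₂; module ≡-Reasoning)
open import Relation.Nullary using (¬_; Dec; yes; no; does; contradiction)
open import Relation.Nullary.Decidable using (_×-dec_; ¬?; dec-true; dec-false)

-- The threshold n^{1/3} balances two dangers. About n² / k³ lines can carry k points, so lines
-- shorter than n^{1/3} may far outnumber the points; but their sums rarely reach Δ, and the tenth
-- moment makes that rare enough to pay for describing the exceptions. Longer lines may have sums of
-- many multiples of Δ, but they have few incidences in total, and the second moment suffices. At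
-- the threshold there are about n lines of variance n^{1/3}, whence Δ ~ n^{1/6}. The weight of a
-- short line has to decay faster than |L|³ for its sum to be free of a logarithm; the fourth power
-- is the first integral choice. The plane is that of an abstract ordered field, so no topology or
-- Euler formula is at hand. Plane graphs are handled through the order of lines over the abscissae
-- of the points alone, and the linear bound comes from charging edges to vertices. All estimates
-- are inequalities between natural numbers: roots are replaced by an s with n ≤ s⁶ ≤ 64 n,
-- probabilities by weighted counts, and logarithms by comparison of powers of two.

-- Finite sums and a pigeonhole principle

sumL : ∀ {A : Set} → (A → ℕ) → List A → ℕ
sumL f []       = 0
sumL f (x ∷ xs) = f x + sumL f xs

⟦_⟧ : Bool → ℕ
⟦ true ⟧  = 1
⟦ false ⟧ = 0

module _ {A : Set} where

  sumL-mono : ∀ {f g : A → ℕ} xs → (∀ {x} → x ∈ xs → f x ≤ g x) → sumL f xs ≤ sumL g xs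
  sumL-mono []       h = z≤n
  sumL-mono (x ∷ xs) h = +-mono-≤ (h (here refl)) (sumL-mono xs (h ∘ there))

  sumL-cong : ∀ {f g : A → ℕ} xs → (∀ {x} → x ∈ xs → f x ≡ g x) → sumL f xs ≡ sumL g xs
  sumL-cong []       h = refl
  sumL-cong (x ∷ xs) h = cong₂ _+_ (h (here refl)) (sumL-cong xs (h ∘ there))

  sumL-+ : ∀ (f g : A → ℕ) xs → sumL (λ x → f x + g x) xs ≡ sumL f xs + sumL g xs
  sumL-+ f g []       = refl
  sumL-+ f g (x ∷ xs) rewrite sumL-+ f g xs = lemma (f x) (g x) (sumL f xs) (sumL g xs)
    where lemma : ∀ a b c d → a + b + (c + d) ≡ a + c + (b + d)
          lemma = solve-∀

  sumL-*ˡ : ∀ c (f : A → ℕ) xs → sumL (λ x → c * f x) xs ≡ c * sumL f xs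
  sumL-*ˡ c f []       = sym (*-zeroʳ c)
  sumL-*ˡ c f (x ∷ xs) rewrite sumL-*ˡ c f xs = sym (*-distribˡ-+ c (f x) (sumL f xs))

  sumL-*ʳ : ∀ c (f : A → ℕ) xs → sumL (λ x → f x * c) xs ≡ sumL f xs * c
  sumL-*ʳ c f []       = refl
  sumL-*ʳ c f (x ∷ xs) rewrite sumL-*ʳ c f xs = sym (*-distribʳ-+ c (f x) (sumL f xs))

  sumL-const : ∀ c (xs : List A) → sumL (λ _ → c) xs ≡ length xs * c
  sumL-const c []       = refl
  sumL-const c (x ∷ xs) = cong (c +_) (sumL-const c xs)

  sumL-++ : ∀ (f : A → ℕ) xs ys → sumL f (xs ++ ys) ≡ sumL f xs + sumL f ys
  sumL-++ f []       ys = refl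
  sumL-++ f (x ∷ xs) ys rewrite sumL-++ f xs ys = sym (+-assoc (f x) _ _)

  sumL-filter : ∀ {P : A → Set} (P? : ∀ x → Dec (P x)) (f : A → ℕ) xs →
                sumL f (filter P? xs) ≡ sumL (λ x → ⟦ does (P? x) ⟧ * f x) xs
  sumL-filter P? f []       = refl
  sumL-filter P? f (x ∷ xs) with P? x
  ... | yes _ = cong₂ _+_ (sym (+-identityʳ (f x))) (sumL-filter P? f xs)
  ... | no  _ = sumL-filter P? f xs

  length-filter≡sumL : ∀ {P : A → Set} (P? : ∀ x → Dec (P x)) xs →
                       length (filter P? xs) ≡ sumL (λ x → ⟦ does (P? x) ⟧) xs
  length-filter≡sumL P? []       = refl
  length-filter≡sumL P? (x ∷ xs) with P? x
  ... | yes _ = cong suc (length-filter≡sumL P? xs)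
  ... | no  _ = length-filter≡sumL P? xs

sumL-map : ∀ {A B : Set} (f : B → ℕ) (g : A → B) xs → sumL f (map g xs) ≡ sumL (f ∘ g) xs
sumL-map f g []       = refl
sumL-map f g (x ∷ xs) = cong (f (g x) +_) (sumL-map f g xs)

^-distribʳ-* : ∀ k m n → (m * n) ^ k ≡ m ^ k * n ^ k
^-distribʳ-* zero    m n = refl
^-distribʳ-* (suc k) m n = trans (cong (m * n *_) (^-distribʳ-* k m n)) (l m n (m ^ k) (n ^ k))
  where l : ∀ a b c d → a * b * (c * d) ≡ a * c * (b * d)
        l = solve-∀

sumL-swap : ∀ {A B : Set} (f : A → B → ℕ) xs ys →
            sumL (λ x → sumL (f x) ys) xs ≡ sumL (λ y → sumL (λ x → f x y) xs) ys
sumL-swap f []       ys = sym (trans (sumL-const 0 ys) (*-zeroʳ (length ys)))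
sumL-swap f (x ∷ xs) ys =
  trans (cong (sumL (f x) ys +_) (sumL-swap f xs ys)) (sym (sumL-+ (f x) _ ys))

sumL-× : ∀ {A B : Set} (f : A × B → ℕ) (xs : List A) (ys : List B) →
         sumL f (cartesianProduct xs ys) ≡ sumL (λ x → sumL (λ y → f (x , y)) ys) xs
sumL-× f []       ys = refl
sumL-× f (x ∷ xs) ys = trans (sumL-++ f (map (x ,_) ys) _) (cong₂ _+_ (sumL-map f (x ,_) ys) (sumL-× f xs ys))

length-× : ∀ {A B : Set} (xs : List A) (ys : List B) → length (cartesianProduct xs ys) ≡ length xs * length ys
length-× []       ys = refl
length-× (x ∷ xs) ys =
  trans (List.length-++ (map (x ,_) ys)) (cong₂ _+_ (List.length-map (x ,_) ys) (length-× xs ys))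

-- A relation replaces a function because charges are only shown to exist. The partner of each `x`
-- is removed from `U`; injectivity ensures that no later element needs it.
pigeonhole : ∀ {A B : Set} (R : A → B → Set) {xs : List A} (U : List B) → Unique xs →
             (∀ {x} → x ∈ xs → ∃ λ b → b ∈ U × R x b) →
             (∀ {x y b} → x ∈ xs → y ∈ xs → R x b → R y b → x ≡ y) →
             length xs ≤ length U
pigeonhole R U []       total inj = z≤n
pigeonhole {A} R {x ∷ xs} U (x∉ ∷ uniq) total inj with total (here refl)
... | b , b∈U , xRb with ∈-∃++ b∈U
... | ps , qs , refl = subst (suc (length xs) ≤_) (sym (trans (List.length-++ ps) (+-suc (length ps) (length qs))))
        (s≤s (subst (length xs ≤_) (List.length-++ ps) (pigeonhole R (ps ++ qs) uniq total′ (λ p q → inj (there p) (there q)))))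
  where
  total′ : ∀ {y} → y ∈ xs → ∃ λ c → c ∈ ps ++ qs × R y c
  total′ y∈ with total (there y∈)
  ... | c , c∈ , yRc with ∈-++⁻ ps c∈
  ... | inj₁ c∈ps         = c , ∈-++⁺ˡ c∈ps , yRc
  ... | inj₂ (there c∈qs) = c , ∈-++⁺ʳ ps c∈qs , yRc
  ... | inj₂ (here refl)  = contradiction (inj (here refl) (there y∈) xRb yRc) (All.lookup x∉ y∈)

-- Random sampling of vertices

-- The mean over random masks: each entry is true with weight 1 and false with weight r,
-- so that the total weight is (1 + r) ^ n.
avg : ℕ → ∀ n → (Vec Bool n → ℕ) → ℕ
avg r zero    F = F []
avg r (suc n) F = avg r n (λ S → F (true ∷ S)) + r * avg r n (λ S → F (false ∷ S))

hits : ∀ {n} → List (Fin n) → Vec Bool n → ℕ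
hits []       S = 1
hits (u ∷ us) S = ⟦ lookup S u ⟧ * hits us S

-- The indicator of `T ⊆ S`. Unlike `hits` it recurs along the positions, as `avg` does; `mark`
-- translates a list without repetitions into such a `T`.
hit : ∀ {n} → Vec Bool n → Vec Bool n → ℕ
hit []          []      = 1
hit (true ∷ T)  (s ∷ S) = ⟦ s ⟧ * hit T S
hit (false ∷ T) (_ ∷ S) = hit T S

module _ (r : ℕ) where

  avg-mono : ∀ n {F G : Vec Bool n → ℕ} → (∀ S → F S ≤ G S) → avg r n F ≤ avg r n G
  avg-mono zero    h = h []
  avg-mono (suc n) h = +-mono-≤ (avg-mono n (h ∘ (true ∷_))) (*-monoʳ-≤ r (avg-mono n (h ∘ (false ∷_))))

  avg-cong : ∀ n {F G : Vec Bool n → ℕ} → (∀ S → F S ≡ G S) → avg r n F ≡ avg r n G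
  avg-cong n h = ≤-antisym (avg-mono n (λ S → ≤-reflexive (h S))) (avg-mono n (λ S → ≤-reflexive (sym (h S))))

  avg-+ : ∀ n (F G : Vec Bool n → ℕ) → avg r n (λ S → F S + G S) ≡ avg r n F + avg r n G
  avg-+ zero    F G = refl
  avg-+ (suc n) F G rewrite avg-+ n (F ∘ (true ∷_)) (G ∘ (true ∷_)) | avg-+ n (F ∘ (false ∷_)) (G ∘ (false ∷_)) =
    lemma r (avg r n (F ∘ (true ∷_))) (avg r n (G ∘ (true ∷_))) (avg r n (F ∘ (false ∷_))) (avg r n (G ∘ (false ∷_)))
    where lemma : ∀ r a b c d → a + b + r * (c + d) ≡ a + r * c + (b + r * d)
          lemma = solve-∀

  avg-*ˡ : ∀ c n (F : Vec Bool n → ℕ) → avg r n (λ S → c * F S) ≡ c * avg r n F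
  avg-*ˡ c zero    F = refl
  avg-*ˡ c (suc n) F rewrite avg-*ˡ c n (F ∘ (true ∷_)) | avg-*ˡ c n (F ∘ (false ∷_)) = lemma r c _ _
    where lemma : ∀ r c a b → c * a + r * (c * b) ≡ c * (a + r * b)
          lemma = solve-∀

  avg-1 : ∀ n → avg r n (λ _ → 1) ≡ suc r ^ n
  avg-1 zero    = refl
  avg-1 (suc n) rewrite avg-1 n = refl

  avg-0 : ∀ n → avg r n (λ _ → 0) ≡ 0
  avg-0 n = avg-*ˡ 0 n (λ _ → 0)

  avg-sumL : ∀ {A : Set} n (F : A → Vec Bool n → ℕ) xs →
             avg r n (λ S → sumL (λ x → F x S) xs) ≡ sumL (λ x → avg r n (F x)) xs
  avg-sumL n F []       = avg-0 n
  avg-sumL n F (x ∷ xs) = trans (avg-+ n (F x) _) (cong (avg r n (F x) +_) (avg-sumL n F xs))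

  -- Positions are independent, and `u` is sampled with probability `1 / suc r`.
  avg-insert : ∀ {n} (T : Vec Bool n) u → lookup T u ≡ false →
               avg r n (hit (T Vec.[ u ]≔ true)) * suc r ≡ avg r n (hit T)
  avg-insert {suc n} (false ∷ T) zero refl = trans (cong (_* suc r) lem) (*-comm (avg r n (hit T)) (suc r))
    where
    lem : avg r n (λ S → 1 * hit T S) + r * avg r n (λ S → 0 * hit T S) ≡ avg r n (hit T)
    lem rewrite avg-0 n | *-zeroʳ r | +-identityʳ (avg r n (λ S → 1 * hit T S)) = avg-cong n (λ S → *-identityˡ (hit T S))
  avg-insert {suc n} (true ∷ T) (suc u) eq
    rewrite avg-0 n | *-zeroʳ r | avg-*ˡ 1 n (hit (T Vec.[ u ]≔ true)) | avg-*ˡ 1 n (hit T)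
          | +-identityʳ (avg r n (hit (T Vec.[ u ]≔ true))) | +-identityʳ (avg r n (hit T))
          | +-identityʳ (avg r n (hit (T Vec.[ u ]≔ true))) | +-identityʳ (avg r n (hit T)) = avg-insert T u eq
  avg-insert {suc n} (false ∷ T) (suc u) eq with avg-insert T u eq
  ... | ih = trans (lemma r (avg r n (hit (T Vec.[ u ]≔ true)))) (cong (λ z → z + r * z) ih)
    where lemma : ∀ r a → (a + r * a) * suc r ≡ a * suc r + r * (a * suc r)
          lemma = solve-∀

  hit-insert : ∀ {n} (T : Vec Bool n) u → lookup T u ≡ false → ∀ S →
               hit (T Vec.[ u ]≔ true) S ≡ ⟦ lookup S u ⟧ * hit T S
  hit-insert (false ∷ T) zero    eq (s ∷ S) = refl
  hit-insert (true ∷ T)  (suc u) eq (s ∷ S) rewrite hit-insert T u eq S = lemma ⟦ s ⟧ ⟦ lookup S u ⟧ (hit T S)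
    where lemma : ∀ a b c → a * (b * c) ≡ b * (a * c)
          lemma = solve-∀
  hit-insert (false ∷ T) (suc u) eq (s ∷ S) = hit-insert T u eq S

  mark : ∀ {n} → List (Fin n) → Vec Bool n
  mark []       = Vec.replicate _ false
  mark (u ∷ us) = mark us Vec.[ u ]≔ true

  mark-∉ : ∀ {n} {u : Fin n} us → All (u ≢_) us → lookup (mark us) u ≡ false
  mark-∉ {u = u} []       _          = Vec.lookup-replicate u false
  mark-∉ {u = u} (w ∷ us) (u≢w ∷ u∉) = trans (Vec.lookup∘update′ u≢w (mark us) true) (mark-∉ us u∉)

  hit-mark : ∀ {n} {us : List (Fin n)} → Unique us → ∀ S → hit (mark us) S ≡ hits us S
  hit-mark {us = []} _ S = lemma S
    where lemma : ∀ {n} (S : Vec Bool n) → hit (Vec.replicate n false) S ≡ 1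
          lemma []      = refl
          lemma (_ ∷ S) = lemma S
  hit-mark {us = u ∷ us} (u∉ ∷ uniq) S =
    trans (hit-insert (mark us) u (mark-∉ us u∉) S) (cong (⟦ lookup S u ⟧ *_) (hit-mark uniq S))

  avg-hit-mark : ∀ {n} {us : List (Fin n)} → Unique us → avg r n (hit (mark us)) * suc r ^ length us ≡ suc r ^ n
  avg-hit-mark {n} {[]} _ = trans (*-identityʳ _) (trans (avg-cong n (hit-mark {us = []} [])) (avg-1 n))
  avg-hit-mark {n} {u ∷ us} (u∉ ∷ uniq) =
    trans (sym (*-assoc (avg r n (hit (mark (u ∷ us)))) (suc r) (suc r ^ length us)))
      (trans (cong (_* suc r ^ length us) (avg-insert (mark us) u (mark-∉ us u∉))) (avg-hit-mark uniq))

  avg-hits : ∀ {n} {us : List (Fin n)} → Unique us → avg r n (hits us) * suc r ^ length us ≡ suc r ^ n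
  avg-hits {n} {us} uniq = trans (cong (_* suc r ^ length us) (avg-cong n (λ S → sym (hit-mark uniq S)))) (avg-hit-mark uniq)

  module _ {A : Set} {n} (us : A → List (Fin n)) (k : ℕ) (xs : List A)
           (uniq : ∀ {x} → x ∈ xs → Unique (us x)) (len : ∀ {x} → x ∈ xs → length (us x) ≡ k) where

    avg-sum-hits : avg r n (λ S → sumL (λ x → hits (us x) S) xs) * suc r ^ k ≡ length xs * suc r ^ n
    avg-sum-hits = begin
      avg r n (λ S → sumL (λ x → hits (us x) S) xs) * suc r ^ k ≡⟨ cong (_* suc r ^ k) (avg-sumL n (hits ∘ us) xs) ⟩
      sumL (λ x → avg r n (hits (us x))) xs * suc r ^ k         ≡⟨ sym (sumL-*ʳ (suc r ^ k) _ xs) ⟩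
      sumL (λ x → avg r n (hits (us x)) * suc r ^ k) xs         ≡⟨ sumL-cong xs each ⟩
      sumL (λ _ → suc r ^ n) xs                                 ≡⟨ sumL-const _ xs ⟩
      length xs * suc r ^ n                                     ∎
      where
      open ≡-Reasoning
      each : ∀ {x} → x ∈ xs → avg r n (hits (us x)) * suc r ^ k ≡ suc r ^ n
      each {x} x∈ = trans (cong (λ j → avg r n (hits (us x)) * suc r ^ j) (sym (len x∈))) (avg-hits (uniq x∈))

  -- Sampling each vertex with probability 1 / t amplifies the linear bound on the number of edges.
  amplify : ∀ {n} {E C : Set} (ends : E → List (Fin n)) (cends : C → List (Fin n)) (es : List E) (cs : List C) →
            (∀ {e} → e ∈ es → Unique (ends e)) → (∀ {e} → e ∈ es → length (ends e) ≡ 2) →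
            (∀ {c} → c ∈ cs → Unique (cends c)) → (∀ {c} → c ∈ cs → length (cends c) ≡ 4) →
            (∀ S → sumL (λ e → hits (ends e) S) es ≤
                   3 * sumL (λ u → hits (u ∷ []) S) (allFin n) + sumL (λ c → hits (cends c) S) cs) →
            length es * suc r ^ 2 ≤ 3 * n * suc r ^ 3 + length cs
  amplify {n} ends cends es cs eu el cu cl linear =
    -- The expectation of the linear bound, multiplied by `t ^ 4`: a vertex survives with
    -- probability 1 / t, an edge with 1 / t², a crossing with its four distinct ends with 1 / t⁴.
    -- The total weight `t ^ n` is the common denominator.
    *-cancelʳ-≤ _ _ (t ^ n) {{m^n≢0 (suc r) n}} (begin
      length es * t ^ 2 * t ^ n                   ≡⟨ l₁ (length es) (t ^ 2) (t ^ n) ⟩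
      length es * t ^ n * t ^ 2                   ≡⟨ cong (_* t ^ 2) (sym (avg-sum-hits ends 2 es eu el)) ⟩
      aE * t ^ 2 * t ^ 2                          ≡⟨ *-assoc aE (t ^ 2) (t ^ 2) ⟩
      aE * (t ^ 2 * t ^ 2)                        ≡⟨ cong (aE *_) (sym (^-distribˡ-+-* t 2 2)) ⟩
      aE * t ^ 4                                  ≤⟨ *-monoˡ-≤ (t ^ 4) (avg-mono n linear) ⟩
      avg r n (λ S → 3 * V S + K S) * t ^ 4       ≡⟨ cong (_* t ^ 4) (trans (avg-+ n (λ S → 3 * V S) K) (cong (_+ aK) (avg-*ˡ 3 n V))) ⟩
      (3 * aV + aK) * t ^ 4                       ≡⟨ l₂ aV aK (t ^ 3) t ⟩
      3 * (aV * (t * 1)) * t ^ 3 + aK * t ^ 4     ≡⟨ cong₂ (λ x y → 3 * x * t ^ 3 + y) vs (avg-sum-hits cends 4 cs cu cl) ⟩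
      3 * (n * t ^ n) * t ^ 3 + length cs * t ^ n ≡⟨ l₃ n (t ^ n) (t ^ 3) (length cs) ⟩
      (3 * n * t ^ 3 + length cs) * t ^ n         ∎)
    where
    open ≤-Reasoning
    t = suc r
    V K : Vec Bool n → ℕ
    V S = sumL (λ u → hits (u ∷ []) S) (allFin n)
    K S = sumL (λ c → hits (cends c) S) cs
    aE = avg r n (λ S → sumL (λ e → hits (ends e) S) es)
    aV = avg r n V
    aK = avg r n K
    vs : aV * (t * 1) ≡ n * t ^ n
    vs = trans (avg-sum-hits (_∷ []) 1 (allFin n) (λ _ → [] ∷ []) (λ _ → refl))
               (cong (_* t ^ n) (List.length-tabulate {n = n} id))
    l₁ : ∀ a b c → a * b * c ≡ a * c * b
    l₁ = solve-∀
    l₂ : ∀ a b c d → (3 * a + b) * (d * c) ≡ 3 * (a * (d * 1)) * c + b * (d * c)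
    l₂ = solve-∀
    l₃ : ∀ a b c d → 3 * (a * b) * c + d * b ≡ (3 * a * c + d) * b
    l₃ = solve-∀

-- Plane graphs drawn with pseudolines

minimal : ∀ {A : Set} {_≺_ : A → A → Set} → (∀ x y → Dec (x ≺ y)) → (∀ {x y z} → x ≺ y → y ≺ z → x ≺ z) →
          (∀ {x} → ¬ (x ≺ x)) → ∀ {P : A → Set} → (∀ x → Dec (P x)) → ∀ xs →
          (∀ {x} → x ∈ xs → ¬ P x) ⊎ (∃ λ x → x ∈ xs × P x × (∀ {z} → z ∈ xs → P z → ¬ (z ≺ x)))
minimal ≺? tr irr P? [] = inj₁ (λ ())
minimal ≺? tr irr P? (x ∷ xs) with P? x | minimal ≺? tr irr P? xs
... | no ¬p | inj₁ none = inj₁ λ { (here refl) → ¬p ; (there z∈) → none z∈ }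
... | no ¬p | inj₂ (z , z∈ , pz , min) =
  inj₂ (z , there z∈ , pz , λ { (here refl) p _ → ¬p p ; (there w∈) → min w∈ })
... | yes p | inj₁ none =
  inj₂ (x , here refl , p , λ { (here refl) _ → irr ; (there w∈) pw → contradiction pw (none w∈) })
... | yes p | inj₂ (z , z∈ , pz , min) with ≺? x z
...   | yes x≺z = inj₂ (x , here refl , p , λ { (here refl) _ → irr ; (there w∈) pw w≺x → min w∈ pw (tr w≺x x≺z) })
...   | no  x⊀z = inj₂ (z , there z∈ , pz , λ { (here refl) _ → x⊀z ; (there w∈) → min w∈ })

-- Lines are given by their heights val over the abscissae of n points; the i-th point has height y i.
module Pseudolines
  {V : Set} {_≈_ _<ᵥ_ : V → V → Set} (sto : IsStrictTotalOrder _≈_ _<ᵥ_)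
  {n m : ℕ} (y : Fin n → V) (val : Fin m → Fin n → V)
  (convex≤ : ∀ f g {i j k} → i Fin.< j → j Fin.< k → ¬ (val g i <ᵥ val f i) → ¬ (val g k <ᵥ val f k) → ¬ (val g j <ᵥ val f j))
  (convexˡ : ∀ f g {i j k} → i Fin.< j → j Fin.< k → val f i <ᵥ val g i → ¬ (val g k <ᵥ val f k) → val f j <ᵥ val g j)
  (convexʳ : ∀ f g {i j k} → i Fin.< j → j Fin.< k → ¬ (val g i <ᵥ val f i) → val f k <ᵥ val g k → val f j <ᵥ val g j)
  (agree-once : ∀ f g {i j} → i Fin.< j → val f i ≈ val g i → val f j ≈ val g j → f ≡ g)
  where

  open IsStrictTotalOrder sto using (compare; asym; module Eq; <-respʳ-≈; <-respˡ-≈; irrefl) renaming (trans to <ᵥ-trans; _<?_ to _<ᵥ?_)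

  record Edge : Set where
    constructor edge
    field
      line       : Fin m
      left right : Fin n
  open Edge

  infix 4 _≺[_]_ _≍[_]_
  _≺[_]_ _≍[_]_ : Edge → Fin n → Edge → Set
  e ≺[ w ] f = val (line e) w <ᵥ val (line f) w
  e ≍[ w ] f = val (line e) w ≈ val (line f) w

  _∋_ : Edge → Fin n → Set
  e ∋ w = val (line e) w ≈ y w

  record IsEdge (e : Edge) : Set where
    field
      left<right : left e Fin.< right e
      on-left    : e ∋ left e
      on-right   : e ∋ right e
      interior   : ∀ {w} → left e Fin.< w → w Fin.< right e → ¬ (e ∋ w)
  open IsEdge

  -- A crossing is a reversal of order between two abscissae of points. No proper crossing is lost
  -- by this, since the common range of two edges begins and ends at such abscissae. The pair is
  -- ordered: `e` is the lower edge on the left.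
  Crosses : Edge → Edge → Set
  Crosses e f = ∃ λ i → ∃ λ j → (i Fin.< j) × (left e Fin.≤ i × left f Fin.≤ i) ×
                (j Fin.≤ right e × j Fin.≤ right f) × (e ≺[ i ] f × f ≺[ j ] e)

  crosses? : ∀ e f → Dec (Crosses e f)
  crosses? e f = Fin.any? λ i → Fin.any? λ j → (i Fin.<? j) ×-dec ((left e Fin.≤? i) ×-dec (left f Fin.≤? i)) ×-dec
                 ((j Fin.≤? right e) ×-dec (j Fin.≤? right f)) ×-dec ((_ <ᵥ? _) ×-dec (_ <ᵥ? _))

  meet : ∀ {e f w} → e ∋ w → f ∋ w → e ≍[ w ] f
  meet p q = Eq.trans p (Eq.sym q)

  ≍⇒⊀ : ∀ {e f w} → e ≍[ w ] f → ¬ (e ≺[ w ] f)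
  ≍⇒⊀ eq lt = irrefl eq lt

  -- Two lines meeting at `u` keep their order to the right of it: were `f` not above `e` at `v`,
  -- convexity between `u` and `v` would deny `e ≺[ w ] f`.
  extend : ∀ {e f u w v} → u Fin.< w → w Fin.≤ v → e ≍[ u ] f → e ≺[ w ] f → e ≺[ v ] f
  extend {e} {f} {u} {w} {v} u<w w≤v eq lt with Fin.<-cmp w v
  ... | tri> _ _ v<w = contradiction (<-≤-trans v<w w≤v) (<-irrefl refl)
  ... | tri≈ _ refl _ = lt
  ... | tri< w<v _ _ with val (line e) v <ᵥ? val (line f) v
  ...   | yes p = p
  ...   | no ¬p = contradiction lt (convex≤ (line f) (line e) u<w w<v (≍⇒⊀ {e} {f} eq) ¬p)

  -- Edges on one line join consecutive points, so an end of one cannot lie strictly inside the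
  -- other.
  overlap⇒≡ : ∀ {e f} → IsEdge e → IsEdge f → line e ≡ line f → left e Fin.< right f → left f Fin.< right e → e ≡ f
  overlap⇒≡ {edge l u v} {edge l u′ v′} E F refl u<v′ u′<v with Fin.<-cmp u u′ | Fin.<-cmp v v′
  ... | tri< u<u′ _ _ | _ = contradiction (on-left F) (interior E u<u′ u′<v)
  ... | tri> _ _ u′<u | _ = contradiction (on-left E) (interior F u′<u u<v′)
  ... | tri≈ _ refl _ | tri< v<v′ _ _ = contradiction (on-right E) (interior F u′<v v<v′)
  ... | tri≈ _ refl _ | tri> _ _ v′<v = contradiction (on-right F) (interior E u<v′ v′<v)
  ... | tri≈ _ refl _ | tri≈ _ refl _ = refl

  -- Lines that agree at a common end do not change order beyond it. This and `crosses-right≢` make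
  -- the four ends of a crossing distinct, as the exponent 4 in the sampling requires.
  crosses-left≢ : ∀ {e f} → IsEdge e → IsEdge f → Crosses e f → left e ≢ left f
  crosses-left≢ {e} {f} E F (i , j , i<j , (u≤i , _) , _ , (e≺f , f≺e)) refl with Fin.<-cmp (left e) i
  ... | tri> _ _ i<u = <-irrefl refl (<-≤-trans i<u u≤i)
  ... | tri≈ _ refl _ = ≍⇒⊀ {e} {f} (meet {e} {f} (on-left E) (on-left F)) e≺f
  ... | tri< u<i _ _ = asym e≺f (convexʳ (line f) (line e) u<i i<j (≍⇒⊀ {e} {f} (meet {e} {f} (on-left E) (on-left F))) f≺e)

  crosses-right≢ : ∀ {e f} → IsEdge e → IsEdge f → Crosses e f → right e ≢ right f
  crosses-right≢ {e} {f} E F (i , j , i<j , _ , (j≤v , _) , (e≺f , f≺e)) refl with Fin.<-cmp j (right e)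
  ... | tri> _ _ v<j = <-irrefl refl (<-≤-trans v<j j≤v)
  ... | tri≈ _ refl _ = ≍⇒⊀ {f} {e} (meet {f} {e} (on-right F) (on-right E)) f≺e
  ... | tri< j<v _ _ = asym f≺e (convexˡ (line e) (line f) i<j j<v e≺f (≍⇒⊀ {f} {e} (meet {f} {e} (on-right F) (on-right E))))

  switch : ∀ {l l′ i j i′} → i Fin.< j → val l i <ᵥ val l′ i → val l′ j <ᵥ val l j → val l i′ <ᵥ val l′ i′ → i′ Fin.< j
  switch {l} {l′} {i} {j} {i′} i<j p q r with Fin.<-cmp i′ j
  ... | tri< i′<j _ _ = i′<j
  ... | tri≈ _ refl _ = contradiction r (asym q)
  ... | tri> _ _ j<i′ = contradiction (convexˡ l l′ i<j j<i′ p (asym r)) (asym q)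

  -- Two lines change order only once, so by `switch` the two witnessing ranges overlap; hence so do
  -- the edges on each line. Thus crossings are counted by ordered pairs of lines.
  crosses-unique : ∀ {e f e′ f′} → IsEdge e → IsEdge f → IsEdge e′ → IsEdge f′ → line e ≡ line e′ → line f ≡ line f′ →
                   Crosses e f → Crosses e′ f′ → (e , f) ≡ (e′ , f′)
  crosses-unique {e} {f} E F E′ F′ refl refl
    (i , j , i<j , (a₁ , a₂) , (b₁ , b₂) , (p , q)) (i′ , j′ , i′<j′ , (c₁ , c₂) , (d₁ , d₂) , (r , s)) =
    cong₂ _,_ (overlap⇒≡ E E′ refl (≤-<-trans a₁ (<-≤-trans i<j′ d₁)) (≤-<-trans c₁ (<-≤-trans i′<j b₁)))
              (overlap⇒≡ F F′ refl (≤-<-trans a₂ (<-≤-trans i<j′ d₂)) (≤-<-trans c₂ (<-≤-trans i′<j b₂)))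
    where
    i′<j : i′ Fin.< j
    i′<j = switch {line e} {line f} i<j p q r
    i<j′ : i Fin.< j′
    i<j′ = switch {line e} {line f} i′<j′ r s p

  module Planar
    (S : Vec Bool n) (es : List Edge) (isEdge : ∀ {e} → e ∈ es → IsEdge e)
    (S-left : ∀ {e} → e ∈ es → lookup S (left e) ≡ true) (S-right : ∀ {e} → e ∈ es → lookup S (right e) ≡ true)
    (planar : ∀ {e f} → e ∈ es → f ∈ es → ¬ Crosses e f) where

    -- An edge is charged to its left end if it is the topmost edge leaving that end to the right; else to
    -- the leftmost vertex between it and the next such edge f; and, if there is none, to its right end.
    Charge : Fin 3 → Edge → Fin n → Set
    Charge zero e w = w ≡ left e × (∀ {f} → f ∈ es → left f ≡ left e → ¬ (e ≺[ right e ] f))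
    Charge (suc zero) e w = (left e Fin.< w × w Fin.< right e) × (val (line e) w <ᵥ y w) ×
      (∀ {h} → h ∈ es → left h Fin.< w → w Fin.< right h → e ≺[ w ] h → ¬ (val (line h) w <ᵥ y w))
    Charge (suc (suc zero)) e w = w ≡ right e × ∃ λ f → f ∈ es × left f ≡ left e × (e ≺[ right e ] f) ×
      (right e Fin.< right f) ×
      (∀ {h} → h ∈ es → left e Fin.< left h → left h Fin.< right e → e ≺[ left h ] h → f ≺[ left h ] h)

    -- At the nearer right end neither edge is above the other, so the lines agree there as well as
    -- at the common left end.
    charge₀ : ∀ {e f} → e ∈ es → f ∈ es → left e ≡ left f → right e Fin.≤ right f →
              ¬ (e ≺[ right e ] f) → ¬ (f ≺[ right f ] e) → e ≡ f
    charge₀ {e} {f} e∈ f∈ u≡u′ v≤v′ e⊀f f⊀e with compare (val (line e) (right e)) (val (line f) (right e))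
    ... | tri< e≺f _ _ = contradiction e≺f e⊀f
    ... | tri> _ _ f≺e = contradiction (extend {f} {e} (left<right (isEdge e∈)) v≤v′ (agree u≡u′) f≺e) f⊀e
      where agree : left e ≡ left f → f ≍[ left e ] e
            agree refl = meet {f} {e} (on-left (isEdge f∈)) (on-left (isEdge e∈))
    ... | tri≈ _ e≍f _ = overlap⇒≡ E F (agree-once (line e) (line f) (left<right E) (agree u≡u′) e≍f) (u<v′ u≡u′) (u′<v u≡u′)
      where
      E = isEdge e∈
      F = isEdge f∈
      agree : left e ≡ left f → e ≍[ left e ] f
      agree refl = meet {e} {f} (on-left E) (on-left F)
      u<v′ : left e ≡ left f → left e Fin.< right f
      u<v′ refl = left<right F
      u′<v : left e ≡ left f → left f Fin.< right e
      u′<v refl = left<right E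

    upper : ∀ (i j : Fin n) → ∃ λ k → i Fin.≤ k × j Fin.≤ k × (k ≡ i ⊎ k ≡ j)
    upper i j with ≤-total (toℕ i) (toℕ j)
    ... | inj₁ i≤j = j , i≤j , ≤-refl , inj₂ refl
    ... | inj₂ j≤i = i , ≤-refl , j≤i , inj₁ refl

    lower : ∀ (i j : Fin n) → ∃ λ k → k Fin.≤ i × k Fin.≤ j × (k ≡ i ⊎ k ≡ j)
    lower i j with ≤-total (toℕ i) (toℕ j)
    ... | inj₁ i≤j = i , ≤-refl , i≤j , inj₁ refl
    ... | inj₂ j≤i = j , j≤i , ≤-refl , inj₂ refl

    -- Compare the edges at both ends of their common range. Agreement at an end gives a second
    -- common point, equal strict orders contradict the meeting at `w` by convexity, and opposite
    -- orders are a crossing.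
    transversal : ∀ {e f w} → e ∈ es → f ∈ es → left e Fin.< w → left f Fin.< w → w Fin.< right e → w Fin.< right f →
                  e ≍[ w ] f → e ≡ f
    transversal {e} {f} {w} e∈ f∈ u<w u′<w w<v w<v′ e≍f
      with upper (left e) (left f) | lower (right e) (right f)
    ... | i , u≤i , u′≤i , i≡ | j , j≤v , j≤v′ , j≡ = go (compare (val (line e) i) (val (line f) i)) (compare (val (line e) j) (val (line f) j))
      where
      i<w : i Fin.< w
      i<w = case i≡ of λ { (inj₁ refl) → u<w ; (inj₂ refl) → u′<w }
      w<j : w Fin.< j
      w<j = case j≡ of λ { (inj₁ refl) → w<v ; (inj₂ refl) → w<v′ }
      same : line e ≡ line f → e ≡ f
      same l≡ = overlap⇒≡ (isEdge e∈) (isEdge f∈) l≡ (<-trans u<w w<v′) (<-trans u′<w w<v)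
      go : _ → _ → e ≡ f
      go (tri≈ _ eq _) _ = same (agree-once (line e) (line f) i<w eq e≍f)
      go _ (tri≈ _ eq _) = same (agree-once (line e) (line f) w<j e≍f eq)
      go (tri< p _ _) (tri< q _ _) = contradiction (convexˡ (line e) (line f) i<w w<j p (asym q)) (≍⇒⊀ {e} {f} e≍f)
      go (tri> _ _ p) (tri> _ _ q) = contradiction (convexˡ (line f) (line e) i<w w<j p (asym q)) (≍⇒⊀ {f} {e} (Eq.sym e≍f))
      go (tri< p _ _) (tri> _ _ q) = contradiction (i , j , <-trans i<w w<j , (u≤i , u′≤i) , (j≤v , j≤v′) , (p , q)) (planar e∈ f∈)
      go (tri> _ _ p) (tri< q _ _) = contradiction (i , j , <-trans i<w w<j , (u′≤i , u≤i) , (j≤v′ , j≤v) , (p , q)) (planar f∈ e∈)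

    -- Both companions `f` and `f′` pass above the common right end. If `e′` starts above `e`, it
    -- starts above `f` because the region between `e` and `f` is free, and so crosses `f` on its
    -- way down; if it starts below `e`, then so does `f′`, which crosses `e` on its way up.
    charge₂ : ∀ {e e′} → e ∈ es → e′ ∈ es → right e ≡ right e′ → left e Fin.< left e′ →
              Charge (suc (suc zero)) e (right e) → Charge (suc (suc zero)) e′ (right e′) → ⊥
    charge₂ {e} {e′} e∈ e′∈ refl u<u′ (_ , f , f∈ , refl , e≺f , v<a , free) (_ , f′ , f′∈ , refl , e′≺f′ , v<a′ , _)
      with compare (val (line e) (left e′)) (val (line e′) (left e′))
    ... | tri≈ _ e≍e′ _ = interior (isEdge e∈) u<u′ (left<right (isEdge e′∈)) (Eq.trans e≍e′ (on-left (isEdge e′∈)))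
    ... | tri< e≺e′ _ _ = planar f∈ e′∈ (left e′ , right e , left<right (isEdge e′∈) , (<⇒≤ u<u′ , ≤-refl) , (<⇒≤ v<a , ≤-refl) ,
                            (free e′∈ u<u′ (left<right (isEdge e′∈)) e≺e′ , <-respˡ-≈ (meet {e} {e′} (on-right (isEdge e∈)) (on-right (isEdge e′∈))) e≺f))
    ... | tri> _ _ e′≺e = planar f′∈ e∈ (left e′ , right e , left<right (isEdge e′∈) , (≤-refl , <⇒≤ u<u′) , (<⇒≤ v<a′ , ≤-refl) ,
                            (<-respˡ-≈ (meet {e′} {f′} (on-left (isEdge e′∈)) (on-left (isEdge f′∈))) e′≺e ,
                             <-respˡ-≈ (meet {e′} {e} (on-right (isEdge e′∈)) (on-right (isEdge e∈))) e′≺f′))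

    charge-injective : ∀ c {e e′ w} → e ∈ es → e′ ∈ es → Charge c e w → Charge c e′ w → e ≡ e′
    charge-injective zero {e} {e′} e∈ e′∈ (refl , top) (u≡u′ , top′) with ≤-total (toℕ (right e)) (toℕ (right e′))
    ... | inj₁ v≤v′ = charge₀ e∈ e′∈ u≡u′ v≤v′ (top e′∈ (sym u≡u′)) (top′ e∈ u≡u′)
    ... | inj₂ v′≤v = sym (charge₀ e′∈ e∈ (sym u≡u′) v′≤v (top′ e∈ u≡u′) (top e′∈ (sym u≡u′)))
    charge-injective (suc zero) {e} {e′} {w} e∈ e′∈ ((u<w , w<v) , e<y , free) ((u′<w , w<v′) , e′<y , free′)
      with compare (val (line e) w) (val (line e′) w)
    ... | tri< e≺e′ _ _ = contradiction e′<y (free e′∈ u′<w w<v′ e≺e′)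
    ... | tri> _ _ e′≺e = contradiction e<y (free′ e∈ u<w w<v e′≺e)
    ... | tri≈ _ e≍e′ _ = transversal e∈ e′∈ u<w u′<w w<v w<v′ e≍e′
    charge-injective (suc (suc zero)) {e} {e′} e∈ e′∈ (refl , ch) (v≡v′ , ch′) with Fin.<-cmp (left e) (left e′)
    ... | tri< u<u′ _ _ = ⊥-elim (charge₂ e∈ e′∈ v≡v′ u<u′ (refl , ch) (refl , ch′))
    ... | tri> _ _ u′<u = ⊥-elim (charge₂ e′∈ e∈ (sym v≡v′) u′<u (refl , ch′) (refl , ch))
    ... | tri≈ _ u≡u′ _ = same u≡u′ v≡v′
      where
      E  = isEdge e∈
      E′ = isEdge e′∈
      same : left e ≡ left e′ → right e ≡ right e′ → e ≡ e′
      same refl refl = overlap⇒≡ E E′ (agree-once (line e) (line e′) (left<right E) (meet {e} {e′} (on-left E) (on-left E′))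
                                       (meet {e} {e′} (on-right E) (on-right E′))) (left<right E) (left<right E)

    -- The edge `f` is the next one above `e` from the same left end, in the order seen at
    -- `right e`. Everything depends on whether a sampled vertex lies in the region between the two
    -- (`W`), and, if none does, on which of them ends earlier.
    charge : ∀ {e} → e ∈ es → ∃ λ c → ∃ λ w → lookup S w ≡ true × Charge c e w
    charge {e} e∈ with minimal {_≺_ = λ f g → f ≺[ right e ] g} (λ _ _ → _ <ᵥ? _) <ᵥ-trans (irrefl Eq.refl)
                         (λ f → (left f Fin.≟ left e) ×-dec (val (line e) (right e) <ᵥ? val (line f) (right e))) es
    ... | inj₁ top = zero , left e , S-left e∈ , refl , λ f∈ u≡ e≺f → top f∈ (u≡ , e≺f)
    ... | inj₂ (f , f∈ , (u≡ , e≺f) , next) with minimal {_≺_ = Fin._<_} Fin._<?_ Fin.<-trans (<-irrefl refl) W? (allFin n)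
      where
      W : Fin n → Set
      W w = lookup S w ≡ true × (left e Fin.< w × w Fin.< right e) × w Fin.≤ right f × (val (line e) w <ᵥ y w) × ¬ (val (line f) w <ᵥ y w)
      W? : ∀ w → Dec (W w)
      W? w = (lookup S w Bool.≟ true) ×-dec ((left e Fin.<? w) ×-dec (w Fin.<? right e)) ×-dec (w Fin.≤? right f) ×-dec
             (_ <ᵥ? _) ×-dec ¬? (_ <ᵥ? _)
    ...   | inj₂ (w , _ , (Sw , (u<w , w<v) , w≤a , e<y , f≮y) , leftmost) =
      suc zero , w , Sw , (u<w , w<v) , e<y , unblocked u≡
      where
      E = isEdge e∈
      F = isEdge f∈
      -- Why `e` is the edge directly below `w`. An edge `h` between them at `w` cannot start left
      -- of `left e`, since it would cross `e` or `f` or pass through their common end; it cannot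
      -- start at that end, since `f` is the next edge; and if it starts later, its left end is a
      -- vertex of the region to the left of `w`.
      unblocked : left f ≡ left e → ∀ {h} → h ∈ es → left h Fin.< w → w Fin.< right h → e ≺[ w ] h → ¬ (val (line h) w <ᵥ y w)
      unblocked refl {h} h∈ b<w w<c e≺h h<y = go (Fin.<-cmp (left h) (left e))
        where
        H = isEdge h∈
        h≺f : h ≺[ w ] f
        h≺f with compare (val (line h) w) (val (line f) w)
        ... | tri< p _ _ = p
        ... | tri≈ _ q _ = contradiction (<-respˡ-≈ q h<y) f≮y
        ... | tri> _ _ p = contradiction (<ᵥ-trans p h<y) f≮y
        go : _ → ⊥
        go (tri< b<u _ _) with compare (val (line h) (left e)) (val (line e) (left e))
        ... | tri< p _ _ = planar h∈ e∈ (left e , w , u<w , (<⇒≤ b<u , ≤-refl) , (<⇒≤ w<c , <⇒≤ w<v) , (p , e≺h))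
        ... | tri≈ _ q _ = interior H b<u (<-trans u<w w<c) (Eq.trans q (on-left E))
        ... | tri> _ _ p = planar f∈ h∈ (left e , w , u<w , (≤-refl , <⇒≤ b<u) , (w≤a , <⇒≤ w<c) ,
                             (<-respˡ-≈ (meet {e} {f} (on-left E) (on-left F)) p , h≺f))
        go (tri≈ _ refl _) =
          next h∈ (refl , extend {e} {h} u<w (<⇒≤ w<v) (meet {e} {h} (on-left E) (on-left H)) e≺h)
                  (extend {h} {f} u<w (<⇒≤ w<v) (meet {h} {f} (on-left H) (on-left F)) h≺f)
        go (tri> _ _ u<b) = leftmost (∈-allFin (left h)) (S-left h∈ , (u<b , <-trans b<w w<v) , ≤-trans (<⇒≤ b<w) w≤a , above , below) b<w
          where
          above : val (line e) (left h) <ᵥ y (left h)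
          above with compare (val (line e) (left h)) (y (left h))
          ... | tri< p _ _ = p
          ... | tri≈ _ q _ = contradiction q (interior E u<b (<-trans b<w w<v))
          ... | tri> _ _ p = contradiction (left h , w , b<w , (≤-refl , <⇒≤ u<b) , (<⇒≤ w<c , <⇒≤ w<v) , (<-respˡ-≈ (Eq.sym (on-left H)) p , e≺h)) (planar h∈ e∈)
          below : ¬ (val (line f) (left h) <ᵥ y (left h))
          below p = planar f∈ h∈ (left h , w , b<w , (<⇒≤ u<b , ≤-refl) , (w≤a , <⇒≤ w<c) , (<-respʳ-≈ (Eq.sym (on-left H)) p , h≺f))
    ...   | inj₁ none with Fin.<-cmp (right f) (right e)
    ...     | tri≈ _ refl _ = contradiction e≺f (≍⇒⊀ {e} {f} (meet {e} {f} (on-right (isEdge e∈)) (on-right (isEdge f∈))))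
    -- If `f` ends before `e`, its right end is itself a vertex of the region; this is why `W`
    -- includes the boundary formed by `f`.
    ...     | tri< a<v _ _ = contradiction (S-right f∈ , (u<a , a<v) , ≤-refl , above , irrefl (on-right (isEdge f∈)))
                               (none (∈-allFin (right f)))
      where
      u<a : left e Fin.< right f
      u<a = subst (Fin._< right f) u≡ (left<right (isEdge f∈))
      agree : left f ≡ left e → e ≍[ left e ] f
      agree refl = meet {e} {f} (on-left (isEdge e∈)) (on-left (isEdge f∈))
      above : val (line e) (right f) <ᵥ y (right f)
      above = <-respʳ-≈ (on-right (isEdge f∈))
                (convexʳ (line e) (line f) u<a a<v (≍⇒⊀ {f} {e} (Eq.sym (agree u≡))) e≺f)
    ...     | tri> _ _ v<a = suc (suc zero) , right e , S-right e∈ , refl , f , f∈ , u≡ , e≺f , v<a , free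
      where
      free : ∀ {h} → h ∈ es → left e Fin.< left h → left h Fin.< right e → e ≺[ left h ] h → f ≺[ left h ] h
      free {h} h∈ u<b b<v e≺h with val (line f) (left h) <ᵥ? y (left h)
      ... | yes p = <-respʳ-≈ (Eq.sym (on-left (isEdge h∈))) p
      ... | no ¬p = contradiction (S-left h∈ , (u<b , b<v) , <⇒≤ (<-trans b<v v<a) , <-respʳ-≈ (on-left (isEdge h∈)) e≺h , ¬p)
                      (none (∈-allFin (left h)))

    planar-bound : Unique es → length es ≤ 3 * length (filter (λ u → lookup S u Bool.≟ true) (allFin n))
    planar-bound uniq = subst (length es ≤_) (length-× (allFin 3) vs)
      (pigeonhole (λ e cw → Charge (proj₁ cw) e (proj₂ cw)) (cartesianProduct (allFin 3) vs) uniq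
        (λ e∈ → case charge e∈ of λ { (c , w , Sw , ch) →
          (c , w) , ∈-cartesianProduct⁺ (∈-allFin c) (∈-filter⁺ (λ u → lookup S u Bool.≟ true) (∈-allFin w) Sw) , ch })
        (λ { {b = c , w} e∈ e′∈ → charge-injective c e∈ e′∈ }))
      where vs = filter (λ u → lookup S u Bool.≟ true) (allFin n)

  module _ (E : List Edge) (uniqE : Unique E) (isEdge : ∀ {e} → e ∈ E → IsEdge e) where

    private
      ends : Edge → List (Fin n)
      ends e = left e ∷ right e ∷ []

      ends₂ : Edge × Edge → List (Fin n)
      ends₂ (e , f) = left e ∷ right e ∷ left f ∷ right f ∷ []

      crossings : List (Edge × Edge)
      crossings = filter (λ ef → crosses? (proj₁ ef) (proj₂ ef)) (cartesianProduct E E)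

      ∈crossings : ∀ {e f} → (e , f) ∈ crossings → (IsEdge e × IsEdge f) × Crosses e f
      ∈crossings ef∈ with ∈-filter⁻ (λ ef → crosses? (proj₁ ef) (proj₂ ef)) {xs = cartesianProduct E E} ef∈
      ... | p , X with ∈-cartesianProduct⁻ E E p
      ... | e∈ , f∈ = (isEdge e∈ , isEdge f∈) , X

    crossings≤ : length crossings ≤ m * m
    crossings≤ = subst (length crossings ≤_) (trans (length-× (allFin m) (allFin m)) (cong₂ _*_ lm lm))
      (pigeonhole (λ ef ll → line (proj₁ ef) ≡ proj₁ ll × line (proj₂ ef) ≡ proj₂ ll) (cartesianProduct (allFin m) (allFin m))
        (Unique.filter⁺ _ (Unique.cartesianProduct⁺ uniqE uniqE))
        (λ { {e , f} _ → (line e , line f) , ∈-cartesianProduct⁺ (∈-allFin (line e)) (∈-allFin (line f)) , refl , refl })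
        (λ { p q (refl , refl) (l≡ , l′≡) → case (∈crossings p , ∈crossings q) of λ
          { (((E₁ , F₁) , X) , ((E₂ , F₂) , X′)) → crosses-unique E₁ F₁ E₂ F₂ (sym l≡) (sym l′≡) X X′ } }))
      where
      lm : length (allFin m) ≡ m
      lm = List.length-tabulate {n = m} id

    private
      ends-unique : ∀ {e} → e ∈ E → Unique (ends e)
      ends-unique e∈ = (Fin.<⇒≢ (left<right (isEdge e∈)) ∷ []) ∷ [] ∷ []

      ends₂-unique : ∀ {ef} → ef ∈ crossings → Unique (ends₂ ef)
      ends₂-unique {e , f} ef∈ with ∈crossings ef∈
      ... | (E₁ , F₁) , X@(i , j , i<j , (u≤i , u′≤i) , (j≤v , j≤v′) , _) =
        (Fin.<⇒≢ (left<right E₁) ∷ crosses-left≢ E₁ F₁ X ∷ Fin.<⇒≢ (≤-<-trans u≤i (<-≤-trans i<j j≤v′)) ∷ []) ∷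
        ((λ v≡u′ → Fin.<⇒≢ (≤-<-trans u′≤i (<-≤-trans i<j j≤v)) (sym v≡u′)) ∷ crosses-right≢ E₁ F₁ X ∷ []) ∷
        (Fin.<⇒≢ (left<right F₁) ∷ []) ∷ [] ∷ []

      module _ (S : Vec Bool n) where

        Inside : Edge → Set
        Inside e = lookup S (left e) ≡ true × lookup S (right e) ≡ true

        inside? : ∀ e → Dec (Inside e)
        inside? e = (lookup S (left e) Bool.≟ true) ×-dec (lookup S (right e) Bool.≟ true)

        es es′ : List Edge
        es = filter inside? E
        Clean : Edge → Set
        Clean e = ¬ Any.Any (Crosses e) es
        clean? : ∀ e → Dec (Clean e)
        clean? e = ¬? (Any.any? (crosses? e) es)
        es′ = filter clean? es

        inside-hits : ∀ e → ⟦ does (inside? e) ⟧ ≡ hits (ends e) S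
        inside-hits e with lookup S (left e) | lookup S (right e)
        ... | true  | true  = refl
        ... | true  | false = refl
        ... | false | true  = refl
        ... | false | false = refl

        ∈es : ∀ {e} → e ∈ es → e ∈ E × Inside e
        ∈es = ∈-filter⁻ inside? {xs = E}

        ∈es′ : ∀ {e} → e ∈ es′ → e ∈ es × Clean e
        ∈es′ = ∈-filter⁻ clean? {xs = es}

        vertices : List (Fin n)
        vertices = filter (λ u → lookup S u Bool.≟ true) (allFin n)

        clean≤ : length es′ ≤ 3 * length vertices
        clean≤ = Planar.planar-bound S es′ (λ e∈ → isEdge (proj₁ (∈es (proj₁ (∈es′ e∈)))))
          (λ e∈ → proj₁ (proj₂ (∈es (proj₁ (∈es′ e∈))))) (λ e∈ → proj₂ (proj₂ (∈es (proj₁ (∈es′ e∈)))))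
          (λ e∈ f∈ X → proj₂ (∈es′ e∈) (lose (proj₁ (∈es′ f∈)) X))
          (Unique.filter⁺ clean? (Unique.filter⁺ inside? uniqE))

        -- The deletion argument: an edge that is not clean is paid for by a crossing, and the clean
        -- edges form a plane graph.
        one : ∀ e xs → 1 ≤ ⟦ does (¬? (Any.any? (crosses? e) xs)) ⟧ + sumL (λ f → ⟦ does (crosses? e f) ⟧) xs
        one e []       = s≤s z≤n
        one e (f ∷ xs) with crosses? e f
        ... | yes _ = s≤s z≤n
        ... | no  _ with Any.any? (crosses? e) xs | one e xs
        ...   | yes _ | p = p
        ...   | no  _ | p = p

        linear : length es ≤ 3 * length vertices + sumL (λ e → sumL (λ f → ⟦ does (crosses? e f) ⟧) es) es
        linear = begin
          length es                                      ≡⟨ sym (trans (sumL-const 1 es) (*-identityʳ (length es))) ⟩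
          sumL (λ _ → 1) es                              ≤⟨ sumL-mono es (λ {e} _ → one e es) ⟩
          sumL (λ e → ⟦ does (clean? e) ⟧ + _) es        ≡⟨ sumL-+ (λ e → ⟦ does (clean? e) ⟧) _ es ⟩
          sumL (λ e → ⟦ does (clean? e) ⟧) es + X        ≡⟨ cong (_+ X) (sym (length-filter≡sumL clean? es)) ⟩
          length es′ + X                                 ≤⟨ +-monoˡ-≤ X clean≤ ⟩
          3 * length vertices + X                        ∎
          where
          open ≤-Reasoning
          X = sumL (λ e → sumL (λ f → ⟦ does (crosses? e f) ⟧) es) es

        sampled : sumL (λ e → hits (ends e) S) E ≤
                  3 * sumL (λ u → hits (u ∷ []) S) (allFin n) + sumL (λ c → hits (ends₂ c) S) crossings
        sampled = subst₂ _≤_ lhs (cong₂ (λ a b → 3 * a + b) vert cross) linear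
          where
          lhs : length es ≡ sumL (λ e → hits (ends e) S) E
          lhs = trans (length-filter≡sumL inside? E) (sumL-cong E (λ {e} _ → inside-hits e))
          vert : length vertices ≡ sumL (λ u → hits (u ∷ []) S) (allFin n)
          vert = trans (length-filter≡sumL _ (allFin n)) (sumL-cong (allFin n) (λ {u} _ → aux (lookup S u)))
            where aux : ∀ b → ⟦ does (b Bool.≟ true) ⟧ ≡ ⟦ b ⟧ * 1
                  aux true  = refl
                  aux false = refl
          cross : sumL (λ e → sumL (λ f → ⟦ does (crosses? e f) ⟧) es) es ≡ sumL (λ c → hits (ends₂ c) S) crossings
          cross = begin
            sumL (λ e → sumL (λ f → x e f) es) es
              ≡⟨ sumL-filter inside? _ E ⟩
            sumL (λ e → ⟦ does (inside? e) ⟧ * sumL (λ f → x e f) es) E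
              ≡⟨ sumL-cong E (λ {e} _ → trans (cong (⟦ does (inside? e) ⟧ *_) (sumL-filter inside? (x e) E)) (sym (sumL-*ˡ ⟦ does (inside? e) ⟧ _ E))) ⟩
            sumL (λ e → sumL (λ f → ⟦ does (inside? e) ⟧ * (⟦ does (inside? f) ⟧ * x e f)) E) E
              ≡⟨ sumL-cong E (λ {e} _ → sumL-cong E (λ {f} _ → each e f)) ⟩
            sumL (λ e → sumL (λ f → x e f * hits (ends₂ (e , f)) S) E) E
              ≡⟨ sym (sumL-× (λ ef → x (proj₁ ef) (proj₂ ef) * hits (ends₂ ef) S) E E) ⟩
            sumL (λ ef → x (proj₁ ef) (proj₂ ef) * hits (ends₂ ef) S) (cartesianProduct E E)
              ≡⟨ sym (sumL-filter (λ ef → crosses? (proj₁ ef) (proj₂ ef)) (λ ef → hits (ends₂ ef) S) (cartesianProduct E E)) ⟩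
            sumL (λ c → hits (ends₂ c) S) crossings ∎
            where
            open ≡-Reasoning
            x : Edge → Edge → ℕ
            x e f = ⟦ does (crosses? e f) ⟧
            reassoc : ∀ a b c d x → a * (b * 1) * ((c * (d * 1)) * x) ≡ x * (a * (b * (c * (d * 1))))
            reassoc = solve-∀
            each : ∀ e f → ⟦ does (inside? e) ⟧ * (⟦ does (inside? f) ⟧ * x e f) ≡ x e f * hits (ends₂ (e , f)) S
            each e f rewrite inside-hits e | inside-hits f =
              reassoc ⟦ lookup S (left e) ⟧ ⟦ lookup S (right e) ⟧ ⟦ lookup S (left f) ⟧ ⟦ lookup S (right f) ⟧ (x e f)

    crossing-inequality : ∀ r → length E * suc r ^ 2 ≤ 3 * n * suc r ^ 3 + m * m
    crossing-inequality r = ≤-trans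
      (amplify r ends ends₂ E crossings ends-unique (λ _ → refl) ends₂-unique (λ _ → refl) sampled)
      (+-monoʳ-≤ _ crossings≤)

-- Edges from traces

size : ∀ {n} → Vec Bool n → ℕ
size []      = 0
size (b ∷ T) = ⟦ b ⟧ + size T

first : ∀ {n} → Vec Bool n → Maybe (Fin n)
first []          = nothing
first (true ∷ T)  = just zero
first (false ∷ T) with first T
... | just w  = just (suc w)
... | nothing = nothing

first-just : ∀ {n} (T : Vec Bool n) {w} → first T ≡ just w →
             lookup T w ≡ true × (∀ {v} → v Fin.< w → lookup T v ≡ false)
first-just (true ∷ T) refl = refl , λ ()
first-just (false ∷ T) eq with first T in eqT | eq
... | just w | refl = proj₁ (first-just T eqT) , λ { {zero} _ → refl ; {suc v} (s≤s v<w) → proj₂ (first-just T eqT) v<w }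

first-nothing : ∀ {n} (T : Vec Bool n) → first T ≡ nothing → size T ≡ 0
first-nothing []          eq = refl
first-nothing (false ∷ T) eq with first T in eqT
... | nothing = first-nothing T eqT

first-size : ∀ {n} (T : Vec Bool n) {w} → first T ≡ just w → 1 ≤ size T
first-size (true ∷ T) eq = s≤s z≤n
first-size (false ∷ T) eq with first T in eqT
... | just w = first-size T eqT

suc² : ∀ {n} → Fin n × Fin n → Fin (suc n) × Fin (suc n)
suc² (u , v) = suc u , suc v

segments : ∀ {n} → Vec Bool n → List (Fin n × Fin n)
segments []          = []
segments (false ∷ T) = map suc² (segments T)
segments (true ∷ T) with first T
... | nothing = []
... | just w  = (zero , suc w) ∷ map suc² (segments T)

length-segments : ∀ {n} (T : Vec Bool n) → length (segments T) ≡ size T ∸ 1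
length-segments []          = refl
length-segments (false ∷ T) = trans (List.length-map suc² (segments T)) (length-segments T)
length-segments (true ∷ T) with first T in eq
... | nothing = sym (first-nothing T eq)
... | just w  = trans (cong suc (trans (List.length-map suc² (segments T)) (length-segments T))) (m+[n∸m]≡n (first-size T eq))

record Consecutive {n} (T : Vec Bool n) (uv : Fin n × Fin n) : Set where
  field
    ordered : proj₁ uv Fin.< proj₂ uv
    start   : lookup T (proj₁ uv) ≡ true
    end     : lookup T (proj₂ uv) ≡ true
    between : ∀ {w} → proj₁ uv Fin.< w → w Fin.< proj₂ uv → lookup T w ≡ false

consecutive-suc : ∀ {n} b {T : Vec Bool n} {uv} → Consecutive T uv → Consecutive (b ∷ T) (suc² uv)
consecutive-suc b c = record
  { ordered = s≤s ordered ; start = start ; end = end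
  ; between = λ { {suc w} (s≤s p) (s≤s q) → between p q } }
  where open Consecutive c

consecutive : ∀ {n} (T : Vec Bool n) {uv} → uv ∈ segments T → Consecutive T uv
consecutive (false ∷ T) uv∈ with ∈-map⁻ suc² uv∈
... | _ , uv∈′ , refl = consecutive-suc false (consecutive T uv∈′)
consecutive (true ∷ T) uv∈ with first T in eq | uv∈
... | just w | here refl = record
  { ordered = s≤s z≤n ; start = refl ; end = proj₁ (first-just T eq)
  ; between = λ { {suc v} _ (s≤s q) → proj₂ (first-just T eq) q } }
... | just w | there uv∈₁ with ∈-map⁻ suc² uv∈₁
...   | _ , uv∈′ , refl = consecutive-suc true (consecutive T uv∈′)

suc²-injective : ∀ {n} {p q : Fin n × Fin n} → suc² p ≡ suc² q → p ≡ q
suc²-injective {p = _ , _} {q = _ , _} refl = refl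

segments-unique : ∀ {n} (T : Vec Bool n) → Unique (segments T)
segments-unique []          = []
segments-unique (false ∷ T) = Unique.map⁺ suc²-injective (segments-unique T)
segments-unique (true ∷ T) with first T
... | nothing = []
... | just w  = All.map⁺ (All.tabulate (λ _ ())) ∷ Unique.map⁺ suc²-injective (segments-unique T)

sumL-lookup : ∀ {A : Set} (f : A → ℕ) (xs : List A) → sumL (λ i → f (List.lookup xs i)) (allFin (length xs)) ≡ sumL f xs
sumL-lookup f xs = trans (sym (sumL-map f (List.lookup xs) (allFin (length xs))))
  (cong (sumL f) (trans (List.map-tabulate id (List.lookup xs)) (List.tabulate-lookup xs)))

lookup-injective : ∀ {A : Set} {xs : List A} → Unique xs → ∀ i j → List.lookup xs i ≡ List.lookup xs j → i ≡ j
lookup-injective (x∉ ∷ u) zero    zero    eq = refl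
lookup-injective (x∉ ∷ u) zero    (suc j) eq = contradiction eq (All.lookup x∉ (∈-lookup j))
lookup-injective (x∉ ∷ u) (suc i) zero    eq = contradiction (sym eq) (All.lookup x∉ (∈-lookup i))
lookup-injective (x∉ ∷ u) (suc i) (suc j) eq = cong suc (lookup-injective u i j eq)

module TracedPseudolines
  {V : Set} {_≈_ _<ᵥ_ : V → V → Set} (sto : IsStrictTotalOrder _≈_ _<ᵥ_)
  {n : ℕ} (y : Fin n → V) (Ts : List (Vec Bool n)) (val : Fin (length Ts) → Fin n → V)
  (convex≤ : ∀ f g {i j k} → i Fin.< j → j Fin.< k → ¬ (val g i <ᵥ val f i) → ¬ (val g k <ᵥ val f k) → ¬ (val g j <ᵥ val f j))
  (convexˡ : ∀ f g {i j k} → i Fin.< j → j Fin.< k → val f i <ᵥ val g i → ¬ (val g k <ᵥ val f k) → val f j <ᵥ val g j)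
  (convexʳ : ∀ f g {i j k} → i Fin.< j → j Fin.< k → ¬ (val g i <ᵥ val f i) → val f k <ᵥ val g k → val f j <ᵥ val g j)
  (agree-once : ∀ f g {i j} → i Fin.< j → val f i ≈ val g i → val f j ≈ val g j → f ≡ g)
  (trace⇒on : ∀ l w → lookup (List.lookup Ts l) w ≡ true → val l w ≈ y w)
  (on⇒trace : ∀ l w → val l w ≈ y w → lookup (List.lookup Ts l) w ≡ true)
  where

  open Pseudolines sto y val convex≤ convexˡ convexʳ agree-once

  private
    edgeOn : Fin (length Ts) → Fin n × Fin n → Edge
    edgeOn l (u , v) = edge l u v

    edgesOn : List (Fin (length Ts)) → List Edge
    edgesOn []       = []
    edgesOn (l ∷ ls) = map (edgeOn l) (segments (List.lookup Ts l)) ++ edgesOn ls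

    edgesOn-line : ∀ ls {e} → e ∈ edgesOn ls → Edge.line e ∈ ls × IsEdge e
    edgesOn-line (l ∷ ls) e∈ with ∈-++⁻ (map (edgeOn l) (segments (List.lookup Ts l))) e∈
    ... | inj₂ e∈₂ = there (proj₁ (edgesOn-line ls e∈₂)) , proj₂ (edgesOn-line ls e∈₂)
    ... | inj₁ e∈₁ with ∈-map⁻ (edgeOn l) e∈₁
    ...   | (u , v) , uv∈ , refl = here refl , record
      { left<right = ordered ; on-left = trace⇒on l u start ; on-right = trace⇒on l v end
      ; interior = λ p q on → case trans (sym (on⇒trace l _ on)) (between p q) of λ () }
      where open Consecutive (consecutive (List.lookup Ts l) uv∈)

    edgesOn-unique : ∀ {ls} → Unique ls → Unique (edgesOn ls)
    edgesOn-unique {[]}     _         = []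
    edgesOn-unique {l ∷ ls} (l∉ ∷ u) =
      Unique.++⁺ (Unique.map⁺ (λ { refl → refl }) (segments-unique (List.lookup Ts l))) (edgesOn-unique u)
        (λ { (p , q) → case ∈-map⁻ (edgeOn l) p of λ { (_ , _ , refl) → All.lookup l∉ (proj₁ (edgesOn-line ls q)) refl } })

    length-edgesOn : ∀ ls → length (edgesOn ls) ≡ sumL (λ l → size (List.lookup Ts l) ∸ 1) ls
    length-edgesOn []       = refl
    length-edgesOn (l ∷ ls) = trans (List.length-++ (map (edgeOn l) (segments (List.lookup Ts l))))
      (cong₂ _+_ (trans (List.length-map (edgeOn l) (segments (List.lookup Ts l))) (length-segments (List.lookup Ts l))) (length-edgesOn ls))

  incidence-inequality : ∀ r → sumL (λ T → size T ∸ 1) Ts * suc r ^ 2 ≤ 3 * n * suc r ^ 3 + length Ts * length Ts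
  incidence-inequality r = subst (λ e → e * suc r ^ 2 ≤ 3 * n * suc r ^ 3 + length Ts * length Ts)
    (trans (length-edgesOn (allFin (length Ts))) (sumL-lookup (λ T → size T ∸ 1) Ts))
    (crossing-inequality (edgesOn (allFin (length Ts))) (edgesOn-unique (Unique.allFin⁺ (length Ts)))
      (λ e∈ → proj₂ (edgesOn-line (allFin (length Ts)) e∈)) r)

-- Ordered fields

-- With integer coefficients the solver can cancel terms, which it cannot decide to do in an abstract ring.
module IntegerCoefficients (R : CommutativeRing 0ℓ 0ℓ) where
  private
    module R = CommutativeRing R
    open R using (_≈_; 0#; 1#)
    open RingProperties R.ring
    open Mult R.semiring renaming (_×_ to _•_)
    open SetoidReasoning R.setoid

    ⟦_⟧ᶻ : ℤ → R.Carrier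
    ⟦ ℤ.+ n ⟧ᶻ      = n • 1#
    ⟦ ℤ.-[1+ n ] ⟧ᶻ = R.- (suc n • 1#)

    cancel-1 : ∀ x y → ((1# R.+ x) R.- (1# R.+ y)) ≈ (x R.- y)
    cancel-1 x y = begin
      (1# R.+ x) R.+ R.- (1# R.+ y)           ≈⟨ R.+-cong (R.+-comm 1# x) (R.sym (-‿+-comm 1# y)) ⟩
      (x R.+ 1#) R.+ (R.- 1# R.+ R.- y)       ≈⟨ R.+-assoc x 1# _ ⟩
      x R.+ (1# R.+ (R.- 1# R.+ R.- y))       ≈⟨ R.+-congˡ (R.sym (R.+-assoc 1# _ _)) ⟩
      x R.+ ((1# R.+ R.- 1#) R.+ R.- y)       ≈⟨ R.+-congˡ (R.+-congʳ (R.-‿inverseʳ 1#)) ⟩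
      x R.+ (0# R.+ R.- y)                    ≈⟨ R.+-congˡ (R.+-identityˡ _) ⟩
      x R.- y                                 ∎

    ⊖-homo : ∀ m n → ⟦ m ℤ.⊖ n ⟧ᶻ ≈ ((m • 1#) R.- (n • 1#))
    ⊖-homo m zero = begin
      m • 1#             ≈⟨ R.sym (R.+-identityʳ _) ⟩
      (m • 1#) R.+ 0#    ≈⟨ R.+-congˡ (R.sym -0#≈0#) ⟩
      (m • 1#) R.- 0#    ∎
    ⊖-homo zero    (suc n) = R.sym (R.+-identityˡ _)
    ⊖-homo (suc m) (suc n) = begin
      ⟦ suc m ℤ.⊖ suc n ⟧ᶻ                            ≈⟨ R.reflexive (cong ⟦_⟧ᶻ (ℤ.[1+m]⊖[1+n]≡m⊖n m n)) ⟩
      ⟦ m ℤ.⊖ n ⟧ᶻ                                    ≈⟨ ⊖-homo m n ⟩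
      (m • 1#) R.- (n • 1#)                           ≈⟨ R.sym (cancel-1 _ _) ⟩
      (1# R.+ (m • 1#)) R.- (1# R.+ (n • 1#))         ≈⟨ R.+-cong (R.sym (1+× m 1#)) (R.-‿cong (R.sym (1+× n 1#))) ⟩
      (suc m • 1#) R.- (suc n • 1#)                   ∎

    +-homoᶻ : ∀ i j → ⟦ i ℤ.+ j ⟧ᶻ ≈ (⟦ i ⟧ᶻ R.+ ⟦ j ⟧ᶻ)
    +-homoᶻ (ℤ.+ m)      (ℤ.+ n)      = ×-homo-+ 1# m n
    +-homoᶻ (ℤ.+ m)      (ℤ.-[1+ n ]) = ⊖-homo m (suc n)
    +-homoᶻ (ℤ.-[1+ m ]) (ℤ.+ n)      = R.trans (⊖-homo n (suc m)) (R.+-comm _ _)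
    +-homoᶻ (ℤ.-[1+ m ]) (ℤ.-[1+ n ]) = begin
      R.- (suc (suc (m + n)) • 1#)                  ≈⟨ R.-‿cong (R.reflexive (cong (_• 1#) (cong suc (sym (+-suc m n))))) ⟩
      R.- ((suc m + suc n) • 1#)                    ≈⟨ R.-‿cong (×-homo-+ 1# (suc m) (suc n)) ⟩
      R.- ((suc m • 1#) R.+ (suc n • 1#))           ≈⟨ R.sym (-‿+-comm _ _) ⟩
      R.- (suc m • 1#) R.+ R.- (suc n • 1#)         ∎

    -‿homoᶻ : ∀ i → ⟦ ℤ.- i ⟧ᶻ ≈ (R.- ⟦ i ⟧ᶻ)
    -‿homoᶻ (ℤ.+ zero)    = R.sym -0#≈0#
    -‿homoᶻ (ℤ.+ suc n)   = R.refl
    -‿homoᶻ (ℤ.-[1+ n ]) = R.sym (-‿involutive _)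

    ◃-homo : ∀ n → ⟦ Sign.- ℤ.◃ n ⟧ᶻ ≈ (R.- (n • 1#))
    ◃-homo zero    = R.sym -0#≈0#
    ◃-homo (suc n) = R.refl

    +◃-homo : ∀ n → ⟦ Sign.+ ℤ.◃ n ⟧ᶻ ≈ (n • 1#)
    +◃-homo zero    = R.refl
    +◃-homo (suc n) = R.refl

    *-homoᶻ : ∀ i j → ⟦ i ℤ.* j ⟧ᶻ ≈ (⟦ i ⟧ᶻ R.* ⟦ j ⟧ᶻ)
    *-homoᶻ (ℤ.+ m)      (ℤ.+ n)      = R.trans (+◃-homo (m * n)) (×1-homo-* m n)
    *-homoᶻ (ℤ.+ m)      (ℤ.-[1+ n ]) = R.trans (◃-homo (m * suc n)) (R.trans (R.-‿cong (×1-homo-* m (suc n))) (-‿distribʳ-* _ _))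
    *-homoᶻ (ℤ.-[1+ m ]) (ℤ.+ n)      = R.trans (◃-homo (suc m * n)) (R.trans (R.-‿cong (×1-homo-* (suc m) n)) (-‿distribˡ-* _ _))
    *-homoᶻ (ℤ.-[1+ m ]) (ℤ.-[1+ n ]) = begin
      (suc m * suc n) • 1#                          ≈⟨ ×1-homo-* (suc m) (suc n) ⟩
      (suc m • 1#) R.* (suc n • 1#)                 ≈⟨ R.sym (-‿involutive _) ⟩
      R.- R.- ((suc m • 1#) R.* (suc n • 1#))       ≈⟨ R.-‿cong (-‿distribˡ-* _ _) ⟩
      R.- (R.- (suc m • 1#) R.* (suc n • 1#))       ≈⟨ -‿distribʳ-* _ _ ⟩
      R.- (suc m • 1#) R.* R.- (suc n • 1#)         ∎

  morphism : ℤ.+-*-rawRing -Raw-AlmostCommutative⟶ fromCommutativeRing R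
  morphism = record
    { ⟦_⟧ = ⟦_⟧ᶻ ; +-homo = +-homoᶻ ; *-homo = *-homoᶻ ; -‿homo = -‿homoᶻ ; 0-homo = R.refl ; 1-homo = R.refl }

  coefficient≟ : ∀ i j → Maybe (⟦ i ⟧ᶻ ≈ ⟦ j ⟧ᶻ)
  coefficient≟ i j with i ℤ.≟ j
  ... | yes refl = just R.refl
  ... | no _     = nothing

  open RingSolver ℤ.+-*-rawRing (fromCommutativeRing R) morphism coefficient≟ public

module OrderedField (R : RealField) where
  module 𝔽 = RealField R
  open 𝔽 using (Carrier; commutativeRing; _≈_; 0#; 1#; setoid; +-cong; +-congˡ; +-congʳ; *-congˡ; *-congʳ; -‿cong; -‿inverseʳ;
                zeroʳ; 0<1; *-pos; inverse; isStrictTotalOrder)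
    renaming (_+_ to _⊕_; _*_ to _⊗_; -_ to ⊖_; _<_ to _≺_; _-_ to _⊝_; refl to ≈-refl; sym to ≈-sym; trans to ≈-trans)
  open IsStrictTotalOrder isStrictTotalOrder using (compare; asym; <-respʳ-≈; <-respˡ-≈; irrefl) renaming (trans to ≺-trans)

  open IntegerCoefficients commutativeRing public using (solve; _:=_; _:+_; _:*_; :-_; _:-_; con)

  ≺⇒pos : ∀ {x y} → x ≺ y → 0# ≺ (y ⊝ x)
  ≺⇒pos {x} x≺y = <-respˡ-≈ (-‿inverseʳ x) (𝔽.+-mono-< (⊖ x) x≺y)

  pos⇒≺ : ∀ {x y} → 0# ≺ (y ⊝ x) → x ≺ y
  pos⇒≺ {x} {y} p = <-respʳ-≈ (lemma x y) (<-respˡ-≈ (𝔽.+-identityˡ x) (𝔽.+-mono-< x p))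
    where lemma : ∀ x y → ((y ⊝ x) ⊕ x) ≈ y
          lemma = solve 2 (λ x y → ((y :- x) :+ x) := y) ≈-refl

  sum-pos : ∀ {x y} → 0# ≺ x → ¬ (y ≺ 0#) → 0# ≺ (x ⊕ y)
  sum-pos {x} {y} p q with compare y 0#
  ... | tri< r _ _ = contradiction r q
  ... | tri≈ _ r _ = <-respʳ-≈ (≈-trans (≈-sym (𝔽.+-identityʳ x)) (+-congˡ (≈-sym r))) p
  ... | tri> _ _ r = ≺-trans r (<-respˡ-≈ (𝔽.+-identityˡ y) (𝔽.+-mono-< y p))

  neg⇒pos : ∀ {x} → x ≺ 0# → 0# ≺ (⊖ x)
  neg⇒pos {x} p = <-respʳ-≈ (𝔽.+-identityˡ (⊖ x)) (≺⇒pos p)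

  pos⇒neg : ∀ {x} → 0# ≺ (⊖ x) → x ≺ 0#
  pos⇒neg {x} p = pos⇒≺ (<-respʳ-≈ (≈-sym (𝔽.+-identityˡ (⊖ x))) p)

  *-nonneg : ∀ {a x} → 0# ≺ a → ¬ (x ≺ 0#) → ¬ ((a ⊗ x) ≺ 0#)
  *-nonneg {a} {x} p q with compare x 0#
  ... | tri< r _ _ = contradiction r q
  ... | tri≈ _ r _ = irrefl (≈-trans (*-congˡ r) (zeroʳ a))
  ... | tri> _ _ r = asym (*-pos p r)

  *-neg : ∀ {a x} → 0# ≺ a → x ≺ 0# → (a ⊗ x) ≺ 0#
  *-neg {a} {x} p q = pos⇒neg (<-respʳ-≈ (lemma a x) (*-pos p (neg⇒pos q)))
    where lemma : ∀ a x → (a ⊗ (⊖ x)) ≈ (⊖ (a ⊗ x))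
          lemma = solve 2 (λ a x → (a :* (:- x)) := (:- (a :* x))) ≈-refl

  cancel-pos : ∀ {a x} → 0# ≺ a → 0# ≺ (a ⊗ x) → 0# ≺ x
  cancel-pos {a} {x} p q with compare x 0#
  ... | tri< r _ _ = contradiction q (asym (*-neg p r))
  ... | tri≈ _ r _ = contradiction q (irrefl (≈-sym (≈-trans (*-congˡ r) (zeroʳ a))))
  ... | tri> _ _ r = r

  cancel-nonneg : ∀ {a x} → 0# ≺ a → ¬ ((a ⊗ x) ≺ 0#) → ¬ (x ≺ 0#)
  cancel-nonneg p q r = q (*-neg p r)

  cancel-zero : ∀ {a x} → 0# ≺ a → (a ⊗ x) ≈ 0# → x ≈ 0#
  cancel-zero {a} {x} p q with compare x 0#
  ... | tri< r _ _ = contradiction (*-neg p r) (irrefl q)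
  ... | tri≈ _ r _ = r
  ... | tri> _ _ r = contradiction (*-pos p r) (irrefl (≈-sym q))

  diff-zero⇒≈ : ∀ {x y} → (y ⊝ x) ≈ 0# → x ≈ y
  diff-zero⇒≈ {x} {y} p = ≈-trans (≈-sym (𝔽.+-identityˡ x)) (≈-trans (+-congʳ (≈-sym p)) (lemma x y))
    where lemma : ∀ x y → ((y ⊝ x) ⊕ x) ≈ y
          lemma = solve 2 (λ x y → ((y :- x) :+ x) := y) ≈-refl

  ≈⇒diff-zero : ∀ {x y} → x ≈ y → (y ⊝ x) ≈ 0#
  ≈⇒diff-zero {x} {y} p = ≈-trans (+-congˡ (-‿cong p)) (-‿inverseʳ y)

  infixl 5 _at_
  _at_ : Carrier × Carrier → Carrier → Carrier
  (α , β) at x = (α ⊗ x) ⊕ β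

  -- The difference `g - f` at `x₂` is a convex combination of its values at `x₁` and `x₃`, here
  -- with cleared denominators. The convexity and uniqueness properties of pseudolines are read off
  -- from the signs of the terms.
  interpolate : ∀ f g x₁ x₂ x₃ → ((x₃ ⊝ x₁) ⊗ ((g at x₂) ⊝ (f at x₂))) ≈
                (((x₃ ⊝ x₂) ⊗ ((g at x₁) ⊝ (f at x₁))) ⊕ ((x₂ ⊝ x₁) ⊗ ((g at x₃) ⊝ (f at x₃))))
  interpolate (α , β) (α′ , β′) x₁ x₂ x₃ = lemma α β α′ β′ x₁ x₂ x₃
    where
    lemma : ∀ α β α′ β′ x₁ x₂ x₃ → ((x₃ ⊝ x₁) ⊗ (((α′ ⊗ x₂) ⊕ β′) ⊝ ((α ⊗ x₂) ⊕ β))) ≈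
            (((x₃ ⊝ x₂) ⊗ (((α′ ⊗ x₁) ⊕ β′) ⊝ ((α ⊗ x₁) ⊕ β))) ⊕ ((x₂ ⊝ x₁) ⊗ (((α′ ⊗ x₃) ⊕ β′) ⊝ ((α ⊗ x₃) ⊕ β))))
    lemma = solve 7 (λ α β α′ β′ x₁ x₂ x₃ → ((x₃ :- x₁) :* (((α′ :* x₂) :+ β′) :- ((α :* x₂) :+ β))) := (((x₃ :- x₂) :* (((α′ :* x₁) :+ β′) :- ((α :* x₁) :+ β))) :+ ((x₂ :- x₁) :* (((α′ :* x₃) :+ β′) :- ((α :* x₃) :+ β))))) ≈-refl

  ⊀⇒nonneg : ∀ {x y} → ¬ (y ≺ x) → ¬ ((y ⊝ x) ≺ 0#)
  ⊀⇒nonneg {x} {y} p q = p (pos⇒≺ (<-respʳ-≈ (lemma x y) (neg⇒pos q)))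
    where lemma : ∀ x y → (⊖ (y ⊝ x)) ≈ (x ⊝ y)
          lemma = solve 2 (λ x y → (:- (y :- x)) := (x :- y)) ≈-refl

  nonneg⇒⊀ : ∀ {x y} → ¬ ((y ⊝ x) ≺ 0#) → ¬ (y ≺ x)
  nonneg⇒⊀ {x} {y} p q = p (pos⇒neg (<-respʳ-≈ (lemma x y) (≺⇒pos q)))
    where lemma : ∀ x y → (x ⊝ y) ≈ (⊖ (y ⊝ x))
          lemma = solve 2 (λ x y → (x :- y) := (:- (y :- x))) ≈-refl

  affine≤ : ∀ f g {x₁ x₂ x₃} → x₁ ≺ x₂ → x₂ ≺ x₃ → ¬ ((g at x₁) ≺ (f at x₁)) → ¬ ((g at x₃) ≺ (f at x₃)) → ¬ ((g at x₂) ≺ (f at x₂))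
  affine≤ f g {x₁} {x₂} {x₃} p q r s = nonneg⇒⊀ (cancel-nonneg (≺⇒pos (≺-trans p q))
    (λ neg → add (*-nonneg (≺⇒pos q) (⊀⇒nonneg r)) (*-nonneg (≺⇒pos p) (⊀⇒nonneg s)) (<-respˡ-≈ (interpolate f g x₁ x₂ x₃) neg)))
    where
    add : ∀ {x y} → ¬ (x ≺ 0#) → ¬ (y ≺ 0#) → ¬ ((x ⊕ y) ≺ 0#)
    add {x} {y} p q r with compare x 0#
    ... | tri< s _ _ = p s
    ... | tri≈ _ s _ = q (<-respˡ-≈ (≈-trans (+-congʳ s) (𝔽.+-identityˡ y)) r)
    ... | tri> _ _ s = asym (sum-pos s q) r

  affineˡ : ∀ f g {x₁ x₂ x₃} → x₁ ≺ x₂ → x₂ ≺ x₃ → (f at x₁) ≺ (g at x₁) → ¬ ((g at x₃) ≺ (f at x₃)) → (f at x₂) ≺ (g at x₂)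
  affineˡ f g {x₁} {x₂} {x₃} p q r s = pos⇒≺ (cancel-pos (≺⇒pos (≺-trans p q))
    (<-respʳ-≈ (≈-sym (interpolate f g x₁ x₂ x₃)) (sum-pos (*-pos (≺⇒pos q) (≺⇒pos r)) (*-nonneg (≺⇒pos p) (⊀⇒nonneg s)))))

  affineʳ : ∀ f g {x₁ x₂ x₃} → x₁ ≺ x₂ → x₂ ≺ x₃ → ¬ ((g at x₁) ≺ (f at x₁)) → (f at x₃) ≺ (g at x₃) → (f at x₂) ≺ (g at x₂)
  affineʳ f g {x₁} {x₂} {x₃} p q r s = pos⇒≺ (cancel-pos (≺⇒pos (≺-trans p q))
    (<-respʳ-≈ (≈-trans (𝔽.+-comm _ _) (≈-sym (interpolate f g x₁ x₂ x₃))) (sum-pos (*-pos (≺⇒pos p) (≺⇒pos s)) (*-nonneg (≺⇒pos q) (⊀⇒nonneg r)))))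

  affine-agree : ∀ f g {x₁ x₂} x → x₁ ≺ x₂ → (f at x₁) ≈ (g at x₁) → (f at x₂) ≈ (g at x₂) → (f at x) ≈ (g at x)
  affine-agree f g {x₁} {x₂} x p r s = diff-zero⇒≈ (cancel-zero (≺⇒pos p) (≈-trans (interpolate f g x₁ x x₂)
    (≈-trans (+-cong (≈-trans (*-congˡ (≈⇒diff-zero r)) (zeroʳ _)) (≈-trans (*-congˡ (≈⇒diff-zero s)) (zeroʳ _))) (𝔽.+-identityˡ 0#))))

  module _ (l : Carrier) where

    -- The abscissa after the shear (x , y) ↦ (x + l y , y).
    key : Carrier × Carrier → Carrier
    key (x , y) = x ⊕ (l ⊗ y)

  x≺x+1 : ∀ x → x ≺ (x ⊕ 1#)
  x≺x+1 x = <-respʳ-≈ (𝔽.+-comm 1# x) (<-respˡ-≈ (𝔽.+-identityˡ x) (𝔽.+-mono-< x 0<1))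

  above : ∀ (bs : List Carrier) → ∃ λ s → ∀ {b} → b ∈ bs → b ≺ s
  above []       = 0# , λ ()
  above (b ∷ bs) with above bs
  ... | s , bs≺s with compare b s
  ...   | tri< b≺s _ _ = s , λ { (here refl) → b≺s ; (there p) → bs≺s p }
  ...   | tri≈ _ b≈s _ = s ⊕ 1# , λ { (here refl) → <-respˡ-≈ (≈-sym b≈s) (x≺x+1 s) ; (there p) → ≺-trans (bs≺s p) (x≺x+1 s) }
  ...   | tri> _ _ s≺b = b ⊕ 1# , λ { (here refl) → x≺x+1 b ; (there p) → ≺-trans (≺-trans (bs≺s p) s≺b) (x≺x+1 b) }

  _≋_ : Carrier × Carrier → Carrier × Carrier → Set
  (x , y) ≋ (x′ , y′) = (x ≈ x′) × (y ≈ y′)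

  -- Points of different heights receive equal keys for a single shear, namely `b`; any `l` above it
  -- separates them. For equal heights the keys differ exactly as the abscissae do, and `0#` is a
  -- dummy bound.
  bad : ∀ p q → ∃ λ b → ∀ l → b ≺ l → key l p ≈ key l q → p ≋ q
  bad (x , y) (x′ , y′) with (y′ ⊝ y) 𝔽.≟ 0#
  ... | yes y≈ = 0# , λ l _ eq → x≈ l eq , diff-zero⇒≈ y≈
    where
    x≈ : ∀ l → key l (x , y) ≈ key l (x′ , y′) → x ≈ x′
    x≈ l eq = diff-zero⇒≈ (≈-trans (lemma x y x′ y′ l)
      (≈-trans (+-cong (≈⇒diff-zero eq) (-‿cong (≈-trans (*-congˡ y≈) (zeroʳ l)))) (-‿inverseʳ 0#)))
      where lemma : ∀ x y x′ y′ l → (x′ ⊝ x) ≈ (((x′ ⊕ (l ⊗ y′)) ⊝ (x ⊕ (l ⊗ y))) ⊝ (l ⊗ (y′ ⊝ y)))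
            lemma = solve 5 (λ x y x′ y′ l → (x′ :- x) := (((x′ :+ (l :* y′)) :- (x :+ (l :* y))) :- (l :* (y′ :- y)))) ≈-refl
  ... | no y≢ with inverse (y′ ⊝ y) y≢
  ...   | d , inv = (x ⊝ x′) ⊗ d , λ l b≺l eq → contradiction b≺l (irrefl (is-bad l eq))
    where
    is-bad : ∀ l → key l (x , y) ≈ key l (x′ , y′) → ((x ⊝ x′) ⊗ d) ≈ l
    is-bad l eq = begin
      (x ⊝ x′) ⊗ d                                    ≈⟨ lemma x y x′ y′ l d ⟩
      (l ⊗ ((y′ ⊝ y) ⊗ d)) ⊝ ((k′ ⊝ k) ⊗ d)           ≈⟨ +-cong (*-congˡ inv) (-‿cong (*-congʳ (≈⇒diff-zero eq))) ⟩
      (l ⊗ 1#) ⊝ (0# ⊗ d)                             ≈⟨ lemma₂ l d ⟩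
      l                                               ∎
      where
      open SetoidReasoning setoid
      k = x ⊕ (l ⊗ y)
      k′ = x′ ⊕ (l ⊗ y′)
      lemma : ∀ x y x′ y′ l d → ((x ⊝ x′) ⊗ d) ≈ ((l ⊗ ((y′ ⊝ y) ⊗ d)) ⊝ (((x′ ⊕ (l ⊗ y′)) ⊝ (x ⊕ (l ⊗ y))) ⊗ d))
      lemma = solve 6 (λ x y x′ y′ l d → ((x :- x′) :* d) := ((l :* ((y′ :- y) :* d)) :- (((x′ :+ (l :* y′)) :- (x :+ (l :* y))) :* d))) ≈-refl
      lemma₂ : ∀ l d → ((l ⊗ 1#) ⊝ (0# ⊗ d)) ≈ l
      lemma₂ = solve 2 (λ l d → ((l :* con ℤ.1ℤ) :- (con ℤ.0ℤ :* d)) := l) ≈-refl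

-- Points and lines

module Traces (R : RealField) where
  open OrderedField R public
  open Plane R using (Point; Line; line)
  open 𝔽 using (Carrier; _≈_; 0#; 1#; setoid; +-cong; +-congˡ; +-congʳ; *-congˡ; *-congʳ; -‿cong; -‿inverseʳ; zeroʳ; inverse)
    renaming (_+_ to _⊕_; _*_ to _⊗_; -_ to ⊖_; _<_ to _≺_; _-_ to _⊝_; refl to ≈-refl; sym to ≈-sym; trans to ≈-trans)
  open SetoidReasoning setoid using (begin_; step-≈-⟩; _∎)

  on : Line → Point → Bool
  on (line a b c _) (x , y) = does (((a ⊗ x) ⊕ (b ⊗ y)) 𝔽.≟ c)

  on-true : ∀ {a b c nd x y} → on (line a b c nd) (x , y) ≡ true → ((a ⊗ x) ⊕ (b ⊗ y)) ≈ c
  on-true {a} {b} {c} {nd} {x} {y} eq with ((a ⊗ x) ⊕ (b ⊗ y)) 𝔽.≟ c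
  ... | yes p = p

  trace : ∀ {n} → Line → Vec Point n → Vec Bool n
  trace L ps = Vec.map (on L) ps

  Sorted : Carrier → ∀ {n} → Vec Point n → Set
  Sorted l = VecPairs.AllPairs (λ p q → key l p ≺ key l q)

  sorted-lookup : ∀ {l n} {ps : Vec Point n} → Sorted l ps → ∀ {i j} → i Fin.< j → key l (lookup ps i) ≺ key l (lookup ps j)
  sorted-lookup (p≺ ∷ s) {zero}  {suc j} _         = VecAll.lookup⁺ p≺ j
  sorted-lookup (p≺ ∷ s) {suc i} {suc j} (s≤s i<j) = sorted-lookup s i<j

  two-hits : ∀ {n} (T : Vec Bool n) → 2 ≤ size T → ∃ λ i → ∃ λ j → i Fin.< j × lookup T i ≡ true × lookup T j ≡ true
  two-hits T 2≤ with segments T in eq | length-segments T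
  ... | []     | 0≡ = contradiction (subst (1 ≤_) (sym 0≡) (∸-monoˡ-≤ 1 2≤)) λ ()
  ... | (i , j) ∷ _ | _ = i , j , ordered , start , end
    where open Consecutive (consecutive T {i , j} (subst ((i , j) ∈_) (sym eq) (here refl)))

  module _ {l n} {ps : Vec Point n} (sorted : Sorted l ps) where

    -- In the sheared coordinates a line through two of the points is the graph of an affine function.
    slope-intercept : ∀ L → 2 ≤ size (trace L ps) → ∃ λ f → ∀ i →
      (lookup (trace L ps) i ≡ true → (f at key l (lookup ps i)) ≈ proj₂ (lookup ps i)) ×
      ((f at key l (lookup ps i)) ≈ proj₂ (lookup ps i) → lookup (trace L ps) i ≡ true)
    slope-intercept L@(line a b c nd) 2≤ = by-cases (d 𝔽.≟ 0#)
      where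
      -- The coefficient of the height after the shear. If it vanishes the line is vertical in the
      -- new coordinates, and as the keys are distinct it can contain only one of the points.
      d = b ⊝ (l ⊗ a)
      sheared : ∀ p → ((a ⊗ proj₁ p) ⊕ (b ⊗ proj₂ p)) ≈ ((a ⊗ key l p) ⊕ (d ⊗ proj₂ p))
      sheared (x , y) = solve 5 (λ a b l x y → (a :* x :+ b :* y) := (a :* (x :+ l :* y) :+ (b :- l :* a) :* y)) ≈-refl a b l x y
      incident : ∀ i → lookup (trace L ps) i ≡ true → ((a ⊗ key l (lookup ps i)) ⊕ (d ⊗ proj₂ (lookup ps i))) ≈ c
      incident i eq = ≈-trans (≈-sym (sheared (lookup ps i)))
        (on-true {nd = nd} (trans (sym (Vec.lookup-map i (on L) ps)) eq))
      by-cases : Dec (d ≈ 0#) → _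
      by-cases (yes d≈0) with two-hits (trace L ps) 2≤
      ... | i , j , i<j , hi , hj = contradiction (a≈0 , b≈0) nd
        where
        kᵢ = key l (lookup ps i)
        kⱼ = key l (lookup ps j)
        flat : ∀ i → lookup (trace L ps) i ≡ true → (a ⊗ key l (lookup ps i)) ≈ c
        flat i h = begin
          a ⊗ key l (lookup ps i)                                          ≈⟨ ≈-sym (𝔽.+-identityʳ _) ⟩
          (a ⊗ key l (lookup ps i)) ⊕ 0#                                   ≈⟨ +-congˡ (≈-sym (≈-trans (*-congʳ d≈0) (𝔽.zeroˡ _))) ⟩
          (a ⊗ key l (lookup ps i)) ⊕ (d ⊗ proj₂ (lookup ps i))            ≈⟨ incident i h ⟩
          c                                                                ∎
        a≈0 : a ≈ 0#
        a≈0 = cancel-zero (≺⇒pos (sorted-lookup sorted i<j)) (begin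
          (kⱼ ⊝ kᵢ) ⊗ a              ≈⟨ solve 3 (λ a u v → (v :- u) :* a := a :* v :- a :* u) ≈-refl a kᵢ kⱼ ⟩
          (a ⊗ kⱼ) ⊝ (a ⊗ kᵢ)        ≈⟨ ≈⇒diff-zero (≈-trans (flat i hi) (≈-sym (flat j hj))) ⟩
          0#                         ∎)
        b≈0 : b ≈ 0#
        b≈0 = begin
          b                          ≈⟨ solve 3 (λ a b l → b := (b :- l :* a) :+ l :* a) ≈-refl a b l ⟩
          d ⊕ (l ⊗ a)                ≈⟨ +-cong d≈0 (≈-trans (*-congˡ a≈0) (zeroʳ l)) ⟩
          0# ⊕ 0#                    ≈⟨ 𝔽.+-identityˡ 0# ⟩
          0#                         ∎
      by-cases (no d≢0) with inverse d d≢0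
      ... | e , de≈1 = (⊖ (e ⊗ a) , e ⊗ c) , λ i → to i , from i
        where
        to : ∀ i → lookup (trace L ps) i ≡ true → (((⊖ (e ⊗ a)) ⊗ key l (lookup ps i)) ⊕ (e ⊗ c)) ≈ proj₂ (lookup ps i)
        to i h = begin
          ((⊖ (e ⊗ a)) ⊗ k) ⊕ (e ⊗ c)                           ≈⟨ +-congˡ (*-congˡ (≈-sym (incident i h))) ⟩
          ((⊖ (e ⊗ a)) ⊗ k) ⊕ (e ⊗ ((a ⊗ k) ⊕ (d ⊗ y)))         ≈⟨ solve 5 (λ a d e k y → (:- (e :* a)) :* k :+ e :* (a :* k :+ d :* y) := (d :* e) :* y) ≈-refl a d e k y ⟩
          (d ⊗ e) ⊗ y                                           ≈⟨ *-congʳ de≈1 ⟩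
          1# ⊗ y                                                ≈⟨ 𝔽.*-identityˡ y ⟩
          y                                                     ∎
          where k = key l (lookup ps i)
                y = proj₂ (lookup ps i)
        from : ∀ i → (((⊖ (e ⊗ a)) ⊗ key l (lookup ps i)) ⊕ (e ⊗ c)) ≈ proj₂ (lookup ps i) → lookup (trace L ps) i ≡ true
        from i eq = trans (Vec.lookup-map i (on L) ps) (dec-true (_ 𝔽.≟ c) (begin
          (a ⊗ proj₁ (lookup ps i)) ⊕ (b ⊗ y)                           ≈⟨ sheared (lookup ps i) ⟩
          (a ⊗ k) ⊕ (d ⊗ y)                                             ≈⟨ +-congˡ (*-congˡ (≈-sym eq)) ⟩
          (a ⊗ k) ⊕ (d ⊗ (((⊖ (e ⊗ a)) ⊗ k) ⊕ (e ⊗ c)))                 ≈⟨ solve 5 (λ a d e k c → a :* k :+ d :* ((:- (e :* a)) :* k :+ e :* c) := (a :* k :- (d :* e) :* (a :* k)) :+ (d :* e) :* c) ≈-refl a d e k c ⟩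
          ((a ⊗ k) ⊝ ((d ⊗ e) ⊗ (a ⊗ k))) ⊕ ((d ⊗ e) ⊗ c)               ≈⟨ +-cong (+-congˡ (-‿cong (*-congʳ de≈1))) (*-congʳ de≈1) ⟩
          ((a ⊗ k) ⊝ (1# ⊗ (a ⊗ k))) ⊕ (1# ⊗ c)                         ≈⟨ solve 3 (λ a k c → (a :* k :- con ℤ.1ℤ :* (a :* k)) :+ con ℤ.1ℤ :* c := c) ≈-refl a k c ⟩
          c                                                             ∎))
          where k = key l (lookup ps i)
                y = proj₂ (lookup ps i)

    -- Traces stand for lines, so that different equations of one line, or lines with the same
    -- points, count once. Functions that agree at two abscissae agree everywhere and so have the
    -- same trace, which is why uniqueness of the traces yields `agree-once`.
    incidence-inequality : ∀ (Ts : List (Vec Bool n)) → Unique Ts →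
      (∀ {T} → T ∈ Ts → 2 ≤ size T × ∃ λ L → T ≡ trace L ps) →
      ∀ r → sumL (λ T → size T ∸ 1) Ts * suc r ^ 2 ≤ 3 * n * suc r ^ 3 + length Ts * length Ts
    incidence-inequality Ts uniq lines = TracedPseudolines.incidence-inequality 𝔽.isStrictTotalOrder (λ i → proj₂ (lookup ps i)) Ts
      (λ t i → fn t at x i)
      (λ f g p q → affine≤ (fn f) (fn g) (sorted-lookup sorted p) (sorted-lookup sorted q))
      (λ f g p q → affineˡ (fn f) (fn g) (sorted-lookup sorted p) (sorted-lookup sorted q))
      (λ f g p q → affineʳ (fn f) (fn g) (sorted-lookup sorted p) (sorted-lookup sorted q))
      agree-once trace⇒on on⇒trace
      where
      x : Fin n → Carrier
      x i = key l (lookup ps i)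
      affine : ∀ t → ∃ λ f → ∀ i →
        (lookup (List.lookup Ts t) i ≡ true → (f at x i) ≈ proj₂ (lookup ps i)) ×
        ((f at x i) ≈ proj₂ (lookup ps i) → lookup (List.lookup Ts t) i ≡ true)
      affine t with lines (∈-lookup {xs = Ts} t)
      ... | 2≤ , L , eq rewrite eq = slope-intercept L 2≤
      fn : Fin (length Ts) → Carrier × Carrier
      fn t = proj₁ (affine t)
      trace⇒on : ∀ t i → lookup (List.lookup Ts t) i ≡ true → (fn t at x i) ≈ proj₂ (lookup ps i)
      trace⇒on t i = proj₁ (proj₂ (affine t) i)
      on⇒trace : ∀ t i → (fn t at x i) ≈ proj₂ (lookup ps i) → lookup (List.lookup Ts t) i ≡ true
      on⇒trace t i = proj₂ (proj₂ (affine t) i)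
      bool-ext : ∀ {a b : Bool} → (a ≡ true → b ≡ true) → (b ≡ true → a ≡ true) → a ≡ b
      bool-ext {true}  p q = sym (p refl)
      bool-ext {false} {true}  p q = q refl
      bool-ext {false} {false} p q = refl
      agree-once : ∀ f g {i j} → i Fin.< j → (fn f at x i) ≈ (fn g at x i) → (fn f at x j) ≈ (fn g at x j) → f ≡ g
      agree-once f g i<j p q = lookup-injective uniq f g (Pointwise-≡⇒≡ (ext λ i → bool-ext
        (λ h → on⇒trace g i (≈-trans (≈-sym (same i)) (trace⇒on f i h)))
        (λ h → on⇒trace f i (≈-trans (same i) (trace⇒on g i h)))))
        where
        same : ∀ i → (fn f at x i) ≈ (fn g at x i)
        same i = affine-agree (fn f) (fn g) (x i) (sorted-lookup sorted i<j) p q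

-- The Szemerédi–Trotter bound

open ≤-Reasoning

m<[1+m/n]*n : ∀ m n .{{_ : NonZero n}} → m < suc (m / n) * n
m<[1+m/n]*n m n = begin-strict
  m                     ≡⟨ m≡m%n+[m/n]*n m n ⟩
  m % n + m / n * n     <⟨ +-monoˡ-< (m / n * n) (m%n<n m n) ⟩
  suc (m / n) * n       ∎

cube-mono : ∀ {a b} → a ≤ b → a * a * a ≤ b * b * b
cube-mono p = *-mono-≤ (*-mono-≤ p p) p

-- With `t = e / (6 n)` the term `3 n t³` is at most half of `e t²`, so that `e t² ≤ 2 m²`;
-- eliminating `t` by `e ≤ 12 n t` gives 288 = 144 · 2. The choice is impossible only if `t = 0`,
-- that is, for `e < 6 n`.
optimise : ∀ n e m .{{_ : NonZero n}} → (∀ r → e * suc r ^ 2 ≤ 3 * n * suc r ^ 3 + m * m) →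
           e ≤ 6 * n ⊎ e * e * e ≤ 288 * (n * n) * (m * m)
optimise n e m {{nz}} h with e / (6 * n) in eq
  where instance
    6n≢0 : NonZero (6 * n)
    6n≢0 = m*n≢0 6 n
... | zero = inj₁ (<⇒≤ (subst (e <_) (trans (cong (λ z → suc z * (6 * n)) eq) (*-identityˡ (6 * n))) (m<[1+m/n]*n e (6 * n) {{m*n≢0 6 n}})))
... | suc r = inj₂ (begin
    e * e * e                          ≤⟨ *-monoˡ-≤ e (*-mono-≤ e≤ e≤) ⟩
    12 * n * t * (12 * n * t) * e      ≡⟨ l₁ n t e ⟩
    144 * (n * n) * (e * (t * (t * 1))) ≤⟨ *-monoʳ-≤ (144 * (n * n)) et² ⟩
    144 * (n * n) * (2 * (m * m))      ≡⟨ l₂ (n * n) (m * m) ⟩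
    288 * (n * n) * (m * m)            ∎)
  where
  t = suc r
  instance
    6n≢0 : NonZero (6 * n)
    6n≢0 = m*n≢0 6 n
  l₁ : ∀ n t e → 12 * n * t * (12 * n * t) * e ≡ 144 * (n * n) * (e * (t * (t * 1)))
  l₁ = solve-∀
  l₂ : ∀ a b → 144 * a * (2 * b) ≡ 288 * a * b
  l₂ = solve-∀
  6nt≤ : t * (6 * n) ≤ e
  6nt≤ = subst (λ z → z * (6 * n) ≤ e) eq (m/n*n≤m e (6 * n))
  e≤ : e ≤ 12 * n * t
  e≤ = begin
    e                         ≤⟨ <⇒≤ (m<[1+m/n]*n e (6 * n)) ⟩
    suc (e / (6 * n)) * (6 * n) ≡⟨ cong (λ z → suc z * (6 * n)) eq ⟩
    suc t * (6 * n)           ≤⟨ *-monoˡ-≤ (6 * n) (+-monoˡ-≤ t (s≤s (z≤n {r}))) ⟩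
    (t + t) * (6 * n)         ≡⟨ l t n ⟩
    12 * n * t                ∎
    where l : ∀ t n → (t + t) * (6 * n) ≡ 12 * n * t
          l = solve-∀
  et² : e * (t * (t * 1)) ≤ 2 * (m * m)
  et² = +-cancelˡ-≤ (e * (t * (t * 1))) _ _ (begin
    e * (t * (t * 1)) + e * (t * (t * 1))      ≡⟨ l (e * (t * (t * 1))) ⟩
    2 * (e * (t * (t * 1)))                    ≤⟨ *-monoʳ-≤ 2 (h r) ⟩
    2 * (3 * n * (t * (t * (t * 1))) + m * m)  ≡⟨ l′ n t (m * m) ⟩
    t * (6 * n) * (t * (t * 1)) + 2 * (m * m)  ≤⟨ +-monoˡ-≤ (2 * (m * m)) (*-monoˡ-≤ (t * (t * 1)) 6nt≤) ⟩
    e * (t * (t * 1)) + 2 * (m * m)            ∎)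
    where
    l : ∀ a → a + a ≡ 2 * a
    l = solve-∀
    l′ : ∀ n t b → 2 * (3 * n * (t * (t * (t * 1))) + b) ≡ t * (6 * n) * (t * (t * 1)) + 2 * b
    l′ = solve-∀

-- Abel summation weights: 4 i³ dominates i⁴ - (i - 1)⁴.
staircase : ℕ → ℕ → ℕ
staircase q k = sumL (λ i → ⟦ does (i ≤? k) ⟧ * (4 * (i * i * i))) (downFrom q)

fourth : ℕ → ℕ
fourth k = k * k * k * k

fourth-step : ∀ k → fourth (suc k) ≤ 4 * (suc k * suc k * suc k) + fourth k
fourth-step k = subst (fourth (suc k) ≤_) (sym (l k)) (m≤m+n (fourth (suc k)) (6 * (k * k) + 8 * k + 3))
  where l : ∀ k → 4 * (suc k * suc k * suc k) + k * k * k * k ≡ suc k * suc k * suc k * suc k + (6 * (k * k) + 8 * k + 3)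
        l = solve-∀

staircase-below : ∀ {j k} → j ≤ k → fourth j ≤ staircase (suc j) k
staircase-below {zero}  j≤k = z≤n
staircase-below {suc j} {k} j<k = ≤-trans (fourth-step j) (+-mono-≤ (≤-reflexive (sym counted)) (staircase-below (<⇒≤ j<k)))
  where
  top = 4 * (suc j * suc j * suc j)
  counted : ⟦ does (suc j ≤? k) ⟧ * top ≡ top
  counted = trans (cong (λ b → ⟦ b ⟧ * top) (dec-true (suc j ≤? k) j<k)) (+-identityʳ top)

fourth≤staircase : ∀ {k q} → k < q → fourth k ≤ staircase q k
fourth≤staircase {k} {suc q} (s≤s k≤q) with m≤n⇒m<n∨m≡n k≤q
... | inj₂ refl = staircase-below {k} ≤-refl
... | inj₁ k<q  = ≤-trans (fourth≤staircase k<q) (m≤n+m _ _)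

∈-downFrom⇒< : ∀ q {i} → i ∈ downFrom q → i < q
∈-downFrom⇒< (suc q) (here refl) = ≤-refl
∈-downFrom⇒< (suc q) (there i∈)  = m<n⇒m<1+n (∈-downFrom⇒< q i∈)

length-downFrom : ∀ q → length (downFrom q) ≡ q
length-downFrom zero    = refl
length-downFrom (suc q) = cong suc (length-downFrom q)

-- How much a trace with k points contributes to the cost of the colouring, in units of q⁴.
weight : ℕ → ℕ → ℕ
weight q k = if does (k <? q) then fourth k else k * (q * q * q)

root-nonZero : ∀ q → 0 < q * q * q → NonZero q
root-nonZero (suc q) _ = nonZero

module Rich {n : ℕ} .{{n≢0 : NonZero n}} (Ts : List (Vec Bool n)) (two≤ : ∀ {T} → T ∈ Ts → 2 ≤ size T)
  (incidences : ∀ {P : Vec Bool n → Set} (P? : ∀ T → Dec (P T)) r →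
     sumL (λ T → size T ∸ 1) (filter P? Ts) * suc r ^ 2 ≤ 3 * n * suc r ^ 3 + length (filter P? Ts) * length (filter P? Ts))
  (q : ℕ) (n≤q³ : n ≤ q * q * q) (q³≤64n : q * q * q ≤ 64 * n) where

  private instance
    q≢0 : NonZero q
    q≢0 = root-nonZero q (≤-trans (>-nonZero⁻¹ n) n≤q³)

  module _ {P : Vec Bool n → Set} (P? : ∀ T → Dec (P T)) where

    private
      U = filter P? Ts
      I = sumL size U
      m = length U

      double : ∀ {k} → 2 ≤ k → k ≤ 2 * (k ∸ 1)
      double {suc (suc k)} _ = ≤-trans (m≤m+n (2 + k) k) (≤-reflexive (l k))
        where l : ∀ k → 2 + k + k ≡ 2 * (1 + k)
              l = solve-∀
      double {suc zero} (s≤s ())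

      I≤2e : I ≤ 2 * sumL (λ T → size T ∸ 1) U
      I≤2e = ≤-trans (sumL-mono U (λ T∈ → double (two≤ (proj₁ (∈-filter⁻ P? {xs = Ts} T∈))))) (≤-reflexive (sumL-*ˡ 2 _ U))

    -- A line with at least two points has at most twice as many points as edges, so the constants
    -- are 12 = 2 · 6 and 2304 = 2³ · 288.
    dichotomy : I ≤ 12 * n ⊎ I * I * I ≤ 2304 * (n * n) * (m * m)
    dichotomy with optimise n (sumL (λ T → size T ∸ 1) U) m (incidences P?)
    ... | inj₁ e≤ = inj₁ (≤-trans I≤2e (≤-trans (*-monoʳ-≤ 2 e≤) (≤-reflexive (l n))))
      where
      l : ∀ n → 2 * (6 * n) ≡ 12 * n
      l = solve-∀
    ... | inj₂ e³≤ = inj₂ (begin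
      I * I * I                                ≤⟨ cube-mono I≤2e ⟩
      2 * e * (2 * e) * (2 * e)                ≡⟨ l₁ e ⟩
      8 * (e * e * e)                          ≤⟨ *-monoʳ-≤ 8 e³≤ ⟩
      8 * (288 * (n * n) * (m * m))            ≡⟨ l₂ (n * n) (m * m) ⟩
      2304 * (n * n) * (m * m)                 ∎)
      where
      e = sumL (λ T → size T ∸ 1) U
      l₁ : ∀ e → 2 * e * (2 * e) * (2 * e) ≡ 8 * (e * e * e)
      l₁ = solve-∀
      l₂ : ∀ a b → 8 * (288 * a * b) ≡ 2304 * a * b
      l₂ = solve-∀

    length*≤ : ∀ i → (∀ {T} → P T → i ≤ size T) → m * i ≤ I
    length*≤ i P⇒ = ≤-trans (≤-reflexive (sym (sumL-const i U)))
      (sumL-mono U (λ T∈ → P⇒ (proj₂ (∈-filter⁻ P? {xs = Ts} T∈))))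

    -- Substituting `m q ≤ I` into the cubic alternative leaves `I q² ≤ 2304 n²`, and `n ≤ q³`
    -- removes one factor `n`.
    large-incidences : (∀ {T} → P T → q ≤ size T) → I ≤ 2304 * n * q
    large-incidences P⇒ with dichotomy
    ... | inj₁ I≤ = ≤-trans I≤ (≤-trans (*-monoˡ-≤ n (m≤m+n 12 2292)) (m≤m*n (2304 * n) q))
    ... | inj₂ I³≤ with I in eq
    ...   | zero  = z≤n
    ...   | suc J = *-cancelʳ-≤ _ _ (i * i * (q * q)) {{m*n≢0 (i * i) (q * q) {{nonZero}} {{m*n≢0 q q}}}} (begin
        i * (i * i * (q * q))                  ≡⟨ l₁ i q ⟩
        i * i * i * (q * q)                    ≤⟨ *-monoˡ-≤ (q * q) I³≤ ⟩
        2304 * (n * n) * (m * m) * (q * q)     ≡⟨ l₂ n m q ⟩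
        2304 * (n * n) * (m * q * (m * q))     ≤⟨ *-mono-≤ (*-monoʳ-≤ 2304 (*-monoʳ-≤ n n≤q³)) (*-mono-≤ mq≤ mq≤) ⟩
        2304 * (n * (q * q * q)) * (i * i)     ≡⟨ l₃ n q i ⟩
        2304 * n * q * (i * i * (q * q))       ∎)
      where
      i = suc J
      mq≤ : m * q ≤ i
      mq≤ = subst (m * q ≤_) eq (length*≤ q P⇒)
      l₁ : ∀ i q → i * (i * i * (q * q)) ≡ i * i * i * (q * q)
      l₁ = solve-∀
      l₂ : ∀ n m q → 2304 * (n * n) * (m * m) * (q * q) ≡ 2304 * (n * n) * (m * q * (m * q))
      l₂ = solve-∀
      l₃ : ∀ n q i → 2304 * (n * (q * q * q)) * (i * i) ≡ 2304 * n * q * (i * i * (q * q))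
      l₃ = solve-∀

    -- The cubic alternative gives the bound through `m i ≤ I`. The linear one gives only
    -- `m i ≤ 12 n`, which is enough because `i² ≤ q² ≤ 64 n` below the threshold.
    small-number : ∀ {i} → i < q → (∀ {T} → P T → i ≤ size T) → m * (i * i * i) ≤ 2304 * (n * n)
    small-number {i} i<q P⇒ with dichotomy
    ... | inj₁ I≤ = begin
        m * (i * i * i)                ≡⟨ l₁ m i ⟩
        m * i * (i * i)                ≤⟨ *-mono-≤ (≤-trans (length*≤ i P⇒) I≤) (*-mono-≤ (<⇒≤ i<q) (<⇒≤ i<q)) ⟩
        12 * n * (q * q)               ≤⟨ *-monoʳ-≤ (12 * n) (≤-trans (m≤m*n (q * q) q) q³≤64n) ⟩
        12 * n * (64 * n)              ≡⟨ l₂ n ⟩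
        768 * (n * n)                  ≤⟨ *-monoˡ-≤ (n * n) (m≤m+n 768 1536) ⟩
        2304 * (n * n)                 ∎
      where
      l₁ : ∀ m i → m * (i * i * i) ≡ m * i * (i * i)
      l₁ = solve-∀
      l₂ : ∀ n → 12 * n * (64 * n) ≡ 768 * (n * n)
      l₂ = solve-∀
    ... | inj₂ I³≤ with m in eq
    ...   | zero   = z≤n
    ...   | suc m′ = *-cancelˡ-≤ (j * j) (begin
        j * j * (j * (i * i * i))      ≡⟨ l₁ j i ⟩
        j * i * (j * i) * (j * i)      ≤⟨ cube-mono (subst (λ z → z * i ≤ I) eq (length*≤ i P⇒)) ⟩
        I * I * I                      ≤⟨ I³≤ ⟩
        2304 * (n * n) * (j * j)       ≡⟨ *-comm (2304 * (n * n)) (j * j) ⟩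
        j * j * (2304 * (n * n))       ∎)
      where
      j = suc m′
      l₁ : ∀ j i → j * j * (j * (i * i * i)) ≡ j * i * (j * i) * (j * i)
      l₁ = solve-∀

  private
    small? : (T : Vec Bool n) → Dec (size T < q)
    small? T = size T <? q
    large? : (T : Vec Bool n) → Dec (¬ size T < q)
    large? T = ¬? (small? T)

  large-weight : sumL size (filter large? Ts) ≤ 2304 * n * q
  large-weight = large-incidences large? ≮⇒≥

  -- By Abel summation: level `i` contributes `4 i³` for each of at most `2304 n² / i³` lines, the
  -- same amount on each of the `q` levels. Third powers would leave a harmonic sum here.
  small-weight : sumL (λ T → fourth (size T)) (filter small? Ts) ≤ 9216 * (n * n) * q
  small-weight = begin
    sumL (λ T → fourth (size T)) S
      ≤⟨ sumL-mono S (λ T∈ → fourth≤staircase (proj₂ (∈-filter⁻ small? {xs = Ts} T∈))) ⟩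
    sumL (λ T → staircase q (size T)) S
      ≡⟨ sumL-swap (λ T i → ⟦ does (i ≤? size T) ⟧ * (4 * (i * i * i))) S (downFrom q) ⟩
    sumL (λ i → sumL (λ T → ⟦ does (i ≤? size T) ⟧ * (4 * (i * i * i))) S) (downFrom q)
      ≤⟨ sumL-mono (downFrom q) (λ {i} i∈ → each i (∈-downFrom⇒< q i∈)) ⟩
    sumL (λ _ → 9216 * (n * n)) (downFrom q)
      ≡⟨ trans (sumL-const (9216 * (n * n)) (downFrom q)) (trans (cong (_* (9216 * (n * n))) (length-downFrom q)) (*-comm q (9216 * (n * n)))) ⟩
    9216 * (n * n) * q ∎
    where
    S = filter small? Ts
    both? : ∀ i (T : Vec Bool n) → Dec (size T < q × i ≤ size T)
    both? i T = small? T ×-dec (i ≤? size T)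
    count : ∀ i → sumL (λ T → ⟦ does (i ≤? size T) ⟧) S ≡ length (filter (both? i) Ts)
    count i = trans (sumL-filter small? _ Ts) (trans (sumL-cong Ts (λ {T} _ → l (does (small? T)) (does (i ≤? size T))))
                (sym (length-filter≡sumL (both? i) Ts)))
      where l : ∀ a b → ⟦ a ⟧ * ⟦ b ⟧ ≡ ⟦ a ∧ b ⟧
            l true  b = +-identityʳ ⟦ b ⟧
            l false b = refl
    each : ∀ i → i < q → sumL (λ T → ⟦ does (i ≤? size T) ⟧ * (4 * (i * i * i))) S ≤ 9216 * (n * n)
    each i i<q = begin
      sumL (λ T → ⟦ does (i ≤? size T) ⟧ * (4 * (i * i * i))) S ≡⟨ sumL-*ʳ (4 * (i * i * i)) _ S ⟩
      sumL (λ T → ⟦ does (i ≤? size T) ⟧) S * (4 * (i * i * i)) ≡⟨ cong (_* (4 * (i * i * i))) (count i) ⟩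
      length (filter (both? i) Ts) * (4 * (i * i * i))          ≡⟨ l₁ (length (filter (both? i) Ts)) (i * i * i) ⟩
      4 * (length (filter (both? i) Ts) * (i * i * i))          ≤⟨ *-monoʳ-≤ 4 (small-number (both? i) i<q proj₂) ⟩
      4 * (2304 * (n * n))                                      ≡⟨ l₂ (n * n) ⟩
      9216 * (n * n)                                            ∎
      where
      l₁ : ∀ a b → a * (4 * b) ≡ 4 * (a * b)
      l₁ = solve-∀
      l₂ : ∀ a → 4 * (2304 * a) ≡ 9216 * a
      l₂ = solve-∀

  total-weight : sumL (λ T → weight q (size T)) Ts ≤ n * fourth q * 11520
  total-weight = begin
    sumL (λ T → weight q (size T)) Ts
      ≡⟨ sumL-cong Ts (λ {T} _ → split (does (small? T)) (fourth (size T)) (size T * (q * q * q))) ⟩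
    sumL (λ T → ⟦ does (small? T) ⟧ * fourth (size T) + ⟦ does (large? T) ⟧ * (size T * (q * q * q))) Ts
      ≡⟨ sumL-+ _ _ Ts ⟩
    sumL (λ T → ⟦ does (small? T) ⟧ * fourth (size T)) Ts + sumL (λ T → ⟦ does (large? T) ⟧ * (size T * (q * q * q))) Ts
      ≡⟨ cong₂ _+_ (sym (sumL-filter small? _ Ts)) (trans (sym (sumL-filter large? _ Ts)) (sumL-*ʳ (q * q * q) size (filter large? Ts))) ⟩
    sumL (λ T → fourth (size T)) (filter small? Ts) + sumL size (filter large? Ts) * (q * q * q)
      ≤⟨ +-mono-≤ small-weight (*-monoˡ-≤ (q * q * q) large-weight) ⟩
    9216 * (n * n) * q + 2304 * n * q * (q * q * q)
      ≤⟨ +-monoˡ-≤ (2304 * n * q * (q * q * q)) (*-monoˡ-≤ q (*-monoʳ-≤ 9216 (*-monoʳ-≤ n n≤q³))) ⟩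
    9216 * (n * (q * q * q)) * q + 2304 * n * q * (q * q * q)
      ≡⟨ l n q ⟩
    n * fourth q * 11520 ∎
    where
    split : ∀ b x y → (if b then x else y) ≡ ⟦ b ⟧ * x + ⟦ not b ⟧ * y
    split true  x y = sym (trans (+-identityʳ (x + 0)) (+-identityʳ x))
    split false x y = sym (+-identityʳ y)
    l : ∀ n q → 9216 * (n * (q * q * q)) * q + 2304 * n * q * (q * q * q) ≡ n * (q * q * q * q) * 11520
    l = solve-∀

-- Kraft inequality

prodL : ∀ {A : Set} → (A → ℕ) → List A → ℕ
prodL f []       = 1
prodL f (x ∷ xs) = f x * prodL f xs

sumL-split : ∀ {A : Set} {P : A → Set} (P? : ∀ x → Dec (P x)) (f : A → ℕ) xs →
             sumL f xs ≡ sumL f (filter P? xs) + sumL f (filter (¬? ∘ P?) xs)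
sumL-split P? f []       = refl
sumL-split P? f (x ∷ xs) with P? x | sumL-split P? f xs
... | yes _ | ih = trans (cong (f x +_) ih) (sym (+-assoc (f x) _ _))
... | no  _ | ih = trans (cong (f x +_) ih) (l (f x) (sumL f (filter P? xs)) (sumL f (filter (¬? ∘ P?) xs)))
  where l : ∀ a b c → a + (b + c) ≡ b + (a + c)
        l = solve-∀

length-split : ∀ {A : Set} {P : A → Set} (P? : ∀ x → Dec (P x)) (xs : List A) →
               length xs ≡ length (filter P? xs) + length (filter (¬? ∘ P?) xs)
length-split P? xs = trans (l xs) (trans (sumL-split P? (λ _ → 1) xs) (sym (cong₂ _+_ (l (filter P? xs)) (l (filter (¬? ∘ P?) xs)))))
  where l : ∀ {A : Set} (ys : List A) → length ys ≡ sumL (λ _ → 1) ys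
        l ys = sym (trans (sumL-const 1 ys) (*-identityʳ (length ys)))

infix 4 _⊑_
record _⊑_ {A : Set} (ys xs : List A) : Set where
  constructor sublist
  field
    ⊑-∈    : ∀ {y} → y ∈ ys → y ∈ xs
    ⊑-sumL : ∀ f → sumL f ys ≤ sumL f xs
open _⊑_ public

⊑-trans : ∀ {A : Set} {xs ys zs : List A} → xs ⊑ ys → ys ⊑ zs → xs ⊑ zs
⊑-trans p q = sublist (⊑-∈ q ∘ ⊑-∈ p) (λ f → ≤-trans (⊑-sumL p f) (⊑-sumL q f))

filter-⊑ : ∀ {A : Set} {P : A → Set} (P? : ∀ x → Dec (P x)) xs → filter P? xs ⊑ xs
filter-⊑ P? xs = sublist (λ y∈ → proj₁ (∈-filter⁻ P? {xs = xs} y∈))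
  (λ f → ≤-trans (m≤m+n _ _) (≤-reflexive (sym (sumL-split P? f xs))))

-- If every x has a description (β f x)_f of cost Σ c f * β f x ≤ T, then some description is shared by
-- many x: the weights 2 ^ (- c f * b), b ≥ 0, sum to 2 ^ c f / (2 ^ c f - 1).
module Kraft {F X : Set} (c : F → ℕ) (c≥1 : ∀ f → 1 ≤ c f) (β : F → X → ℕ) where

  num den : F → ℕ
  num f = 2 ^ c f
  den f = 2 ^ c f ∸ 1

  suc-den : ∀ f → suc (den f) ≡ num f
  suc-den f = m+[n∸m]≡n (m^n>0 2 (c f))

  cost : List F → X → ℕ
  cost fs x = sumL (λ f → c f * β f x) fs

  Constant : List F → List X → Set
  Constant fs ys = ∀ {f x y} → f ∈ fs → x ∈ ys → y ∈ ys → β f x ≡ β f y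

  Shared : List F → List X → ℕ → Set
  Shared fs xs T = ∃ λ ys → ys ⊑ xs × Constant fs ys × length xs * prodL den fs ≤ length ys * (2 ^ T * prodL num fs)

  module _ (f : F) (fs : List F) (shared : ∀ xs T → (∀ {x} → x ∈ xs → cost fs x ≤ T) → Shared fs xs T) where

    private
      D = prodL den fs
      N = prodL num fs

      -- The identity `1 + 1 / den f = num f / den f` adds one term to the rest of a geometric
      -- series. The alternative `u ≡ 0` is the end of the series, where the budget does not allow
      -- another unit of `c f`.
      combine : ∀ {a a₀ a₁ y t u} → a ≡ a₀ + a₁ → a₀ * D ≤ y * (t * N) → a₁ * (den f * D) ≤ y * (u * (num f * N)) →
                u * num f ≡ t ⊎ u ≡ 0 → a * (den f * D) ≤ y * (t * (num f * N))
      combine {a₀ = a₀} {a₁} {y} {t} {u} refl p₀ p₁ u≡ = begin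
        (a₀ + a₁) * (den f * D)                               ≡⟨ l₁ a₀ a₁ (den f) D ⟩
        a₀ * D * den f + a₁ * (den f * D)                     ≤⟨ +-mono-≤ (*-monoˡ-≤ (den f) p₀) p₁ ⟩
        y * (t * N) * den f + y * (u * (num f * N))           ≤⟨ +-monoʳ-≤ (y * (t * N) * den f) (bound u≡) ⟩
        y * (t * N) * den f + y * (t * N)                     ≡⟨ l₂ y (t * N) (den f) ⟩
        y * (t * N) * suc (den f)                             ≡⟨ cong (y * (t * N) *_) (suc-den f) ⟩
        y * (t * N) * num f                                   ≡⟨ l₃ y t N (num f) ⟩
        y * (t * (num f * N))                                 ∎
        where
        l₁ : ∀ a b d D → (a + b) * (d * D) ≡ a * D * d + b * (d * D)
        l₁ = solve-∀
        l₂ : ∀ y a d → y * a * d + y * a ≡ y * a * suc d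
        l₂ = solve-∀
        l₃ : ∀ y t N m → y * (t * N) * m ≡ y * (t * (m * N))
        l₃ = solve-∀
        bound : u * num f ≡ t ⊎ u ≡ 0 → y * (u * (num f * N)) ≤ y * (t * N)
        bound (inj₁ refl) = ≤-reflexive (cong (y *_) (sym (*-assoc u (num f) N)))
        bound (inj₂ refl) = *-monoʳ-≤ y z≤n

      glue : ∀ {xs xs₀ xs₁ T u} → xs₀ ⊑ xs → xs₁ ⊑ xs → length xs ≡ length xs₀ + length xs₁ →
             (∀ {x y} → x ∈ xs₀ → y ∈ xs₀ → β f x ≡ β f y) → Shared fs xs₀ T →
             (∃ λ ys → ys ⊑ xs₁ × Constant (f ∷ fs) ys × length xs₁ * (den f * D) ≤ length ys * (u * (num f * N))) →
             u * num f ≡ 2 ^ T ⊎ u ≡ 0 → Shared (f ∷ fs) xs T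
      glue {xs₁ = xs₁} {T} {u} s₀ s₁ len const₀ (ys₀ , t₀ , k₀ , p₀) (ys₁ , t₁ , k₁ , p₁) u≡ with ≤-total (length ys₀) (length ys₁)
      ... | inj₁ le = ys₁ , ⊑-trans t₁ s₁ , k₁ , combine {a₁ = length xs₁} {y = length ys₁} {t = 2 ^ T} {u} len (≤-trans p₀ (*-monoˡ-≤ (2 ^ T * N) le)) p₁ u≡
      ... | inj₂ le = ys₀ , ⊑-trans t₀ s₀ , (λ { (here refl) p q → const₀ (⊑-∈ t₀ p) (⊑-∈ t₀ q) ; (there g∈) → k₀ g∈ }) ,
                      combine {a₁ = length xs₁} {y = length ys₀} {t = 2 ^ T} {u} len p₀ (≤-trans p₁ (*-monoˡ-≤ (u * (num f * N)) le)) u≡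

    -- The elements with `β f x ≡ i` form one candidate class. The others pay `c f` for a further
    -- unit, so their budget drops to `T ∸ c f` and `2 ^ T` is divided by `num f`: the geometric
    -- series is summed one level at a time. The longer of the two resulting classes is kept.
    shared-level : ∀ fuel T i xs → T < fuel → (∀ {x} → x ∈ xs → i ≤ β f x) →
                   (∀ {x} → x ∈ xs → c f * (β f x ∸ i) + cost fs x ≤ T) → Shared (f ∷ fs) xs T
    shared-level (suc fuel) T i xs (s≤s T≤fuel) low bounded = go (c f ≤? T)
      where
      here? : ∀ x → Dec (β f x ≡ i)
      here? x = β f x ≟ i
      xs₀ = filter here? xs
      xs₁ = filter (¬? ∘ here?) xs
      ∈₀ : ∀ {x} → x ∈ xs₀ → x ∈ xs × β f x ≡ i
      ∈₀ = ∈-filter⁻ here? {xs = xs}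
      ∈₁ : ∀ {x} → x ∈ xs₁ → x ∈ xs × suc i ≤ β f x
      ∈₁ x∈ with ∈-filter⁻ (¬? ∘ here?) {xs = xs} x∈
      ... | x∈xs , ≢i = x∈xs , ≤∧≢⇒< (low x∈xs) (≢i ∘ sym)
      shared₀ : Shared fs xs₀ T
      shared₀ = shared xs₀ T (λ x∈ → ≤-trans (m≤n+m _ _) (bounded (proj₁ (∈₀ x∈))))
      const₀ : ∀ {x y} → x ∈ xs₀ → y ∈ xs₀ → β f x ≡ β f y
      const₀ p q = trans (proj₂ (∈₀ p)) (sym (proj₂ (∈₀ q)))
      peel : ∀ {x} → x ∈ xs₁ → c f + (c f * (β f x ∸ suc i) + cost fs x) ≤ T
      peel {x} x∈ = ≤-trans (≤-reflexive (begin-equality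
        c f + (c f * (β f x ∸ suc i) + cost fs x)    ≡⟨ l (c f) (β f x ∸ suc i) (cost fs x) ⟩
        c f * suc (β f x ∸ suc i) + cost fs x        ≡⟨ cong (λ z → c f * z + cost fs x) (sym (+-∸-assoc 1 (proj₂ (∈₁ x∈)))) ⟩
        c f * (β f x ∸ i) + cost fs x                ∎)) (bounded (proj₁ (∈₁ x∈)))
        where l : ∀ c b r → c + (c * b + r) ≡ c * suc b + r
              l = solve-∀
      go : Dec (c f ≤ T) → Shared (f ∷ fs) xs T
      go (yes c≤T) = glue {xs₁ = xs₁} {T} {2 ^ (T ∸ c f)} (filter-⊑ here? xs) (filter-⊑ (¬? ∘ here?) xs) (length-split here? xs) const₀ shared₀
        (shared-level fuel (T ∸ c f) (suc i) xs₁ (<-≤-trans (∸-monoʳ-< (c≥1 f) c≤T) T≤fuel) (proj₂ ∘ ∈₁)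
          (λ x∈ → ≤-trans (≤-reflexive (sym (m+n∸m≡n (c f) _))) (∸-monoˡ-≤ (c f) (peel x∈))))
        (inj₁ (trans (sym (^-distribˡ-+-* 2 (T ∸ c f) (c f))) (cong (2 ^_) (m∸n+n≡m c≤T))))
      go (no c≰T) = glue {xs₁ = xs₁} {T} {0} (filter-⊑ here? xs) (filter-⊑ (¬? ∘ here?) xs) (length-split here? xs) const₀ shared₀
        ([] , sublist (λ ()) (λ _ → z≤n) , (λ _ ()) , ≤-reflexive (cong (λ ys → length ys * (den f * D)) (empty xs₁ λ x∈ → c≰T (≤-trans (m≤m+n (c f) _) (peel x∈))))) (inj₂ refl)
        where empty : ∀ (ys : List X) → (∀ {y} → ¬ y ∈ ys) → ys ≡ []
              empty []       _ = refl
              empty (y ∷ ys) p = contradiction (here refl) p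

  shared : ∀ fs xs T → (∀ {x} → x ∈ xs → cost fs x ≤ T) → Shared fs xs T
  shared []       xs T bounded = xs , sublist id (λ _ → ≤-refl) , (λ ()) ,
    *-monoʳ-≤ (length xs) (≤-trans (m^n>0 2 T) (≤-reflexive (sym (*-identityʳ (2 ^ T)))))
  shared (f ∷ fs) xs T bounded = shared-level f fs (shared fs) (suc T) T 0 xs ≤-refl (λ _ → z≤n) bounded

  module _ (E : ℕ) (fs : List F) (c≤E : ∀ f → c f ≤ E) where

    -- Bernoulli: (1 - 1 / N) ^ i ≥ 1 - i / N with N = d + 1.
    bernoulli : ∀ d i a → a + i ≡ suc d → a * suc d ^ i ≤ suc d * d ^ i
    bernoulli d zero a eq = *-monoˡ-≤ 1 (≤-reflexive (trans (sym (+-identityʳ a)) eq))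
    bernoulli d (suc i) a eq = begin
      a * (suc d * suc d ^ i)        ≡⟨ sym (*-assoc a (suc d) _) ⟩
      a * suc d * suc d ^ i          ≤⟨ *-monoˡ-≤ (suc d ^ i) step ⟩
      suc a * d * suc d ^ i          ≡⟨ l (suc a) d (suc d ^ i) ⟩
      suc a * suc d ^ i * d          ≤⟨ *-monoˡ-≤ d (bernoulli d i (suc a) (trans (sym (+-suc a i)) eq)) ⟩
      suc d * d ^ i * d              ≡⟨ l′ (suc d) (d ^ i) d ⟩
      suc d * (d * d ^ i)            ∎
      where
      l : ∀ a b c → a * b * c ≡ a * c * b
      l = solve-∀
      l′ : ∀ a b c → a * b * c ≡ a * (c * b)
      l′ = solve-∀
      step : a * suc d ≤ suc a * d
      step = begin
        a * suc d       ≡⟨ *-suc a d ⟩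
        a + a * d       ≤⟨ +-monoˡ-≤ (a * d) (≤-trans (m≤m+n a i) (≤-reflexive (suc-injective (trans (sym (+-suc a i)) eq)))) ⟩
        d + a * d       ∎

    -- Bernoulli with half of `num f` as exponent: (1 - 1 / N)^{N / 2} ≥ 1 / 2.
    square-root-2 : ∀ f → num f ^ (2 ^ (c f ∸ 1)) ≤ 2 * den f ^ (2 ^ (c f ∸ 1))
    square-root-2 f = *-cancelˡ-≤ j {{m^n≢0 2 (c f ∸ 1)}} (begin
      j * num f ^ j               ≡⟨ cong (λ z → j * z ^ j) (sym (suc-den f)) ⟩
      j * suc (den f) ^ j         ≤⟨ bernoulli (den f) j j (trans j+j (sym (suc-den f))) ⟩
      suc (den f) * den f ^ j     ≡⟨ cong (_* den f ^ j) (trans (suc-den f) (sym j+j)) ⟩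
      (j + j) * den f ^ j         ≡⟨ l j (den f ^ j) ⟩
      j * (2 * den f ^ j)         ∎)
      where
      j = 2 ^ (c f ∸ 1)
      l : ∀ j a → (j + j) * a ≡ j * (2 * a)
      l = solve-∀
      j+j : j + j ≡ num f
      j+j = trans (cong (j +_) (sym (+-identityʳ j))) (cong (2 ^_) (m+[n∸m]≡n (c≥1 f)))

    -- This says that `num f / den f` is at most 2 to the power 2 / `num f`. Raising both sides to
    -- the power `2 ^ E`, with `E` at least every cost, keeps the exponents integral.
    num^D : ∀ f → num f ^ (2 ^ E) ≤ 2 ^ (2 * 2 ^ (E ∸ c f)) * den f ^ (2 ^ E)
    num^D f = begin
      num f ^ (2 ^ E)                          ≡⟨ cong (num f ^_) jk ⟩
      num f ^ (j * k)                          ≡⟨ sym (^-*-assoc (num f) j k) ⟩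
      (num f ^ j) ^ k                          ≤⟨ ^-monoˡ-≤ k (square-root-2 f) ⟩
      (2 * den f ^ j) ^ k                      ≡⟨ ^-distribʳ-* k 2 (den f ^ j) ⟩
      2 ^ k * (den f ^ j) ^ k                  ≡⟨ cong (2 ^ k *_) (trans (^-*-assoc (den f) j k) (cong (den f ^_) (sym jk))) ⟩
      2 ^ k * den f ^ (2 ^ E)                  ∎
      where
      j = 2 ^ (c f ∸ 1)
      k = 2 * 2 ^ (E ∸ c f)
      jk : 2 ^ E ≡ j * k
      jk = begin-equality
        2 ^ E                                         ≡⟨ cong (2 ^_) (sym (m+[n∸m]≡n (c≤E f))) ⟩
        2 ^ (c f + (E ∸ c f))                         ≡⟨ cong (λ z → 2 ^ (z + (E ∸ c f))) (sym (m∸n+n≡m (c≥1 f))) ⟩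
        2 ^ (c f ∸ 1 + 1 + (E ∸ c f))                 ≡⟨ cong (2 ^_) (+-assoc (c f ∸ 1) 1 (E ∸ c f)) ⟩
        2 ^ (c f ∸ 1 + suc (E ∸ c f))                 ≡⟨ ^-distribˡ-+-* 2 (c f ∸ 1) (suc (E ∸ c f)) ⟩
        j * k                                         ∎

    prod^D : ∀ gs → prodL num gs ^ (2 ^ E) ≤ 2 ^ sumL (λ f → 2 * 2 ^ (E ∸ c f)) gs * prodL den gs ^ (2 ^ E)
    prod^D []       = m≤m+n _ 0
    prod^D (g ∷ gs) = begin
      (num g * prodL num gs) ^ D                                  ≡⟨ ^-distribʳ-* D (num g) (prodL num gs) ⟩
      num g ^ D * prodL num gs ^ D                                ≤⟨ *-mono-≤ (num^D g) (prod^D gs) ⟩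
      2 ^ a * den g ^ D * (2 ^ b * prodL den gs ^ D)              ≡⟨ l (2 ^ a) (den g ^ D) (2 ^ b) (prodL den gs ^ D) ⟩
      2 ^ a * 2 ^ b * (den g ^ D * prodL den gs ^ D)              ≡⟨ cong₂ _*_ (sym (^-distribˡ-+-* 2 a b)) (sym (^-distribʳ-* D (den g) (prodL den gs))) ⟩
      2 ^ (a + b) * (den g * prodL den gs) ^ D                    ∎
      where
      D = 2 ^ E
      a = 2 * 2 ^ (E ∸ c g)
      b = sumL (λ f → 2 * 2 ^ (E ∸ c f)) gs
      l : ∀ a b c d → a * b * (c * d) ≡ a * c * (b * d)
      l = solve-∀

    kraft-product : ∀ h → sumL (λ f → 2 * 2 ^ (E ∸ c f)) fs ≤ h * 2 ^ E → prodL num fs ≤ 2 ^ h * prodL den fs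
    kraft-product h sum≤ = ≮⇒≥ λ lt → <⇒≱ (^-monoˡ-< D {{m^n≢0 2 E}} lt) (begin
      prodL num fs ^ D                           ≤⟨ prod^D fs ⟩
      2 ^ sumL (λ f → 2 * 2 ^ (E ∸ c f)) fs * prodL den fs ^ D ≤⟨ *-monoˡ-≤ (prodL den fs ^ D) (^-monoʳ-≤ 2 sum≤) ⟩
      2 ^ (h * D) * prodL den fs ^ D             ≡⟨ cong (_* prodL den fs ^ D) (sym (^-*-assoc 2 h D)) ⟩
      (2 ^ h) ^ D * prodL den fs ^ D             ≡⟨ sym (^-distribʳ-* D (2 ^ h) (prodL den fs)) ⟩
      (2 ^ h * prodL den fs) ^ D                 ∎)
      where D = 2 ^ E

  den>0 : ∀ fs → 0 < prodL den fs
  den>0 []       = s≤s z≤n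
  den>0 (f ∷ fs) = *-mono-≤ (∸-monoˡ-≤ 1 (^-monoʳ-≤ 2 (c≥1 f))) (den>0 fs)

  large-class : ∀ E fs → (∀ f → c f ≤ E) → ∀ h → sumL (λ f → 2 * 2 ^ (E ∸ c f)) fs ≤ h * 2 ^ E →
                ∀ xs T → (∀ {x} → x ∈ xs → cost fs x ≤ T) →
                ∃ λ ys → ys ⊑ xs × Constant fs ys × length xs ≤ length ys * 2 ^ (T + h)
  large-class E fs c≤E h sum≤ xs T bounded with shared fs xs T bounded
  ... | ys , s , k , p = ys , s , k , *-cancelʳ-≤ _ _ (prodL den fs) {{>-nonZero (den>0 fs)}} (begin
      length xs * prodL den fs                              ≤⟨ p ⟩
      length ys * (2 ^ T * prodL num fs)                    ≤⟨ *-monoʳ-≤ (length ys) (*-monoʳ-≤ (2 ^ T) (kraft-product E fs c≤E h sum≤)) ⟩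
      length ys * (2 ^ T * (2 ^ h * prodL den fs))          ≡⟨ l (length ys) (2 ^ T) (2 ^ h) (prodL den fs) ⟩
      length ys * (2 ^ T * 2 ^ h) * prodL den fs            ≡⟨ cong (λ z → length ys * z * prodL den fs) (sym (^-distribˡ-+-* 2 T h)) ⟩
      length ys * 2 ^ (T + h) * prodL den fs                ∎)
    where
    l : ∀ a b c d → a * (b * (c * d)) ≡ a * (b * c) * d
    l = solve-∀

-- Moments

χ : ∀ {n} → Vec Bool n → Vec Bool n → ℤ
χ []          []      = ℤ.+ 0
χ (true ∷ T)  (b ∷ x) = sign b ℤ.+ χ T x
χ (false ∷ T) (b ∷ x) = χ T x

length-allSigns : ∀ n → length (allSigns n) ≡ 2 ^ n
length-allSigns zero    = refl
length-allSigns (suc n) = begin-equality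
  length (map (true ∷_) (allSigns n) ++ map (false ∷_) (allSigns n))            ≡⟨ List.length-++ (map (true ∷_) (allSigns n)) ⟩
  length (map (true ∷_) (allSigns n)) + length (map (false ∷_) (allSigns n))    ≡⟨ cong₂ _+_ (List.length-map (true ∷_) (allSigns n)) (List.length-map (false ∷_) (allSigns n)) ⟩
  length (allSigns n) + length (allSigns n)                                     ≡⟨ cong₂ _+_ (length-allSigns n) (trans (length-allSigns n) (sym (+-identityʳ (2 ^ n)))) ⟩
  2 ^ suc n                                                                     ∎

∈-allSigns : ∀ {n} (x : Vec Bool n) → x ∈ allSigns n
∈-allSigns []          = here refl
∈-allSigns (true ∷ x)  = ∈-++⁺ˡ (∈-map⁺ (true ∷_) (∈-allSigns x))
∈-allSigns (false ∷ x) = ∈-++⁺ʳ _ (∈-map⁺ (false ∷_) (∈-allSigns x))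

sumL-allSigns : ∀ {n} (f : Vec Bool (suc n) → ℕ) →
                sumL f (allSigns (suc n)) ≡ sumL (λ x → f (true ∷ x) + f (false ∷ x)) (allSigns n)
sumL-allSigns {n} f = trans (sumL-++ f (map (true ∷_) (allSigns n)) (map (false ∷_) (allSigns n)))
  (trans (cong₂ _+_ (sumL-map f (true ∷_) (allSigns n)) (sumL-map f (false ∷_) (allSigns n)))
         (sym (sumL-+ (f ∘ (true ∷_)) (f ∘ (false ∷_)) (allSigns n))))

moment : ∀ {n} → ℕ → Vec Bool n → ℕ
moment {n} p T = sumL (λ x → ∣ χ T x ∣ ^ p) (allSigns n)

neighbours : (ℕ → ℕ) → ℕ → ℕ
neighbours g zero    = g 1 + g 1
neighbours g (suc m) = g (suc (suc m)) + g m

∣±1∣ : ∀ (g : ℕ → ℕ) a → g ∣ ℤ.+ 1 ℤ.+ a ∣ + g ∣ ℤ.- (ℤ.+ 1) ℤ.+ a ∣ ≡ neighbours g ∣ a ∣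
∣±1∣ g (ℤ.+ zero)        = refl
∣±1∣ g (ℤ.+ suc m)       = cong (g (suc (suc m)) +_) (cong (g ∘ ∣_∣) (trans (ℤ.[1+m]⊖[1+n]≡m⊖n m 0) (l m)))
  where l : ∀ m → m ℤ.⊖ 0 ≡ ℤ.+ m
        l zero    = refl
        l (suc m) = refl
∣±1∣ g (ℤ.-[1+ zero ])   = +-comm (g 0) (g 2)
∣±1∣ g (ℤ.-[1+ suc m ])  = trans (+-comm (g ∣ ℤ.+ 1 ℤ.+ ℤ.-[1+ suc m ] ∣) _) (cong (g (suc (suc (suc m))) +_) (cong (g ∘ ∣_∣) (ℤ.[1+m]⊖[1+n]≡m⊖n 0 (suc m))))

module _ {n} (T : Vec Bool n) where

  moment-true : ∀ p → moment p (true ∷ T) ≡ sumL (λ x → neighbours (_^ p) ∣ χ T x ∣) (allSigns n)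
  moment-true p = trans (sumL-allSigns (λ x → ∣ χ (true ∷ T) x ∣ ^ p)) (sumL-cong (allSigns n) (λ {x} _ → ∣±1∣ (_^ p) (χ T x)))

  moment-false : ∀ p → moment p (false ∷ T) ≡ 2 * moment p T
  moment-false p = trans (sumL-allSigns (λ x → ∣ χ (false ∷ T) x ∣ ^ p))
    (trans (sumL-+ (λ x → ∣ χ T x ∣ ^ p) (λ x → ∣ χ T x ∣ ^ p) (allSigns n)) (cong (moment p T +_) (sym (+-identityʳ (moment p T)))))

  private
    sumL-+* : ∀ c (f g : Vec Bool n → ℕ) → sumL (λ x → f x + c * g x) (allSigns n) ≡ sumL f (allSigns n) + c * sumL g (allSigns n)
    sumL-+* c f g = trans (sumL-+ f _ (allSigns n)) (cong (sumL f (allSigns n) +_) (sumL-*ˡ c g (allSigns n)))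

  moment-zero : moment 0 T ≡ 2 ^ n
  moment-zero = trans (sumL-const 1 (allSigns n)) (trans (*-identityʳ _) (length-allSigns n))

  open +-*-Solver

  -- In these recursions the odd terms of (m + 1)^p + (m - 1)^p cancel; the coefficients are the
  -- even binomial coefficients of p.
  moment-2 : moment 2 (true ∷ T) ≡ 2 * (moment 2 T + 2 ^ n)
  moment-2 = trans (moment-true 2) (trans (sumL-cong (allSigns n) (λ {x} _ → step ∣ χ T x ∣))
    (trans (sumL-*ˡ 2 _ (allSigns n)) (cong (2 *_) (trans (sumL-+ _ _ (allSigns n)) (cong (moment 2 T +_) moment-zero)))))
    where
    step : ∀ m → neighbours (_^ 2) m ≡ 2 * (m ^ 2 + m ^ 0)
    step zero    = refl
    step (suc m) = solve 1 (λ m → (con 2 :+ m) :^ 2 :+ m :^ 2 := con 2 :* ((con 1 :+ m) :^ 2 :+ con 1)) refl m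

  moment-4 : moment 4 (true ∷ T) ≡ 2 * (moment 4 T + 6 * moment 2 T + 2 ^ n)
  moment-4 = trans (moment-true 4) (trans (sumL-cong (allSigns n) (λ {x} _ → step ∣ χ T x ∣))
    (trans (sumL-*ˡ 2 _ (allSigns n)) (cong (2 *_) (trans (sumL-+ _ _ (allSigns n)) (cong₂ _+_ (sumL-+* 6 _ _) moment-zero)))))
    where
    step : ∀ m → neighbours (_^ 4) m ≡ 2 * (m ^ 4 + 6 * m ^ 2 + m ^ 0)
    step zero    = refl
    step (suc m) = solve 1 (λ m → (con 2 :+ m) :^ 4 :+ m :^ 4 := con 2 :* ((con 1 :+ m) :^ 4 :+ con 6 :* (con 1 :+ m) :^ 2 :+ con 1)) refl m

  moment-6 : moment 6 (true ∷ T) ≡ 2 * (moment 6 T + 15 * moment 4 T + 15 * moment 2 T + 2 ^ n)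
  moment-6 = trans (moment-true 6) (trans (sumL-cong (allSigns n) (λ {x} _ → step ∣ χ T x ∣))
    (trans (sumL-*ˡ 2 _ (allSigns n)) (cong (2 *_) (trans (sumL-+ _ _ (allSigns n))
      (cong₂ _+_ (trans (sumL-+* 15 _ _) (cong (_+ 15 * moment 2 T) (sumL-+* 15 _ _))) moment-zero)))))
    where
    step : ∀ m → neighbours (_^ 6) m ≡ 2 * (m ^ 6 + 15 * m ^ 4 + 15 * m ^ 2 + m ^ 0)
    step zero    = refl
    step (suc m) = solve 1 (λ m → (con 2 :+ m) :^ 6 :+ m :^ 6 :=
      con 2 :* ((con 1 :+ m) :^ 6 :+ con 15 :* (con 1 :+ m) :^ 4 :+ con 15 :* (con 1 :+ m) :^ 2 :+ con 1)) refl m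

  moment-8 : moment 8 (true ∷ T) ≡ 2 * (moment 8 T + 28 * moment 6 T + 70 * moment 4 T + 28 * moment 2 T + 2 ^ n)
  moment-8 = trans (moment-true 8) (trans (sumL-cong (allSigns n) (λ {x} _ → step ∣ χ T x ∣))
    (trans (sumL-*ˡ 2 _ (allSigns n)) (cong (2 *_) (trans (sumL-+ _ _ (allSigns n))
      (cong₂ _+_ (trans (sumL-+* 28 _ _) (cong (_+ 28 * moment 2 T) (trans (sumL-+* 70 _ _) (cong (_+ 70 * moment 4 T) (sumL-+* 28 _ _))))) moment-zero)))))
    where
    step : ∀ m → neighbours (_^ 8) m ≡ 2 * (m ^ 8 + 28 * m ^ 6 + 70 * m ^ 4 + 28 * m ^ 2 + m ^ 0)
    step zero    = refl
    step (suc m) = solve 1 (λ m → (con 2 :+ m) :^ 8 :+ m :^ 8 :=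
      con 2 :* ((con 1 :+ m) :^ 8 :+ con 28 :* (con 1 :+ m) :^ 6 :+ con 70 :* (con 1 :+ m) :^ 4 :+ con 28 :* (con 1 :+ m) :^ 2 :+ con 1)) refl m

  moment-10 : moment 10 (true ∷ T) ≡ 2 * (moment 10 T + 45 * moment 8 T + 210 * moment 6 T + 210 * moment 4 T + 45 * moment 2 T + 2 ^ n)
  moment-10 = trans (moment-true 10) (trans (sumL-cong (allSigns n) (λ {x} _ → step ∣ χ T x ∣))
    (trans (sumL-*ˡ 2 _ (allSigns n)) (cong (2 *_) (trans (sumL-+ _ _ (allSigns n))
      (cong₂ _+_ (trans (sumL-+* 45 _ _) (cong (_+ 45 * moment 2 T) (trans (sumL-+* 210 _ _) (cong (_+ 210 * moment 4 T)
        (trans (sumL-+* 210 _ _) (cong (_+ 210 * moment 6 T) (sumL-+* 45 _ _))))))) moment-zero)))))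
    where
    step : ∀ m → neighbours (_^ 10) m ≡ 2 * (m ^ 10 + 45 * m ^ 8 + 210 * m ^ 6 + 210 * m ^ 4 + 45 * m ^ 2 + m ^ 0)
    step zero    = refl
    step (suc m) = solve 1 (λ m → (con 2 :+ m) :^ 10 :+ m :^ 10 :=
      con 2 :* ((con 1 :+ m) :^ 10 :+ con 45 :* (con 1 :+ m) :^ 8 :+ con 210 :* (con 1 :+ m) :^ 6 :+ con 210 :* (con 1 :+ m) :^ 4 :+ con 45 :* (con 1 :+ m) :^ 2 :+ con 1)) refl m

moment-false≤ : ∀ {n} p (T : Vec Bool n) K → moment p T ≤ K * 2 ^ n → moment p (false ∷ T) ≤ K * 2 ^ suc n
moment-false≤ {n} p T K bound = begin
  moment p (false ∷ T)   ≡⟨ moment-false T p ⟩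
  2 * moment p T         ≤⟨ *-monoʳ-≤ 2 bound ⟩
  2 * (K * 2 ^ n)        ≡⟨ l K (2 ^ n) ⟩
  K * (2 * 2 ^ n)        ∎
  where l : ∀ k P → 2 * (k * P) ≡ k * (2 * P)
        l = solve-∀

slack : ∀ {a b} c → a + c ≡ b → a ≤ b
slack {a} c refl = m≤m+n a c

moment-2≤ : ∀ {n} (T : Vec Bool n) → moment 2 T ≤ size T * 2 ^ n
moment-2≤ []          = z≤n
moment-2≤ (false ∷ T) = moment-false≤ 2 T (size T) (moment-2≤ T)
moment-2≤ {suc n} (true ∷ T) = begin
  moment 2 (true ∷ T)                ≡⟨ moment-2 T ⟩
  2 * (moment 2 T + 2 ^ n)           ≤⟨ *-monoʳ-≤ 2 (+-monoˡ-≤ (2 ^ n) (moment-2≤ T)) ⟩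
  2 * (size T * 2 ^ n + 2 ^ n)       ≡⟨ l (size T) (2 ^ n) ⟩
  (1 + size T) * (2 * 2 ^ n)         ∎
  where l : ∀ k P → 2 * (k * P + P) ≡ (1 + k) * (2 * P)
        l = solve-∀

-- The constants 3, 15, 105, 945 of the moments 4 to 10 are the double factorials (p - 1)!!, as for
-- a Gaussian of variance `size T`. With them the two highest powers of `k` on both sides agree
-- exactly, and the rest is the nonnegative slack given in `l`.
moment-4≤ : ∀ {n} (T : Vec Bool n) → moment 4 T ≤ 3 * (size T * size T) * 2 ^ n
moment-4≤ []          = z≤n
moment-4≤ (false ∷ T) = moment-false≤ 4 T (3 * (size T * size T)) (moment-4≤ T)
moment-4≤ {suc n} (true ∷ T) = begin
  moment 4 (true ∷ T)                                      ≡⟨ moment-4 T ⟩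
  2 * (moment 4 T + 6 * moment 2 T + P)                    ≤⟨ *-monoʳ-≤ 2 (+-monoˡ-≤ P (+-mono-≤ (moment-4≤ T) (*-monoʳ-≤ 6 (moment-2≤ T)))) ⟩
  2 * (3 * (k * k) * P + 6 * (k * P) + P)                  ≤⟨ slack _ (l k P) ⟩
  3 * ((1 + k) * (1 + k)) * (2 * P)                        ∎
  where
  k = size T
  P = 2 ^ n
  l : ∀ k P → 2 * (3 * (k * k) * P + 6 * (k * P) + P) + 4 * P ≡ 3 * ((1 + k) * (1 + k)) * (2 * P)
  l = solve-∀

moment-6≤ : ∀ {n} (T : Vec Bool n) → moment 6 T ≤ 15 * (size T * size T * size T) * 2 ^ n
moment-6≤ []          = z≤n
moment-6≤ (false ∷ T) = moment-false≤ 6 T (15 * (size T * size T * size T)) (moment-6≤ T)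
moment-6≤ {suc n} (true ∷ T) = begin
  moment 6 (true ∷ T)                                                          ≡⟨ moment-6 T ⟩
  2 * (moment 6 T + 15 * moment 4 T + 15 * moment 2 T + P)
    ≤⟨ *-monoʳ-≤ 2 (+-monoˡ-≤ P (+-mono-≤ (+-mono-≤ (moment-6≤ T) (*-monoʳ-≤ 15 (moment-4≤ T))) (*-monoʳ-≤ 15 (moment-2≤ T)))) ⟩
  2 * (15 * (k * k * k) * P + 15 * (3 * (k * k) * P) + 15 * (k * P) + P)       ≤⟨ slack _ (l k P) ⟩
  15 * ((1 + k) * (1 + k) * (1 + k)) * (2 * P)                                 ∎
  where
  k = size T
  P = 2 ^ n
  l : ∀ k P → 2 * (15 * (k * k * k) * P + 15 * (3 * (k * k) * P) + 15 * (k * P) + P) + (60 * k * P + 28 * P) ≡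
              15 * ((1 + k) * (1 + k) * (1 + k)) * (2 * P)
  l = solve-∀

moment-8≤ : ∀ {n} (T : Vec Bool n) → moment 8 T ≤ 105 * (size T * size T * size T * size T) * 2 ^ n
moment-8≤ []          = z≤n
moment-8≤ (false ∷ T) = moment-false≤ 8 T (105 * (size T * size T * size T * size T)) (moment-8≤ T)
moment-8≤ {suc n} (true ∷ T) = begin
  moment 8 (true ∷ T)                                                          ≡⟨ moment-8 T ⟩
  2 * (moment 8 T + 28 * moment 6 T + 70 * moment 4 T + 28 * moment 2 T + P)
    ≤⟨ *-monoʳ-≤ 2 (+-monoˡ-≤ P (+-mono-≤ (+-mono-≤ (+-mono-≤ (moment-8≤ T) (*-monoʳ-≤ 28 (moment-6≤ T))) (*-monoʳ-≤ 70 (moment-4≤ T))) (*-monoʳ-≤ 28 (moment-2≤ T)))) ⟩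
  2 * (105 * (k * k * k * k) * P + 28 * (15 * (k * k * k) * P) + 70 * (3 * (k * k) * P) + 28 * (k * P) + P) ≤⟨ slack _ (l k P) ⟩
  105 * ((1 + k) * (1 + k) * (1 + k) * (1 + k)) * (2 * P)                      ∎
  where
  k = size T
  P = 2 ^ n
  l : ∀ k P → 2 * (105 * (k * k * k * k) * P + 28 * (15 * (k * k * k) * P) + 70 * (3 * (k * k) * P) + 28 * (k * P) + P) +
              (840 * (k * k) * P + 784 * k * P + 208 * P) ≡
              105 * ((1 + k) * (1 + k) * (1 + k) * (1 + k)) * (2 * P)
  l = solve-∀

moment-10≤ : ∀ {n} (T : Vec Bool n) → moment 10 T ≤ 945 * (size T * size T * size T * size T * size T) * 2 ^ n
moment-10≤ []          = z≤n
moment-10≤ (false ∷ T) = moment-false≤ 10 T (945 * (size T * size T * size T * size T * size T)) (moment-10≤ T)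
moment-10≤ {suc n} (true ∷ T) = begin
  moment 10 (true ∷ T)                                              ≡⟨ moment-10 T ⟩
  2 * (moment 10 T + 45 * moment 8 T + 210 * moment 6 T + 210 * moment 4 T + 45 * moment 2 T + P)
    ≤⟨ *-monoʳ-≤ 2 (+-monoˡ-≤ P (+-mono-≤ (+-mono-≤ (+-mono-≤ (+-mono-≤ (moment-10≤ T) (*-monoʳ-≤ 45 (moment-8≤ T)))
         (*-monoʳ-≤ 210 (moment-6≤ T))) (*-monoʳ-≤ 210 (moment-4≤ T))) (*-monoʳ-≤ 45 (moment-2≤ T)))) ⟩
  2 * (945 * (k * k * k * k * k) * P + 45 * (105 * (k * k * k * k) * P) + 210 * (15 * (k * k * k) * P) + 210 * (3 * (k * k) * P) + 45 * (k * P) + P)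
    ≤⟨ slack _ (l k P) ⟩
  945 * ((1 + k) * (1 + k) * (1 + k) * (1 + k) * (1 + k)) * (2 * P) ∎
  where
  k = size T
  P = 2 ^ n
  l : ∀ k P → 2 * (945 * (k * k * k * k * k) * P + 45 * (105 * (k * k * k * k) * P) + 210 * (15 * (k * k * k) * P) + 210 * (3 * (k * k) * P) + 45 * (k * P) + P) +
              (12600 * (k * k * k) * P + 17640 * (k * k) * P + 9360 * k * P + 1888 * P) ≡
              945 * ((1 + k) * (1 + k) * (1 + k) * (1 + k) * (1 + k)) * (2 * P)
  l = solve-∀

-- Partial colouring

weight-small : ∀ {q k} → k < q → weight q k ≡ fourth k
weight-small {q} {k} k<q = cong (λ b → if b then fourth k else k * (q * q * q)) (dec-true (k <? q) k<q)

weight-large : ∀ {q k} → ¬ k < q → weight q k ≡ k * (q * q * q)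
weight-large {q} {k} k≮q = cong (λ b → if b then fourth k else k * (q * q * q)) (dec-false (k <? q) k≮q)

n<2^n : ∀ n → n < 2 ^ n
n<2^n zero    = s≤s z≤n
n<2^n (suc n) = +-mono-≤ (m^n>0 2 n) (≤-trans (n<2^n n) (m≤m+n (2 ^ n) 0))

-- Positive and negative part. A rounded sum is thus described by two natural numbers, as the Kraft
-- inequality demands, and at most one of them is nonzero.
part : Bool → ℤ → ℕ
part true  (ℤ.+ m)      = m
part true  (ℤ.-[1+ m ]) = 0
part false (ℤ.+ m)      = 0
part false (ℤ.-[1+ m ]) = suc m

parts : ∀ a → part true a + part false a ≡ ∣ a ∣
parts (ℤ.+ m)      = +-identityʳ m
parts (ℤ.-[1+ m ]) = refl

parts-⊖ : ∀ a → a ≡ part true a ℤ.⊖ part false a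
parts-⊖ (ℤ.+ zero)     = refl
parts-⊖ (ℤ.+ suc m)    = refl
parts-⊖ (ℤ.-[1+ m ])   = refl

agree : ∀ {n} → Vec Bool n → Vec Bool n → ℕ
agree []          []          = 0
agree (true ∷ x)  (true ∷ y)  = suc (agree x y)
agree (false ∷ x) (false ∷ y) = suc (agree x y)
agree (true ∷ x)  (false ∷ y) = agree x y
agree (false ∷ x) (true ∷ y)  = agree x y

-- The generating function of the Hamming distance, (7 + 1)^n, from which the size of a ball follows
-- as in Markov's inequality. The base 7 makes the total a power of two.
ball : ∀ {n} (x : Vec Bool n) → sumL (λ y → 7 ^ agree x y) (allSigns n) ≡ 8 ^ n
ball []          = refl
ball {suc n} (true ∷ x) = trans (sumL-allSigns (λ y → 7 ^ agree (true ∷ x) y))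
  (trans (sumL-cong (allSigns n) (λ {y} _ → +-comm (7 * 7 ^ agree x y) (7 ^ agree x y)))
    (trans (sumL-*ˡ 8 (λ y → 7 ^ agree x y) (allSigns n)) (cong (8 *_) (ball x))))
ball {suc n} (false ∷ x) = trans (sumL-allSigns (λ y → 7 ^ agree (false ∷ x) y))
  (trans (sumL-*ˡ 8 (λ y → 7 ^ agree x y) (allSigns n)) (cong (8 *_) (ball x)))

-- Since `b` is an integer, `b ≤ b ^ suc p`. This lets any moment bound the mean number of units of
-- size `d`.
low-power : ∀ b d p → b * d ^ suc p ≤ (b * d) ^ suc p
low-power zero    d p = z≤n
low-power (suc b) d p = begin
  suc b * d ^ suc p                 ≡⟨ cong (_* d ^ suc p) (sym (*-identityʳ (suc b))) ⟩
  suc b * 1 * d ^ suc p             ≤⟨ *-monoˡ-≤ (d ^ suc p) (*-monoʳ-≤ (suc b) (m^n>0 (suc b) p)) ⟩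
  suc b ^ suc p * d ^ suc p         ≡⟨ sym (^-distribʳ-* (suc p) (suc b) d) ⟩
  (suc b * d) ^ suc p               ∎

-- Here `2 * 4 ^ h` is the factor by which the class of equal rounded values may fall short of
-- `2 ^ n`, and `7 ^ h * 8 ^ n / 7 ^ n` bounds a ball of radius `h`. The factors to the power `h`
-- amount to at most `64 ^ h`, and one block of twelve points pays for 64 because 64 · 4¹² < 7¹².
too-many : ∀ h r → 1 ≤ h → 2 * 4 ^ h * 7 ^ h * 8 ^ (12 * h + r) < 2 ^ (12 * h + r) * 7 ^ (12 * h + r)
too-many h r 1≤h = begin-strict
  2 * 4 ^ h * 7 ^ h * 8 ^ N             ≤⟨ *-monoˡ-≤ (8 ^ N) (*-mono-≤ (*-monoˡ-≤ (4 ^ h) (^-monoʳ-≤ 2 1≤h)) (^-monoˡ-≤ h (m≤m+n 7 1))) ⟩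
  2 ^ h * 4 ^ h * 8 ^ h * 8 ^ N         ≡⟨ cong₂ _*_ small (^-distribʳ-* N 2 4) ⟩
  64 ^ h * (2 ^ N * 4 ^ N)              ≡⟨ l (64 ^ h) (2 ^ N) (4 ^ N) ⟩
  2 ^ N * (64 ^ h * 4 ^ N)              <⟨ *-monoʳ-< (2 ^ N) {{m^n≢0 2 N}} main ⟩
  2 ^ N * 7 ^ N                         ∎
  where
  N = 12 * h + r
  l : ∀ a b c → a * (b * c) ≡ b * (a * c)
  l = solve-∀
  small : 2 ^ h * 4 ^ h * 8 ^ h ≡ 64 ^ h
  small = trans (cong (_* 8 ^ h) (sym (^-distribʳ-* h 2 4))) (sym (^-distribʳ-* h 8 8))
  64·4¹²<7¹² : 64 * 4 ^ 12 < 7 ^ 12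
  64·4¹²<7¹² = <ᵇ⇒< (64 * 4 ^ 12) (7 ^ 12) _
  main : 64 ^ h * 4 ^ N < 7 ^ N
  main = begin-strict
    64 ^ h * 4 ^ N                         ≡⟨ cong (64 ^ h *_) (trans (^-distribˡ-+-* 4 (12 * h) r) (cong (_* 4 ^ r) (sym (^-*-assoc 4 12 h)))) ⟩
    64 ^ h * ((4 ^ 12) ^ h * 4 ^ r)        ≡⟨ sym (*-assoc (64 ^ h) ((4 ^ 12) ^ h) (4 ^ r)) ⟩
    64 ^ h * (4 ^ 12) ^ h * 4 ^ r          ≡⟨ cong (_* 4 ^ r) (sym (^-distribʳ-* h 64 (4 ^ 12))) ⟩
    (64 * 4 ^ 12) ^ h * 4 ^ r              ≤⟨ *-monoʳ-≤ ((64 * 4 ^ 12) ^ h) (^-monoˡ-≤ r (m≤m+n 4 3)) ⟩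
    (64 * 4 ^ 12) ^ h * 7 ^ r              <⟨ *-monoˡ-< (7 ^ r) {{m^n≢0 7 r}} (^-monoˡ-< h {{>-nonZero 1≤h}} 64·4¹²<7¹²) ⟩
    (7 ^ 12) ^ h * 7 ^ r                   ≡⟨ trans (cong (_* 7 ^ r) (^-*-assoc 7 12 h)) (sym (^-distribˡ-+-* 7 (12 * h) r)) ⟩
    7 ^ N                                  ∎

module Pair {n : ℕ} .{{n≢0 : NonZero n}} (Ts : List (Vec Bool n)) (two≤ : ∀ {T} → T ∈ Ts → 2 ≤ size T)
  (s : ℕ) (n≤q³ : n ≤ (s * s) * (s * s) * (s * s))
  (total : sumL (λ T → weight (s * s) (size T)) Ts ≤ n * fourth (s * s) * 11520)
  (A M h : ℕ) .{{_ : NonZero M}} (1≤h : 1 ≤ h) (12h≤n : 12 * h ≤ n)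
  (kraft-constant : n * 46080 ≤ h * 2 ^ A) (cost-constant : n * ((A + 8) * 21772800) ≤ h * (M * M)) where

  q Δ : ℕ
  q = s * s
  Δ = s * M

  private
    instance
      q≢0 : NonZero q
      q≢0 = root-nonZero q (≤-trans (>-nonZero⁻¹ n) n≤q³)
      s≢0 : NonZero s
      s≢0 = m*n≢0⇒m≢0 s {s}
      Δ≢0 : NonZero Δ
      Δ≢0 = m*n≢0 s M
      q⁴≢0 : NonZero (fourth q)
      q⁴≢0 = m*n≢0 (q * q * q) q {{m*n≢0 (q * q) q {{m*n≢0 q q}}}}

    P : ℕ
    P = 2 ^ n

    -- An integer above `q / k`; the divisor is `k` for nonempty traces. In the price it stands for
    -- its own logarithm, by `g k < 2 ^ g k`. The price of a short line then grows like `q / k`,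
    -- which the tenth moment can afford.
    g : ℕ → ℕ
    g k = suc (q / suc (k ∸ 1))

    -- 2 ^ price k exceeds (q / k)⁴ by at least the factor 2 ^ A.
    price : ℕ → ℕ
    price k = A + 4 * g k

    c : Bool × Vec Bool n → ℕ
    c (_ , T) = price (size T)

    c≥1 : ∀ f → 1 ≤ c f
    c≥1 (_ , T) = ≤-trans (s≤s z≤n) (≤-trans (*-monoʳ-≤ 4 (s≤s (z≤n {q / suc (size T ∸ 1)}))) (m≤n+m (4 * g (size T)) A))

    β : Bool × Vec Bool n → Vec Bool n → ℕ
    β (b , T) x = part b (χ T x) / Δ

    open Kraft c c≥1 β

    E : ℕ
    E = A + 4 * suc q

    c≤E : ∀ f → c f ≤ E
    c≤E (_ , T) = +-monoʳ-≤ A (*-monoʳ-≤ 4 (s≤s (≤-trans (m≤m*n (q / suc (size T ∸ 1)) (suc (size T ∸ 1))) (m/n*n≤m q (suc (size T ∸ 1))))))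

    fs : List (Bool × Vec Bool n)
    fs = cartesianProduct (true ∷ false ∷ []) Ts

    size-suc : ∀ {T} → T ∈ Ts → suc (size T ∸ 1) ≡ size T
    size-suc T∈ = m+[n∸m]≡n (≤-trans (s≤s z≤n) (two≤ T∈))

    q<gk : ∀ {T} → T ∈ Ts → q < g (size T) * size T
    q<gk {T} T∈ = subst (λ k → q < g (size T) * k) (size-suc T∈) (m<[1+m/n]*n q (suc (size T ∸ 1)))

    gk≤q+k : ∀ {T} → T ∈ Ts → g (size T) * size T ≤ size T + q
    gk≤q+k {T} T∈ = +-monoʳ-≤ (size T) (subst (λ k → q / suc (size T ∸ 1) * k ≤ q) (size-suc T∈) (m/n*n≤m q (suc (size T ∸ 1))))

    fourth-* : ∀ a b → fourth (a * b) ≡ fourth a * fourth b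
    fourth-* a b = l a b
      where l : ∀ a b → a * b * (a * b) * (a * b) * (a * b) ≡ a * a * a * a * (b * b * b * b)
            l = solve-∀

    fourth-mono : ∀ {a b} → a ≤ b → fourth a ≤ fourth b
    fourth-mono p = *-mono-≤ (*-mono-≤ (*-mono-≤ p p) p) p

    fourth-2^ : ∀ k → fourth (2 ^ k) ≡ 2 ^ (4 * k)
    fourth-2^ k = trans (l (2 ^ k)) (trans (^-*-assoc 2 k 4) (cong (2 ^_) (*-comm k 4)))
      where l : ∀ a → a * a * a * a ≡ a * (a * (a * (a * 1)))
            l = solve-∀

    -- For short lines this is `q < g k * k` raised to the fourth power; for long ones the weight
    -- alone is at least `q⁴`. Hence the sum of 2 to the power `- price` is at most the total weight
    -- divided by `2 ^ A * fourth q`.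
    q⁴≤ : ∀ {T} → T ∈ Ts → fourth q ≤ 2 ^ (4 * g (size T)) * weight q (size T)
    q⁴≤ {T} T∈ with size T <? q
    ... | yes k<q = begin
        fourth q                                        ≤⟨ fourth-mono (<⇒≤ (q<gk T∈)) ⟩
        fourth (g (size T) * size T)                    ≡⟨ fourth-* (g (size T)) (size T) ⟩
        fourth (g (size T)) * fourth (size T)           ≤⟨ *-monoˡ-≤ (fourth (size T)) (fourth-mono (<⇒≤ (n<2^n (g (size T))))) ⟩
        fourth (2 ^ g (size T)) * fourth (size T)       ≡⟨ cong₂ _*_ (fourth-2^ (g (size T))) (sym (weight-small k<q)) ⟩
        2 ^ (4 * g (size T)) * weight q (size T)        ∎
    ... | no k≮q = begin
        q * q * q * q                                   ≡⟨ *-comm (q * q * q) q ⟩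
        q * (q * q * q)                                 ≤⟨ *-monoˡ-≤ (q * q * q) (≮⇒≥ k≮q) ⟩
        size T * (q * q * q)                            ≡⟨ sym (trans (*-identityˡ _) (weight-large k≮q)) ⟩
        1 * weight q (size T)                           ≤⟨ *-monoˡ-≤ (weight q (size T)) (m^n>0 2 (4 * g (size T))) ⟩
        2 ^ (4 * g (size T)) * weight q (size T)        ∎

    -- The constant is 46080 = 2 · 2 · 11520: two signs, the factor 2 of `num^D`, and the bound on
    -- the total weight.
    kraft-sum : sumL (λ f → 2 * 2 ^ (E ∸ c f)) fs ≤ h * 2 ^ E
    kraft-sum = *-cancelʳ-≤ _ _ (2 ^ A * fourth q) {{m*n≢0 (2 ^ A) (fourth q) {{m^n≢0 2 A}}}} (begin
      sumL (λ f → 2 * 2 ^ (E ∸ c f)) fs * Q                            ≡⟨ cong (_* Q) (sumL-× (λ f → 2 * 2 ^ (E ∸ c f)) (true ∷ false ∷ []) Ts) ⟩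
      (X + (X + 0)) * Q                                                ≡⟨ l₁ X Q ⟩
      2 * (X * Q)                                                      ≡⟨ cong (2 *_) (sym (sumL-*ʳ Q (λ T → 2 * 2 ^ (E ∸ price (size T))) Ts)) ⟩
      2 * sumL (λ T → 2 * 2 ^ (E ∸ price (size T)) * Q) Ts             ≤⟨ *-monoʳ-≤ 2 (sumL-mono Ts each) ⟩
      2 * sumL (λ T → 2 * 2 ^ E * weight q (size T)) Ts                ≡⟨ cong (2 *_) (sumL-*ˡ (2 * 2 ^ E) (λ T → weight q (size T)) Ts) ⟩
      2 * (2 * 2 ^ E * sumL (λ T → weight q (size T)) Ts)              ≤⟨ *-monoʳ-≤ 2 (*-monoʳ-≤ (2 * 2 ^ E) total) ⟩
      2 * (2 * 2 ^ E * (n * fourth q * 11520))                         ≡⟨ l₂ (2 ^ E) n (fourth q) ⟩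
      n * 46080 * (2 ^ E * fourth q)                                   ≤⟨ *-monoˡ-≤ (2 ^ E * fourth q) kraft-constant ⟩
      h * 2 ^ A * (2 ^ E * fourth q)                                   ≡⟨ l₃ (2 ^ A) h (2 ^ E) (fourth q) ⟩
      h * 2 ^ E * Q                                                    ∎)
      where
      Q = 2 ^ A * fourth q
      X = sumL (λ T → 2 * 2 ^ (E ∸ price (size T))) Ts
      l₁ : ∀ x y → (x + (x + 0)) * y ≡ 2 * (x * y)
      l₁ = solve-∀
      l₂ : ∀ e n f → 2 * (2 * e * (n * f * 11520)) ≡ n * 46080 * (e * f)
      l₂ = solve-∀
      l₃ : ∀ a h e f → h * a * (e * f) ≡ h * e * (a * f)
      l₃ = solve-∀
      l₄ : ∀ e a f → 2 * e * (a * f) ≡ 2 * (e * a) * f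
      l₄ = solve-∀
      l₅ : ∀ e a p w → 2 * (e * a) * (p * w) ≡ 2 * (a * p * e) * w
      l₅ = solve-∀
      each : ∀ {T} → T ∈ Ts → 2 * 2 ^ (E ∸ price (size T)) * Q ≤ 2 * 2 ^ E * weight q (size T)
      each {T} T∈ = begin
        2 * e * (2 ^ A * fourth q)                                     ≡⟨ l₄ e (2 ^ A) (fourth q) ⟩
        2 * (e * 2 ^ A) * fourth q                                     ≤⟨ *-monoʳ-≤ (2 * (e * 2 ^ A)) (q⁴≤ T∈) ⟩
        2 * (e * 2 ^ A) * (2 ^ (4 * g (size T)) * weight q (size T))   ≡⟨ l₅ e (2 ^ A) (2 ^ (4 * g (size T))) (weight q (size T)) ⟩
        2 * (2 ^ A * 2 ^ (4 * g (size T)) * e) * weight q (size T)     ≡⟨ cong (λ z → 2 * z * weight q (size T)) collect ⟩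
        2 * 2 ^ E * weight q (size T)                                  ∎
        where
        e = 2 ^ (E ∸ price (size T))
        collect : 2 ^ A * 2 ^ (4 * g (size T)) * e ≡ 2 ^ E
        collect = trans (cong (_* e) (sym (^-distribˡ-+-* 2 A (4 * g (size T)))))
          (trans (sym (^-distribˡ-+-* 2 (price (size T)) (E ∸ price (size T)))) (cong (2 ^_) (m+[n∸m]≡n (c≤E (true , T)))))

    B : Vec Bool n → Vec Bool n → ℕ
    B T x = β (true , T) x + β (false , T) x

    BΔ≤ : ∀ T x → B T x * Δ ≤ ∣ χ T x ∣
    BΔ≤ T x = begin
      (u / Δ + v / Δ) * Δ       ≡⟨ *-distribʳ-+ Δ (u / Δ) (v / Δ) ⟩
      u / Δ * Δ + v / Δ * Δ     ≤⟨ +-mono-≤ (m/n*n≤m u Δ) (m/n*n≤m v Δ) ⟩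
      u + v                     ≡⟨ parts (χ T x) ⟩
      ∣ χ T x ∣                 ∎
      where
      u = part true (χ T x)
      v = part false (χ T x)

    W : Vec Bool n → ℕ
    W T = sumL (B T) (allSigns n)

    W≤moment : ∀ p T → W T * Δ ^ suc p ≤ moment (suc p) T
    W≤moment p T = begin
      W T * Δ ^ suc p                                  ≡⟨ sym (sumL-*ʳ (Δ ^ suc p) (B T) (allSigns n)) ⟩
      sumL (λ x → B T x * Δ ^ suc p) (allSigns n)      ≤⟨ sumL-mono (allSigns n) (λ {x} _ → ≤-trans (low-power (B T x) Δ p) (^-monoˡ-≤ (suc p) (BΔ≤ T x))) ⟩
      moment (suc p) T                                 ∎

    R : ℕ
    R = M * M

    Δ² : Δ ^ 2 ≡ R * q
    Δ² = l M s
      where l : ∀ M s → s * M * (s * M * 1) ≡ M * M * (s * s)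
            l = solve-∀

    Δ¹⁰ : Δ ^ 10 ≡ R * fourth q * (fourth R * q)
    Δ¹⁰ = trans (sym (^-*-assoc Δ 2 5)) (trans (cong (_^ 5) Δ²) (l R q))
      where l : ∀ R q → R * q * (R * q * (R * q * (R * q * (R * q * 1)))) ≡ R * (q * q * q * q) * (R * R * R * R * q)
            l = solve-∀

    -- For a short line the tenth moment bounds the mean number of units by a multiple of (k / q)⁵;
    -- one factor cancels the price, which is at most `(A + 8) q / k`, and (k / q)⁴ is the weight
    -- over `q⁴`. For a long line the price is at most `A + 8`, and the second moment gives k / q,
    -- again the weight over `q⁴`.
    price-bound : ∀ {T} → T ∈ Ts → price (size T) * W T * (R * fourth q) ≤ (A + 8) * P * weight q (size T) * 945
    price-bound {T} T∈ = by-cases (size T <? q)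
      where
      k = size T
      by-cases : Dec (k < q) → price k * W T * (R * fourth q) ≤ (A + 8) * P * weight q k * 945
      by-cases (yes k<q) = *-cancelʳ-≤ _ _ (fourth R * q) {{m*n≢0 (fourth R) q {{R⁴≢0}}}} (begin
        price k * W T * (R * fourth q) * (fourth R * q)          ≡⟨ l₁ (price k) (W T) (R * fourth q) (fourth R * q) ⟩
        price k * (W T * (R * fourth q * (fourth R * q)))        ≡⟨ cong (λ z → price k * (W T * z)) (sym Δ¹⁰) ⟩
        price k * (W T * Δ ^ 10)                                 ≤⟨ *-monoʳ-≤ (price k) (≤-trans (W≤moment 9 T) (moment-10≤ T)) ⟩
        price k * (945 * (k * k * k * k * k) * P)                ≡⟨ l₂ (price k) k P ⟩
        price k * k * P * fourth k * 945                         ≤⟨ *-monoˡ-≤ 945 (*-monoˡ-≤ (fourth k) (*-monoˡ-≤ P price*k)) ⟩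
        -- Of the factor `R ^ 5` from the tenth moment only one `R` is kept, since the second moment
        -- yields no more.
        (A + 8) * q * P * fourth k * 945                         ≡⟨ l₃ (A + 8) q P (fourth k) ⟩
        (A + 8) * P * fourth k * 945 * q                         ≤⟨ *-monoʳ-≤ ((A + 8) * P * fourth k * 945) (m≤n*m q (fourth R) {{R⁴≢0}}) ⟩
        (A + 8) * P * fourth k * 945 * (fourth R * q)            ≡⟨ cong (λ z → (A + 8) * P * z * 945 * (fourth R * q)) (sym (weight-small k<q)) ⟩
        (A + 8) * P * weight q k * 945 * (fourth R * q)          ∎)
        where
        R≢0 : NonZero R
        R≢0 = m*n≢0 M M
        R⁴≢0 : NonZero (fourth R)
        R⁴≢0 = m*n≢0 (R * R * R) R {{m*n≢0 (R * R) R {{m*n≢0 R R {{R≢0}} {{R≢0}}}} {{R≢0}}}} {{R≢0}}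
        l₁ : ∀ a b c d → a * b * c * d ≡ a * (b * (c * d))
        l₁ = solve-∀
        l₂ : ∀ c k P → c * (945 * (k * k * k * k * k) * P) ≡ c * k * P * (k * k * k * k) * 945
        l₂ = solve-∀
        l₃ : ∀ a q P f → a * q * P * f * 945 ≡ a * P * f * 945 * q
        l₃ = solve-∀
        price*k : price k * k ≤ (A + 8) * q
        price*k = begin
          (A + 4 * g k) * k              ≡⟨ l₄ A (g k) k ⟩
          A * k + 4 * (g k * k)          ≤⟨ +-mono-≤ (*-monoʳ-≤ A (<⇒≤ k<q)) (*-monoʳ-≤ 4 (≤-trans (gk≤q+k T∈) (+-monoˡ-≤ q (<⇒≤ k<q)))) ⟩
          A * q + 4 * (q + q)            ≡⟨ l₅ A q ⟩
          (A + 8) * q                    ∎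
          where
          l₄ : ∀ A g k → (A + 4 * g) * k ≡ A * k + 4 * (g * k)
          l₄ = solve-∀
          l₅ : ∀ A q → A * q + 4 * (q + q) ≡ (A + 8) * q
          l₅ = solve-∀
      by-cases (no k≮q) = begin
        price k * W T * (R * (q * q * q * q))       ≡⟨ l₁ (price k) (W T) R q ⟩
        price k * (W T * (R * q)) * (q * q * q)     ≡⟨ cong (λ z → price k * (W T * z) * (q * q * q)) (sym Δ²) ⟩
        price k * (W T * Δ ^ 2) * (q * q * q)       ≤⟨ *-monoˡ-≤ (q * q * q) (*-mono-≤ price≤ (≤-trans (W≤moment 1 T) (moment-2≤ T))) ⟩
        (A + 8) * (k * P) * (q * q * q)             ≡⟨ l₂ (A + 8) k P (q * q * q) ⟩
        (A + 8) * P * (k * (q * q * q))             ≤⟨ m≤m*n _ 945 ⟩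
        (A + 8) * P * (k * (q * q * q)) * 945       ≡⟨ cong (λ z → (A + 8) * P * z * 945) (sym (weight-large k≮q)) ⟩
        (A + 8) * P * weight q k * 945              ∎
        where
        l₁ : ∀ c w R q → c * w * (R * (q * q * q * q)) ≡ c * (w * (R * q)) * (q * q * q)
        l₁ = solve-∀
        l₂ : ∀ a k P f → a * (k * P) * f ≡ a * P * (k * f)
        l₂ = solve-∀
        g≤2 : g k ≤ 2
        g≤2 = *-cancelʳ-≤ (g k) 2 k {{>-nonZero (≤-trans (s≤s z≤n) (two≤ T∈))}}
          (≤-trans (gk≤q+k T∈) (≤-trans (+-monoʳ-≤ k (≮⇒≥ k≮q)) (≤-reflexive (cong (k +_) (sym (+-identityʳ k))))))
        price≤ : price k ≤ A + 8
        price≤ = +-monoʳ-≤ A (*-monoʳ-≤ 4 g≤2)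

    -- The average cost is at most `h / 2`, so by Markov at least half of the colourings cost at
    -- most `h`. The constant is 21772800 = 2 · 11520 · 945.
    total-cost : sumL (cost fs) (allSigns n) * 2 ≤ h * P
    total-cost = *-cancelʳ-≤ _ _ (R * fourth q) {{m*n≢0 R (fourth q) {{m*n≢0 M M}}}} (begin
      sumL (cost fs) (allSigns n) * 2 * (R * fourth q)                       ≡⟨ cong (λ z → z * 2 * (R * fourth q)) by-trace ⟩
      sumL (λ T → price (size T) * W T) Ts * 2 * (R * fourth q)              ≡⟨ l₁ (sumL (λ T → price (size T) * W T) Ts) 2 (R * fourth q) ⟩
      2 * (sumL (λ T → price (size T) * W T) Ts * (R * fourth q))            ≡⟨ cong (2 *_) (sym (sumL-*ʳ (R * fourth q) _ Ts)) ⟩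
      2 * sumL (λ T → price (size T) * W T * (R * fourth q)) Ts              ≤⟨ *-monoʳ-≤ 2 (sumL-mono Ts price-bound) ⟩
      2 * sumL (λ T → (A + 8) * P * weight q (size T) * 945) Ts              ≡⟨ cong (2 *_) (trans (sumL-*ʳ 945 _ Ts) (cong (_* 945) (sumL-*ˡ ((A + 8) * P) _ Ts))) ⟩
      2 * ((A + 8) * P * sumL (λ T → weight q (size T)) Ts * 945)            ≤⟨ *-monoʳ-≤ 2 (*-monoˡ-≤ 945 (*-monoʳ-≤ ((A + 8) * P) total)) ⟩
      2 * ((A + 8) * P * (n * fourth q * 11520) * 945)                       ≡⟨ l₂ (A + 8) P n (fourth q) ⟩
      n * ((A + 8) * 21772800) * (P * fourth q)                                ≤⟨ *-monoˡ-≤ (P * fourth q) cost-constant ⟩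
      h * R * (P * fourth q)                                                 ≡⟨ l₃ R h P (fourth q) ⟩
      h * P * (R * fourth q)                                                 ∎)
      where
      l₁ : ∀ a b c → a * b * c ≡ b * (a * c)
      l₁ = solve-∀
      l₂ : ∀ a P n f → 2 * (a * P * (n * f * 11520) * 945) ≡ n * (a * 21772800) * (P * f)
      l₂ = solve-∀
      l₃ : ∀ a b c d → b * a * (c * d) ≡ b * c * (a * d)
      l₃ = solve-∀
      by-trace : sumL (cost fs) (allSigns n) ≡ sumL (λ T → price (size T) * W T) Ts
      by-trace = begin-equality
        sumL (λ x → sumL (λ f → c f * β f x) fs) (allSigns n)
          ≡⟨ sumL-cong (allSigns n) (λ {x} _ → trans (sumL-× (λ f → c f * β f x) (true ∷ false ∷ []) Ts) (join x)) ⟩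
        sumL (λ x → sumL (λ T → price (size T) * B T x) Ts) (allSigns n)
          ≡⟨ sumL-swap (λ x T → price (size T) * B T x) (allSigns n) Ts ⟩
        sumL (λ T → sumL (λ x → price (size T) * B T x) (allSigns n)) Ts
          ≡⟨ sumL-cong Ts (λ {T} _ → sumL-*ˡ (price (size T)) (B T) (allSigns n)) ⟩
        sumL (λ T → price (size T) * W T) Ts ∎
        where
        join : ∀ x → sumL (λ T → price (size T) * β (true , T) x) Ts + (sumL (λ T → price (size T) * β (false , T) x) Ts + 0) ≡
                     sumL (λ T → price (size T) * B T x) Ts
        join x = trans (cong (sumL (λ T → price (size T) * β (true , T) x) Ts +_) (+-identityʳ (sumL (λ T → price (size T) * β (false , T) x) Ts))) (trans (sym (sumL-+ _ _ Ts))
          (sumL-cong Ts (λ {T} _ → sym (*-distribˡ-+ (price (size T)) (β (true , T) x) (β (false , T) x)))))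

    cheap? : ∀ x → Dec (cost fs x ≤ h)
    cheap? x = cost fs x ≤? h

    cheap costly : List (Vec Bool n)
    cheap  = filter cheap? (allSigns n)
    costly = filter (¬? ∘ cheap?) (allSigns n)

    many-cheap : P ≤ 2 * length cheap
    many-cheap = +-cancelʳ-≤ P _ _ (begin
      P + P                                          ≡⟨ trans (cong (λ z → P + z) (sym (+-identityʳ P))) (cong (2 *_) (trans (sym (length-allSigns n)) (length-split cheap? (allSigns n)))) ⟩
      2 * (length cheap + length costly)             ≡⟨ *-distribˡ-+ 2 (length cheap) (length costly) ⟩
      2 * length cheap + 2 * length costly           ≤⟨ +-monoʳ-≤ (2 * length cheap) few-costly ⟩
      2 * length cheap + P                           ∎)
      where
      few-costly : 2 * length costly ≤ P
      few-costly = *-cancelʳ-≤ _ _ (suc h) (begin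
        2 * length costly * suc h                    ≡⟨ l (length costly) (suc h) ⟩
        length costly * suc h * 2                    ≡⟨ cong (_* 2) (sym (sumL-const (suc h) costly)) ⟩
        sumL (λ _ → suc h) costly * 2                ≤⟨ *-monoˡ-≤ 2 (sumL-mono costly (λ x∈ → ≰⇒> (proj₂ (∈-filter⁻ (¬? ∘ cheap?) {xs = allSigns n} x∈)))) ⟩
        sumL (cost fs) costly * 2                    ≤⟨ *-monoˡ-≤ 2 (⊑-sumL (filter-⊑ (¬? ∘ cheap?) (allSigns n)) (cost fs)) ⟩
        sumL (cost fs) (allSigns n) * 2              ≤⟨ total-cost ⟩
        h * P                                        ≤⟨ *-monoˡ-≤ P (n≤1+n h) ⟩
        suc h * P                                    ≡⟨ *-comm (suc h) P ⟩
        P * suc h                                    ∎)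
        where l : ∀ a b → 2 * a * b ≡ a * b * 2
              l = solve-∀

  same-quotient : ∀ {u v} → u / Δ ≡ v / Δ → u ≤ Δ + v
  same-quotient {u} {v} eq = begin
    u                      ≤⟨ <⇒≤ (m<[1+m/n]*n u Δ) ⟩
    suc (u / Δ) * Δ        ≡⟨ cong (λ z → suc z * Δ) eq ⟩
    Δ + v / Δ * Δ          ≤⟨ +-monoʳ-≤ Δ (m/n*n≤m v Δ) ⟩
    Δ + v                  ∎

  Distant : Set
  Distant = ∃ λ x → ∃ λ y → (agree x y + h < n) × (∀ {T b} → T ∈ Ts → part b (χ T x) / Δ ≡ part b (χ T y) / Δ)

  private
    both : ∀ b → b ∈ true ∷ false ∷ []
    both true  = here refl
    both false = there (here refl)

    -- The exponent `h + h` is the budget `h` of a cheap colouring plus the Kraft loss `h`. If every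
    -- member agreed with `x` in at least `n - h` points, the class would lie in a Hamming ball too
    -- small for it; any member may serve as the centre.
    class-spreads : ∀ ys → ys ⊑ cheap → Constant fs ys → length cheap ≤ length ys * 2 ^ (h + h) → Distant
    class-spreads [] _ _ many = contradiction
      (≤-trans (m^n>0 2 n) (≤-trans many-cheap (≤-trans (*-monoʳ-≤ 2 many) (≤-reflexive (*-zeroʳ 2))))) λ ()
    class-spreads ys@(x ∷ _) ys⊑ constant many = by-cases (Any.any? (λ y → agree x y + h <? n) ys)
      where
      everything : 2 ^ n ≤ 2 * 4 ^ h * length ys
      everything = begin
        P                                    ≤⟨ many-cheap ⟩
        2 * length cheap                     ≤⟨ *-monoʳ-≤ 2 many ⟩
        2 * (length ys * 2 ^ (h + h))        ≡⟨ cong (λ z → 2 * (length ys * z)) (trans (^-distribˡ-+-* 2 h h) (sym (^-distribʳ-* h 2 2))) ⟩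
        2 * (length ys * 4 ^ h)              ≡⟨ l (length ys) (4 ^ h) ⟩
        2 * 4 ^ h * length ys                ∎
        where l : ∀ a b → 2 * (a * b) ≡ 2 * b * a
              l = solve-∀
      by-cases : Dec (Any.Any (λ y → agree x y + h < n) ys) → Distant
      by-cases (yes far) = let (y , y∈ , lt) = find far in
        x , y , lt , λ {T} {b} T∈ → constant (∈-cartesianProduct⁺ (both b) T∈) (here refl) y∈
      by-cases (no near) = contradiction (begin
          2 ^ n * 7 ^ n                                          ≤⟨ *-monoˡ-≤ (7 ^ n) everything ⟩
          2 * 4 ^ h * length ys * 7 ^ n                          ≡⟨ *-assoc (2 * 4 ^ h) (length ys) (7 ^ n) ⟩
          2 * 4 ^ h * (length ys * 7 ^ n)                        ≤⟨ *-monoʳ-≤ (2 * 4 ^ h) crowded ⟩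
          2 * 4 ^ h * (7 ^ h * 8 ^ n)                            ≡⟨ sym (*-assoc (2 * 4 ^ h) (7 ^ h) (8 ^ n)) ⟩
          2 * 4 ^ h * 7 ^ h * 8 ^ n                              ∎)
          (<⇒≱ (subst (λ m → 2 * 4 ^ h * 7 ^ h * 8 ^ m < 2 ^ m * 7 ^ m) (m+[n∸m]≡n 12h≤n) (too-many h (n ∸ 12 * h) 1≤h)))
        where
        crowded : length ys * 7 ^ n ≤ 7 ^ h * 8 ^ n
        crowded = begin
          length ys * 7 ^ n                                  ≡⟨ sym (sumL-const (7 ^ n) ys) ⟩
          sumL (λ _ → 7 ^ n) ys                              ≤⟨ sumL-mono ys (λ {y} y∈ → ^-monoʳ-≤ 7 (≮⇒≥ (λ lt → near (lose y∈ lt)))) ⟩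
          sumL (λ y → 7 ^ (agree x y + h)) ys                ≡⟨ sumL-cong ys (λ {y} _ → trans (^-distribˡ-+-* 7 (agree x y) h) (*-comm (7 ^ agree x y) (7 ^ h))) ⟩
          sumL (λ y → 7 ^ h * 7 ^ agree x y) ys              ≡⟨ sumL-*ˡ (7 ^ h) (λ y → 7 ^ agree x y) ys ⟩
          7 ^ h * sumL (λ y → 7 ^ agree x y) ys              ≤⟨ *-monoʳ-≤ (7 ^ h) (⊑-sumL (⊑-trans ys⊑ (filter-⊑ cheap? (allSigns n))) (λ y → 7 ^ agree x y)) ⟩
          7 ^ h * sumL (λ y → 7 ^ agree x y) (allSigns n)    ≡⟨ cong (7 ^ h *_) (ball x) ⟩
          7 ^ h * 8 ^ n                                      ∎

  distant-pair : Distant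
  distant-pair = let (ys , ys⊑ , constant , many) = large-class E fs c≤E h kraft-sum cheap h (λ x∈ → proj₂ (∈-filter⁻ cheap? {xs = allSigns n} x∈))
                 in class-spreads ys ys⊑ constant many

-- Recolouring by half the difference of two colourings

∣χ∣≤size : ∀ {n} (T x : Vec Bool n) → ∣ χ T x ∣ ≤ size T
∣χ∣≤size []          []      = z≤n
∣χ∣≤size (true ∷ T)  (b ∷ x) = ≤-trans (ℤ.∣i+j∣≤∣i∣+∣j∣ (sign b) (χ T x)) (+-mono-≤ (≤-reflexive (unit b)) (∣χ∣≤size T x))
  where unit : ∀ b → ∣ sign b ∣ ≡ 1
        unit true  = refl
        unit false = refl
∣χ∣≤size (false ∷ T) (b ∷ x) = ∣χ∣≤size T x

size≤n : ∀ {n} (T : Vec Bool n) → size T ≤ n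
size≤n []          = z≤n
size≤n (true ∷ T)  = s≤s (size≤n T)
size≤n (false ∷ T) = m≤n⇒m≤1+n (size≤n T)

∣a⊖b∣≤ : ∀ {a b D} → a ≤ D + b → b ≤ D + a → ∣ a ℤ.⊖ b ∣ ≤ D
∣a⊖b∣≤ {a} {b} {D} p q with ≤-total a b
... | inj₁ a≤b = ≤-trans (≤-reflexive (ℤ.∣⊖∣-≤ a≤b)) (≤-trans (∸-monoˡ-≤ a q) (≤-reflexive (m+n∸n≡m D a)))
... | inj₂ b≤a = ≤-trans (≤-reflexive (trans (ℤ.∣m⊖n∣≡∣n⊖m∣ a b) (ℤ.∣⊖∣-≤ b≤a))) (≤-trans (∸-monoˡ-≤ b p) (≤-reflexive (m+n∸n≡m D b)))

-- Both parts may change by `Δ`. The resulting factor 2 is regained when the difference of the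
-- colourings is halved.
parts-close : ∀ i j Δ → (∀ b → part b i ≤ Δ + part b j) → (∀ b → part b j ≤ Δ + part b i) → ∣ i ℤ.- j ∣ ≤ Δ + Δ
parts-close i j Δ p q = subst (λ z → ∣ z ∣ ≤ Δ + Δ) (sym difference)
  (∣a⊖b∣≤ (both (p true) (q false)) (both (q true) (p false)))
  where
  l : ∀ a b c d → (a ℤ.- b) ℤ.- (c ℤ.- d) ≡ (a ℤ.+ d) ℤ.- (c ℤ.+ b)
  l = ℤ-Solver.solve-∀
  difference : i ℤ.- j ≡ (part true i + part false j) ℤ.⊖ (part true j + part false i)
  difference = trans (cong₂ ℤ._-_ (trans (parts-⊖ i) (sym (ℤ.m-n≡m⊖n (part true i) (part false i)))) (trans (parts-⊖ j) (sym (ℤ.m-n≡m⊖n (part true j) (part false j)))))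
    (trans (l (ℤ.+ part true i) (ℤ.+ part false i) (ℤ.+ part true j) (ℤ.+ part false j)) (ℤ.m-n≡m⊖n (part true i + part false j) (part true j + part false i)))
  both : ∀ {u v s t} → u ≤ Δ + s → v ≤ Δ + t → u + v ≤ Δ + Δ + (s + t)
  both {s = s} {t} u≤ v≤ = ≤-trans (+-mono-≤ u≤ v≤) (≤-reflexive (m Δ s t))
    where m : ∀ d s t → d + s + (d + t) ≡ d + d + (s + t)
          m = solve-∀

-- Half of x - y is a partial colouring; the coordinates where x and y agree are left to a colouring w.
restrict : ∀ {A : Set} {n} (x y : Vec Bool n) → Vec A n → Vec A (agree x y)
restrict []          []          []       = []
restrict (true ∷ x)  (true ∷ y)  (a ∷ as) = a ∷ restrict x y as
restrict (false ∷ x) (false ∷ y) (a ∷ as) = a ∷ restrict x y as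
restrict (true ∷ x)  (false ∷ y) (a ∷ as) = restrict x y as
restrict (false ∷ x) (true ∷ y)  (a ∷ as) = restrict x y as

recolour : ∀ {n} (x y : Vec Bool n) → Vec Bool (agree x y) → Vec Bool n
recolour []          []          []      = []
recolour (true ∷ x)  (true ∷ y)  (b ∷ w) = b ∷ recolour x y w
recolour (false ∷ x) (false ∷ y) (b ∷ w) = b ∷ recolour x y w
recolour (true ∷ x)  (false ∷ y) w       = true ∷ recolour x y w
recolour (false ∷ x) (true ∷ y)  w       = false ∷ recolour x y w

recolour-free : ∀ s b z u v w → ℤ.+ 2 ℤ.* z ≡ (u ℤ.- v) ℤ.+ ℤ.+ 2 ℤ.* w →
             ℤ.+ 2 ℤ.* (b ℤ.+ z) ≡ ((s ℤ.+ u) ℤ.- (s ℤ.+ v)) ℤ.+ ℤ.+ 2 ℤ.* (b ℤ.+ w)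
recolour-free s b z u v w eq = trans (ℤ.*-distribˡ-+ (ℤ.+ 2) b z) (trans (cong (ℤ._+_ (ℤ.+ 2 ℤ.* b)) eq) (l b s u v w))
  where
  l : ∀ b s u v w → ℤ.+ 2 ℤ.* b ℤ.+ ((u ℤ.- v) ℤ.+ ℤ.+ 2 ℤ.* w) ≡ ((s ℤ.+ u) ℤ.- (s ℤ.+ v)) ℤ.+ ℤ.+ 2 ℤ.* (b ℤ.+ w)
  l = ℤ-Solver.solve-∀

recolour-fixed : ∀ s z u v w → ℤ.+ 2 ℤ.* z ≡ (u ℤ.- v) ℤ.+ ℤ.+ 2 ℤ.* w →
           ℤ.+ 2 ℤ.* (s ℤ.+ z) ≡ ((s ℤ.+ u) ℤ.- (ℤ.- s ℤ.+ v)) ℤ.+ ℤ.+ 2 ℤ.* w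
recolour-fixed s z u v w eq = trans (ℤ.*-distribˡ-+ (ℤ.+ 2) s z) (trans (cong (ℤ._+_ (ℤ.+ 2 ℤ.* s)) eq) (l s u v w))
  where
  l : ∀ s u v w → ℤ.+ 2 ℤ.* s ℤ.+ ((u ℤ.- v) ℤ.+ ℤ.+ 2 ℤ.* w) ≡ ((s ℤ.+ u) ℤ.- (ℤ.- s ℤ.+ v)) ℤ.+ ℤ.+ 2 ℤ.* w
  l = ℤ-Solver.solve-∀

-- Doubled to avoid the half: a point where the colours differ adds twice the sign of `x` on both
-- sides, and one where they agree cancels in the difference.
χ-recolour : ∀ {n} (T x y : Vec Bool n) w →
             ℤ.+ 2 ℤ.* χ T (recolour x y w) ≡ (χ T x ℤ.- χ T y) ℤ.+ ℤ.+ 2 ℤ.* χ (restrict x y T) w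
χ-recolour []          []          []          []      = refl
χ-recolour (false ∷ T) (true ∷ x)  (true ∷ y)  (b ∷ w) = χ-recolour T x y w
χ-recolour (false ∷ T) (false ∷ x) (false ∷ y) (b ∷ w) = χ-recolour T x y w
χ-recolour (false ∷ T) (true ∷ x)  (false ∷ y) w       = χ-recolour T x y w
χ-recolour (false ∷ T) (false ∷ x) (true ∷ y)  w       = χ-recolour T x y w
χ-recolour (true ∷ T)  (true ∷ x)  (true ∷ y)  (b ∷ w) = recolour-free (sign true) (sign b) (χ T (recolour x y w)) (χ T x) (χ T y) (χ (restrict x y T) w) (χ-recolour T x y w)
χ-recolour (true ∷ T)  (false ∷ x) (false ∷ y) (b ∷ w) = recolour-free (sign false) (sign b) (χ T (recolour x y w)) (χ T x) (χ T y) (χ (restrict x y T) w) (χ-recolour T x y w)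
χ-recolour (true ∷ T)  (true ∷ x)  (false ∷ y) w       = recolour-fixed (sign true) (χ T (recolour x y w)) (χ T x) (χ T y) (χ (restrict x y T) w) (χ-recolour T x y w)
χ-recolour (true ∷ T)  (false ∷ x) (true ∷ y)  w       = recolour-fixed (sign false) (χ T (recolour x y w)) (χ T x) (χ T y) (χ (restrict x y T) w) (χ-recolour T x y w)

∣recolour∣≤ : ∀ {n} (T x y : Vec Bool n) w {Δ} → ∣ χ T x ℤ.- χ T y ∣ ≤ Δ + Δ →
              ∣ χ T (recolour x y w) ∣ ≤ ∣ χ (restrict x y T) w ∣ + Δ
∣recolour∣≤ T x y w {Δ} p = *-cancelˡ-≤ 2 (begin
  2 * ∣ χ T (recolour x y w) ∣                                                     ≡⟨ sym (ℤ.abs-* (ℤ.+ 2) (χ T (recolour x y w))) ⟩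
  ∣ ℤ.+ 2 ℤ.* χ T (recolour x y w) ∣                                               ≡⟨ cong ∣_∣ (χ-recolour T x y w) ⟩
  ∣ (χ T x ℤ.- χ T y) ℤ.+ ℤ.+ 2 ℤ.* χ (restrict x y T) w ∣                         ≤⟨ ℤ.∣i+j∣≤∣i∣+∣j∣ (χ T x ℤ.- χ T y) (ℤ.+ 2 ℤ.* χ (restrict x y T) w) ⟩
  ∣ χ T x ℤ.- χ T y ∣ + ∣ ℤ.+ 2 ℤ.* χ (restrict x y T) w ∣                         ≤⟨ +-mono-≤ p (≤-reflexive (ℤ.abs-* (ℤ.+ 2) (χ (restrict x y T) w))) ⟩
  Δ + Δ + 2 * ∣ χ (restrict x y T) w ∣                                             ≡⟨ l Δ ∣ χ (restrict x y T) w ∣ ⟩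
  2 * (∣ χ (restrict x y T) w ∣ + Δ)                                               ∎)
  where l : ∀ d z → d + d + 2 * z ≡ 2 * (z + d)
        l = solve-∀

restrict-map : ∀ {A B : Set} {n} (f : A → B) (x y : Vec Bool n) as → restrict x y (Vec.map f as) ≡ Vec.map f (restrict x y as)
restrict-map f []          []          []       = refl
restrict-map f (true ∷ x)  (true ∷ y)  (a ∷ as) = cong (f a ∷_) (restrict-map f x y as)
restrict-map f (false ∷ x) (false ∷ y) (a ∷ as) = cong (f a ∷_) (restrict-map f x y as)
restrict-map f (true ∷ x)  (false ∷ y) (a ∷ as) = restrict-map f x y as
restrict-map f (false ∷ x) (true ∷ y)  (a ∷ as) = restrict-map f x y as

restrict-All : ∀ {A : Set} {P : A → Set} {n} (x y : Vec Bool n) {as} → VecAll.All P as → VecAll.All P (restrict x y as)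
restrict-All []          []          VecAll.[]        = VecAll.[]
restrict-All (true ∷ x)  (true ∷ y)  (p VecAll.∷ ps) = p VecAll.∷ restrict-All x y ps
restrict-All (false ∷ x) (false ∷ y) (p VecAll.∷ ps) = p VecAll.∷ restrict-All x y ps
restrict-All (true ∷ x)  (false ∷ y) (p VecAll.∷ ps) = restrict-All x y ps
restrict-All (false ∷ x) (true ∷ y)  (p VecAll.∷ ps) = restrict-All x y ps

restrict-AllPairs : ∀ {A : Set} {_∼_ : A → A → Set} {n} (x y : Vec Bool n) {as} → VecPairs.AllPairs _∼_ as → VecPairs.AllPairs _∼_ (restrict x y as)
restrict-AllPairs []          []          []       = []
restrict-AllPairs (true ∷ x)  (true ∷ y)  (p ∷ ps) = restrict-All x y p ∷ restrict-AllPairs x y ps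
restrict-AllPairs (false ∷ x) (false ∷ y) (p ∷ ps) = restrict-All x y p ∷ restrict-AllPairs x y ps
restrict-AllPairs (true ∷ x)  (false ∷ y) (p ∷ ps) = restrict-AllPairs x y ps
restrict-AllPairs (false ∷ x) (true ∷ y)  (p ∷ ps) = restrict-AllPairs x y ps

-- Roots replaced by powers

-- If Q had a root ρ of order p, this would be x ≤ a ρ and y ≤ ρ, hence x + y ≤ (a + 1) ρ. Without
-- the root, the larger of `x` and `a * y` bounds the sum.
minkowski : ∀ p a .{{_ : NonZero a}} {x y Q} → x ^ p ≤ a ^ p * Q → y ^ p ≤ Q → (x + y) ^ p ≤ suc a ^ p * Q
minkowski p a {x} {y} {Q} x≤ y≤ with ≤-total x (a * y)
... | inj₁ x≤ay = begin
  (x + y) ^ p              ≤⟨ ^-monoˡ-≤ p (≤-trans (+-monoˡ-≤ y x≤ay) (≤-reflexive (+-comm (a * y) y))) ⟩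
  (suc a * y) ^ p          ≡⟨ ^-distribʳ-* p (suc a) y ⟩
  suc a ^ p * y ^ p        ≤⟨ *-monoʳ-≤ (suc a ^ p) y≤ ⟩
  suc a ^ p * Q            ∎
... | inj₂ ay≤x = *-cancelˡ-≤ (a ^ p) {{m^n≢0 a p}} (begin
  a ^ p * (x + y) ^ p          ≡⟨ sym (^-distribʳ-* p a (x + y)) ⟩
  (a * (x + y)) ^ p            ≤⟨ ^-monoˡ-≤ p (≤-trans (≤-reflexive (*-distribˡ-+ a x y)) (≤-trans (+-monoʳ-≤ (a * x) ay≤x) (≤-reflexive (+-comm (a * x) x)))) ⟩
  (suc a * x) ^ p              ≡⟨ ^-distribʳ-* p (suc a) x ⟩
  suc a ^ p * x ^ p            ≤⟨ *-monoʳ-≤ (suc a ^ p) x≤ ⟩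
  suc a ^ p * (a ^ p * Q)      ≡⟨ l (suc a ^ p) (a ^ p) Q ⟩
  a ^ p * (suc a ^ p * Q)      ∎)
  where l : ∀ a b c → a * (b * c) ≡ b * (a * c)
        l = solve-∀

sixth : ℕ → ℕ
sixth s = (s * s) * (s * s) * (s * s)

sixth≡^ : ∀ s → sixth s ≡ s ^ 6
sixth≡^ s = l s
  where l : ∀ s → (s * s) * (s * s) * (s * s) ≡ s * (s * (s * (s * (s * (s * 1)))))
        l = solve-∀

sixth-mono : ∀ {a b} → a ≤ b → sixth a ≤ sixth b
sixth-mono p = *-mono-≤ (*-mono-≤ (*-mono-≤ p p) (*-mono-≤ p p)) (*-mono-≤ p p)

-- The root grows by one only when `n` outgrows its sixth power, and `suc s ≤ 2 * s` then costs at
-- most the factor 2⁶ = 64.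
sixth-root : ∀ n .{{_ : NonZero n}} → ∃ λ s → 1 ≤ s × n ≤ sixth s × sixth s ≤ 64 * n
sixth-root (suc zero) = 1 , s≤s z≤n , s≤s z≤n , s≤s z≤n
sixth-root (suc n@(suc _)) with sixth-root n
... | s , 1≤s , n≤ , ≤64n with suc n ≤? sixth s
...   | yes p = s , 1≤s , p , ≤-trans ≤64n (*-monoʳ-≤ 64 (n≤1+n n))
...   | no ¬p = suc s , s≤s z≤n , ≤-trans (s≤s n≤) (grow s 1≤s) , (begin
        sixth (suc s)        ≤⟨ sixth-mono (≤-trans (+-monoˡ-≤ s 1≤s) (≤-reflexive (cong (s +_) (sym (+-identityʳ s))))) ⟩
        sixth (2 * s)        ≡⟨ l s ⟩
        64 * sixth s         ≤⟨ *-monoʳ-≤ 64 (<⇒≤ (≰⇒> ¬p)) ⟩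
        64 * suc n           ∎)
  where
  l : ∀ s → (2 * s * (2 * s)) * (2 * s * (2 * s)) * (2 * s * (2 * s)) ≡ 64 * ((s * s) * (s * s) * (s * s))
  l = solve-∀
  grow : ∀ s → 1 ≤ s → suc (sixth s) ≤ sixth (suc s)
  grow s _ = subst₂ _<_ (sym (sixth≡^ s)) (sym (sixth≡^ (suc s))) (^-monoˡ-< 6 (n<1+n s))

-- Iteration

module Colouring (R : RealField) (A M a : ℕ) .{{_ : NonZero M}} .{{_ : NonZero a}} (16≤M : 16 ≤ M)
  (kraft-constant : 46080 * 32 ≤ 2 ^ A) (cost-constant : (A + 8) * 21772800 * 32 ≤ M * M)
  (decay : suc a ^ 6 * 31 ≤ a ^ 6 * 32) where

  open Traces R
  open Plane R using (Point; Line)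

  -- The geometric series. A round adds `Δ = s * M`, at most 2 M n^{1/6}, and by `decay` the bound
  -- for the remaining points shrinks by the factor a / (a + 1); so the rounds sum to 2 M (a + 1)
  -- n^{1/6}.
  C : ℕ
  C = M * 2 * suc a

  C≥M : M ≤ C
  C≥M = ≤-trans (m≤m*n M 2) (m≤m*n (M * 2) (suc a))

  module _ {D : ℕ} (L : Fin D → Line) (l : 𝔽.Carrier) where

    Coloured : ∀ {n} → Vec Point n → Set
    Coloured {n} ps = ∃ λ x → ∀ d → ∣ χ (trace (L d) ps) x ∣ ^ 6 ≤ C ^ 6 * n

    -- The induction starts here because `n / 16` vanishes below 16, and a round would then colour
    -- no definite proportion.
    few-points : ∀ {n} (ps : Vec Point n) → n ≤ 16 → Coloured ps
    few-points {n} ps n≤16 = allTrue n , λ d → ≤-trans (^-monoˡ-≤ 6 (≤-trans (∣χ∣≤size (trace (L d) ps) (allTrue n)) (size≤n (trace (L d) ps)))) (bound n n≤16)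
      where
      bound : ∀ n → n ≤ 16 → n ^ 6 ≤ C ^ 6 * n
      bound zero    _    = z≤n
      bound (suc n) n<16 = ≤-trans (^-monoˡ-≤ 6 (≤-trans n<16 (≤-trans 16≤M C≥M))) (m≤m*n (C ^ 6) (suc n))

    module Step {n : ℕ} .{{n≢0 : NonZero n}} (ps : Vec Point n) (sorted : Sorted l ps) (16≤n : 16 ≤ n)
      (smaller : ∀ m → m < n → (qs : Vec Point m) → Sorted l qs → Coloured qs) where

      _≟ᵛ_ : (T U : Vec Bool n) → Dec (T ≡ U)
      _≟ᵛ_ = Vec.≡-dec Bool._≟_

      two? : (T : Vec Bool n) → Dec (2 ≤ size T)
      two? T = 2 ≤? size T

      Ts : List (Vec Bool n)
      Ts = filter two? (List.deduplicate _≟ᵛ_ (List.tabulate (λ d → trace (L d) ps)))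

      Ts-unique : Unique Ts
      Ts-unique = Unique.filter⁺ two? (DecUnique.deduplicate-! _≟ᵛ_ (List.tabulate (λ d → trace (L d) ps)))

      ∈Ts : ∀ d → 2 ≤ size (trace (L d) ps) → trace (L d) ps ∈ Ts
      ∈Ts d two = ∈-filter⁺ two? (∈-deduplicate⁺ _≟ᵛ_ (∈-tabulate⁺ {f = λ d → trace (L d) ps} d)) two

      lines : ∀ {T} → T ∈ Ts → 2 ≤ size T × ∃ λ ℓ → T ≡ trace ℓ ps
      lines T∈ = let (T∈′ , two) = ∈-filter⁻ two? {xs = List.deduplicate _≟ᵛ_ (List.tabulate (λ d → trace (L d) ps))} T∈
                     (d , eq)    = ∈-tabulate⁻ {f = λ d → trace (L d) ps} (∈-deduplicate⁻ _≟ᵛ_ (List.tabulate (λ d → trace (L d) ps)) T∈′)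
                 in two , L d , eq

      incidences : ∀ {Q : Vec Bool n → Set} (Q? : ∀ T → Dec (Q T)) r →
        sumL (λ T → size T ∸ 1) (filter Q? Ts) * suc r ^ 2 ≤ 3 * n * suc r ^ 3 + length (filter Q? Ts) * length (filter Q? Ts)
      incidences Q? = incidence-inequality sorted (filter Q? Ts) (Unique.filter⁺ Q? Ts-unique)
        (λ T∈ → lines (proj₁ (∈-filter⁻ Q? {xs = Ts} T∈)))

      -- A sixteenth satisfies `12 * h ≤ n`, and for `16 ≤ n` rounding down loses at most a factor
      -- two, so `n ≤ h * 32`. This is the origin of the factor 32 in the numerical conditions.
      h : ℕ
      h = n / 16

      1≤h : 1 ≤ h
      1≤h = *-cancelʳ-< 16 0 h (+-cancelˡ-< (n % 16) _ _ (<-≤-trans (subst (_< 16) (sym (+-identityʳ (n % 16))) (m%n<n n 16))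
              (≤-trans 16≤n (≤-reflexive (m≡m%n+[m/n]*n n 16)))))

      16h≤n : h * 16 ≤ n
      16h≤n = m/n*n≤m n 16

      n≤32h : n ≤ h * 32
      n≤32h = begin
        n                   ≤⟨ <⇒≤ (m<[1+m/n]*n n 16) ⟩
        (1 + h) * 16        ≤⟨ *-monoˡ-≤ 16 (+-monoˡ-≤ h 1≤h) ⟩
        (h + h) * 16        ≡⟨ m h ⟩
        h * 32              ∎
        where m : ∀ h → (h + h) * 16 ≡ h * 32
              m = solve-∀

      scale : ∀ c {b} → c * 32 ≤ b → n * c ≤ h * b
      scale c {b} c≤ = begin
        n * c            ≤⟨ *-monoˡ-≤ c n≤32h ⟩
        h * 32 * c       ≡⟨ *-assoc h 32 c ⟩
        h * (32 * c)     ≤⟨ *-monoʳ-≤ h (≤-trans (≤-reflexive (*-comm 32 c)) c≤) ⟩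
        h * b            ∎

      module _ (s : ℕ) (1≤s : 1 ≤ s) (n≤s⁶ : n ≤ sixth s) (s⁶≤64n : sixth s ≤ 64 * n) where

        open Pair Ts (proj₁ ∘ lines) s n≤s⁶ (Rich.total-weight Ts (proj₁ ∘ lines) incidences (s * s) n≤s⁶ s⁶≤64n) A M h 1≤h
          (≤-trans (≤-trans (≤-reflexive (*-comm 12 h)) (*-monoʳ-≤ h (m≤m+n 12 4))) 16h≤n)
          (scale 46080 kraft-constant) (scale ((A + 8) * 21772800) cost-constant)
          using (Δ; Distant; distant-pair; same-quotient)

        instance
          Δ≢0 : NonZero Δ
          Δ≢0 = m*n≢0 s M {{>-nonZero 1≤s}}

        1≤Δ : 1 ≤ Δ
        1≤Δ = *-mono-≤ 1≤s (≤-trans (s≤s z≤n) 16≤M)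

        module _ (x y : Vec Bool n) (far : agree x y + h < n)
          (same : ∀ {T b} → T ∈ Ts → part b (χ T x) / Δ ≡ part b (χ T y) / Δ) where

          close-on : ∀ d → ∣ χ (trace (L d) ps) x ℤ.- χ (trace (L d) ps) y ∣ ≤ Δ + Δ
          close-on d = by-cases (two? T)
            where
            T = trace (L d) ps
            by-cases : Dec (2 ≤ size T) → ∣ χ T x ℤ.- χ T y ∣ ≤ Δ + Δ
            by-cases (yes two) = parts-close (χ T x) (χ T y) Δ (λ b → same-quotient (same {T} {b} (∈Ts d two))) (λ b → same-quotient (sym (same {T} {b} (∈Ts d two))))
            -- Lines with at most one point are missing from `Ts`, but their sums never exceed 1.
            by-cases (no ¬two) = ≤-trans (ℤ.∣i-j∣≤∣i∣+∣j∣ (χ T x) (χ T y)) (+-mono-≤ (single x) (single y))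
              where single : ∀ z → ∣ χ T z ∣ ≤ Δ
                    single z = ≤-trans (∣χ∣≤size T z) (≤-trans (s≤s⁻¹ (≰⇒> ¬two)) 1≤Δ)

          fewer : agree x y * 32 ≤ n * 31
          fewer = +-cancelʳ-≤ (h * 32) _ _ (begin
            agree x y * 32 + h * 32        ≡⟨ sym (*-distribʳ-+ 32 (agree x y) h) ⟩
            (agree x y + h) * 32           ≤⟨ *-monoˡ-≤ 32 (<⇒≤ far) ⟩
            n * 32                         ≡⟨ *-suc n 31 ⟩
            n + n * 31                     ≡⟨ +-comm n (n * 31) ⟩
            n * 31 + n                     ≤⟨ +-monoʳ-≤ (n * 31) n≤32h ⟩
            n * 31 + h * 32                ∎)

          Q : ℕ
          Q = C ^ 6 * n

          Δ-bound : (suc a * Δ) ^ 6 ≤ Q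
          Δ-bound = begin
            (suc a * (s * M)) ^ 6                   ≡⟨ trans (^-distribʳ-* 6 (suc a) (s * M)) (cong (suc a ^ 6 *_) (^-distribʳ-* 6 s M)) ⟩
            suc a ^ 6 * (s ^ 6 * M ^ 6)             ≤⟨ *-monoʳ-≤ (suc a ^ 6) (*-monoˡ-≤ (M ^ 6) (≤-trans (≤-reflexive (sym (sixth≡^ s))) (≤-trans s⁶≤64n (≤-reflexive (*-comm 64 n))))) ⟩
            suc a ^ 6 * (n * 64 * M ^ 6)            ≡⟨ m (suc a ^ 6) n (M ^ 6) ⟩
            M ^ 6 * 64 * suc a ^ 6 * n              ≡⟨ cong (_* n) (trans (cong (_* suc a ^ 6) (sym (^-distribʳ-* 6 M 2))) (sym (^-distribʳ-* 6 (M * 2) (suc a)))) ⟩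
            Q                                       ∎
            where m : ∀ b n c → b * (n * 64 * c) ≡ c * 64 * b * n
                  m = solve-∀

          -- The induction hypothesis for at most `31 / 32` of the points, put into the form that
          -- `minkowski` expects: scaled by `suc a`, the rest takes `a` parts of the bound, which
          -- leaves one part for `Δ`.
          rest-bound : ∀ {e} → e ^ 6 ≤ C ^ 6 * agree x y → (suc a * e) ^ 6 ≤ a ^ 6 * Q
          rest-bound {e} e≤ = *-cancelʳ-≤ _ _ 32 (begin
            (suc a * e) ^ 6 * 32                          ≡⟨ cong (_* 32) (^-distribʳ-* 6 (suc a) e) ⟩
            suc a ^ 6 * e ^ 6 * 32                        ≤⟨ *-monoˡ-≤ 32 (*-monoʳ-≤ (suc a ^ 6) e≤) ⟩
            suc a ^ 6 * (C ^ 6 * agree x y) * 32          ≡⟨ m₁ (suc a ^ 6) (C ^ 6) (agree x y) 32 ⟩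
            suc a ^ 6 * C ^ 6 * (agree x y * 32)          ≤⟨ *-monoʳ-≤ (suc a ^ 6 * C ^ 6) fewer ⟩
            suc a ^ 6 * C ^ 6 * (n * 31)                  ≡⟨ m₂ (suc a ^ 6) (C ^ 6) n 31 ⟩
            suc a ^ 6 * 31 * Q                            ≤⟨ *-monoˡ-≤ Q decay ⟩
            a ^ 6 * 32 * Q                                ≡⟨ m₃ (a ^ 6) 32 Q ⟩
            a ^ 6 * Q * 32                                ∎)
            where
            m₁ : ∀ b c g k → b * (c * g) * k ≡ b * c * (g * k)
            m₁ = solve-∀
            m₂ : ∀ b c n k → b * c * (n * k) ≡ b * k * (c * n)
            m₂ = solve-∀
            m₃ : ∀ b k q → b * k * q ≡ b * q * k
            m₃ = solve-∀

          combined : ∀ {e} → e ^ 6 ≤ C ^ 6 * agree x y → (e + Δ) ^ 6 ≤ Q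
          combined {e} e≤ = *-cancelˡ-≤ (suc a ^ 6) {{m^n≢0 (suc a) 6}} (begin
            suc a ^ 6 * (e + Δ) ^ 6           ≡⟨ sym (^-distribʳ-* 6 (suc a) (e + Δ)) ⟩
            (suc a * (e + Δ)) ^ 6             ≡⟨ cong (_^ 6) (*-distribˡ-+ (suc a) e Δ) ⟩
            (suc a * e + suc a * Δ) ^ 6       ≤⟨ minkowski 6 a {suc a * e} {suc a * Δ} (rest-bound {e} e≤) Δ-bound ⟩
            suc a ^ 6 * Q                     ∎)

          extended : Coloured (restrict x y ps) → Coloured ps
          extended (w , good) = recolour x y w , λ d → ≤-trans (^-monoˡ-≤ 6 (∣recolour∣≤ (trace (L d) ps) x y w {Δ} (close-on d)))
            (combined {∣ χ (restrict x y (trace (L d) ps)) w ∣} (subst (λ T → ∣ χ T w ∣ ^ 6 ≤ C ^ 6 * agree x y) (sym (restrict-map (on (L d)) x y ps)) (good d)))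

        coloured : Coloured ps
        coloured = let (x , y , far , same) = distant-pair
                   in extended x y far (λ {T} {b} → same {T} {b})
                        (smaller (agree x y) (≤-<-trans (m≤m+n (agree x y) h) far) (restrict x y ps) (restrict-AllPairs x y sorted))

    colouring′ : ∀ fuel n → n < fuel → (ps : Vec Point n) → Sorted l ps → Coloured ps
    colouring′ (suc fuel) n (s≤s n≤fuel) ps sorted = by-cases (16 ≤? n)
      where
      by-cases : Dec (16 ≤ n) → Coloured ps
      by-cases (no 16≰n)  = few-points ps (<⇒≤ (≰⇒> 16≰n))
      by-cases (yes 16≤n) = let (s , 1≤s , n≤ , ≤64n) = sixth-root n {{n≢0}}
                            in Step.coloured {{n≢0}} ps sorted 16≤n (λ m m<n → colouring′ fuel m (<-≤-trans m<n n≤fuel)) s 1≤s n≤ ≤64n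
        where n≢0 : NonZero n
              n≢0 = >-nonZero (≤-trans (s≤s z≤n) 16≤n)

    colouring : ∀ {n} (ps : Vec Point n) → Sorted l ps → Coloured ps
    colouring {n} = colouring′ (suc n) n ≤-refl

-- Discrepancy, and the order of the points

disc≤supNorm : ∀ {D N} (B : Fin D → Fin N → ℤ) z → disc B ≤ supNormAz B z
disc≤supNorm {N = N} B z = below (allSigns N) (∈-allSigns z)
  where
  below : ∀ zs → z ∈ zs → foldr (λ z m → supNormAz B z ⊓ m) (supNormAz B (allTrue N)) zs ≤ supNormAz B z
  below (_ ∷ zs) (here refl) = m⊓n≤m _ _
  below (w ∷ zs) (there z∈)  = ≤-trans (m⊓n≤n (supNormAz B w) _) (below zs z∈)

maxFin^≤ : ∀ {K} p n (f : Fin n → ℕ) → (∀ i → f i ^ suc p ≤ K) → maxFin n f ^ suc p ≤ K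
maxFin^≤ p zero    f h = z≤n
maxFin^≤ {K} p (suc n) f h with ⊔-sel (f zero) (maxFin n (f ∘ suc))
... | inj₁ eq = subst (λ m → m ^ suc p ≤ K) (sym eq) (h zero)
... | inj₂ eq = subst (λ m → m ^ suc p ≤ K) (sym eq) (maxFin^≤ p n (f ∘ suc) (h ∘ suc))

module _ (R : RealField) where

  open Traces R
  open Plane R
  open 𝔽 using (Carrier; _≈_; isStrictTotalOrder) renaming (_<_ to _≺_; sym to ≈-sym)
  open IsStrictTotalOrder isStrictTotalOrder using (compare) renaming (trans to ≺-trans)

  signed : Bool → Bool → ℤ
  signed true  b = sign b
  signed false b = ℤ.+ 0

  χ-∷ : ∀ {n} t b (T x : Vec Bool n) → χ (t ∷ T) (b ∷ x) ≡ signed t b ℤ.+ χ T x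
  χ-∷ true  b T x = refl
  χ-∷ false b T x = sym (ℤ.+-identityˡ (χ T x))

  -- Sorting is harmless for colourings: the signs move along with the points, and each line keeps
  -- its signed sum. The permutation itself is never named.
  Transfers : ∀ {n} → Vec Point n → Vec Point n → Set
  Transfers {n} ps qs = ∀ (x : Vec Bool n) → ∃ λ y → ∀ ℓ → χ (trace ℓ qs) y ≡ χ (trace ℓ ps) x

  transfers-∷ : ∀ {n} p {ps qs : Vec Point n} → Transfers ps qs → Transfers (p ∷ ps) (p ∷ qs)
  transfers-∷ p {ps} {qs} t (b ∷ x) = let (y , same) = t x in b ∷ y , λ ℓ →
    trans (χ-∷ (on ℓ p) b (trace ℓ qs) y) (trans (cong (ℤ._+_ (signed (on ℓ p) b)) (same ℓ)) (sym (χ-∷ (on ℓ p) b (trace ℓ ps) x)))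

  transfers-swap : ∀ {n} p q (ps : Vec Point n) → Transfers (p ∷ q ∷ ps) (q ∷ p ∷ ps)
  transfers-swap p q ps (b ∷ c ∷ x) = c ∷ b ∷ x , λ ℓ → trans (two ℓ q p c b)
    (trans (exchange (signed (on ℓ q) c) (signed (on ℓ p) b) (χ (trace ℓ ps) x)) (sym (two ℓ p q b c)))
    where
    exchange : ∀ i j k → i ℤ.+ (j ℤ.+ k) ≡ j ℤ.+ (i ℤ.+ k)
    exchange = ℤ-Solver.solve-∀
    two : ∀ ℓ p q b c → χ (trace ℓ (p ∷ q ∷ ps)) (b ∷ c ∷ x) ≡ signed (on ℓ p) b ℤ.+ (signed (on ℓ q) c ℤ.+ χ (trace ℓ ps) x)
    two ℓ p q b c = trans (χ-∷ (on ℓ p) b (trace ℓ (q ∷ ps)) (c ∷ x)) (cong (ℤ._+_ (signed (on ℓ p) b)) (χ-∷ (on ℓ q) c (trace ℓ ps) x))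

  transfers-trans : ∀ {n} {ps qs rs : Vec Point n} → Transfers ps qs → Transfers qs rs → Transfers ps rs
  transfers-trans t u x = let (y , same) = t x ; (z , same′) = u y in z , λ ℓ → trans (same′ ℓ) (same ℓ)

  module _ (l : Carrier) where

    -- The last component replaces a membership relation: any property of `p` and of all of `qs`
    -- passes to `rs`. It is applied to comparisons with the key of an earlier point.
    insert : ∀ {n} p (qs : Vec Point n) → VecAll (λ q → ¬ (key l p ≈ key l q)) qs → Sorted l qs →
             ∃ λ rs → Sorted l rs × Transfers rs (p ∷ qs) × (∀ {Q : Point → Set} → Q p → VecAll Q qs → VecAll Q rs)
    insert p []       _            _        = p ∷ [] , []ᵃ ∷ [] , (λ x → x , λ _ → refl) , λ Qp _ → Qp ∷ᵃ []ᵃ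
    insert p (q ∷ qs) (p≉q ∷ᵃ p≉) (q≺ ∷ s) with compare (key l p) (key l q)
    ... | tri< p≺q _ _ = p ∷ q ∷ qs , (p≺q ∷ᵃ VecAll.map (≺-trans p≺q) q≺) ∷ q≺ ∷ s , (λ x → x , λ _ → refl) , _∷ᵃ_
    ... | tri≈ _ p≈q _ = contradiction p≈q p≉q
    ... | tri> _ _ q≺p with insert p qs p≉ s
    ...   | rs , sorted , t , all = q ∷ rs , all q≺p q≺ ∷ sorted ,
      transfers-trans {ps = q ∷ rs} {q ∷ p ∷ qs} {p ∷ q ∷ qs} (transfers-∷ q {rs} {p ∷ qs} t) (transfers-swap q p qs) , λ { Qp (Qq ∷ᵃ Qqs) → Qq ∷ᵃ all Qp Qqs }

    sort : ∀ {n} (ps : Vec Point n) → VecPairs.AllPairs (λ p q → ¬ (key l p ≈ key l q)) ps →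
           ∃ λ rs → Sorted l rs × Transfers rs ps × (∀ {Q : Point → Set} → VecAll Q ps → VecAll Q rs)
    sort []       _        = [] , [] , (λ x → x , λ _ → refl) , λ _ → []ᵃ
    sort (p ∷ ps) (p≉ ∷ d) with sort ps d
    ... | qs , sorted , t , all with insert p qs (all p≉) sorted
    ...   | rs , sorted′ , t′ , all′ = rs , sorted′ , transfers-trans {ps = rs} {p ∷ qs} {p ∷ ps} t′ (transfers-∷ p {qs} {ps} t) , λ { (Qp ∷ᵃ Qps) → all′ Qp (all Qps) }

  incidence-on : ∀ ℓ p → incidence ℓ p ≡ (if on ℓ p then ℤ.+ 1 else ℤ.+ 0)
  incidence-on (line a b c _) (x , y) with ((a 𝔽.* x) 𝔽.+ (b 𝔽.* y)) 𝔽.≟ c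
  ... | yes _ = refl
  ... | no  _ = refl

  sumFin-χ : ∀ N (P : Fin N → Point) ℓ z → sumFin N (λ j → incidence ℓ (P j) ℤ.* sign (lookup z j)) ≡ χ (trace ℓ (Vec.tabulate P)) z
  sumFin-χ zero    P ℓ []      = refl
  sumFin-χ (suc N) P ℓ (b ∷ z) = trans (cong₂ ℤ._+_ (term (P zero)) (sumFin-χ N (P ∘ suc) ℓ z))
    (sym (χ-∷ (on ℓ (P zero)) b (trace ℓ (Vec.tabulate (P ∘ suc))) z))
    where
    term : ∀ p → incidence ℓ p ℤ.* sign b ≡ signed (on ℓ p) b
    term p rewrite incidence-on ℓ p with on ℓ p
    ... | true  = ℤ.*-identityˡ (sign b)
    ... | false = refl

  -- Only finitely many shears make two points share an abscissa, and `l` exceeds them all. The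
  -- dummy values for the pairs `i ≡ j` do no harm.
  shear : ∀ {N} (P : Fin N → Point) → Distinct P → ∃ λ l → ∀ {i j} → i ≢ j → ¬ (key l (P i) ≈ key l (P j))
  shear {N} P distinct = let (l , above-l) = above bads in l , λ {i} {j} i≢j eq →
      i≢j (distinct i j (proj₂ (bad (P i) (P j)) l (above-l (∈-map⁺ bad-value (∈-cartesianProduct⁺ (∈-allFin i) (∈-allFin j)))) eq))
    where
    bad-value : Fin N × Fin N → Carrier
    bad-value (i , j) = proj₁ (bad (P i) (P j))
    bads : List Carrier
    bads = map bad-value (cartesianProduct (allFin N) (allFin N))

  discrepancy-bound : ∀ {N D} (P : Fin N → Point) (L : Fin D → Line) → Distinct P → ∀ K →
    (∀ l (ps : Vec Point N) → Sorted l ps → ∃ λ x → ∀ d → ∣ χ (trace (L d) ps) x ∣ ^ 6 ≤ K) →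
    disc (adjacency P L) ^ 6 ≤ K
  discrepancy-bound {N} {D} P L distinct K colouring =
    let (l , distinct-keys)     = shear P distinct
        (ps , sorted , t , _)   = sort l (Vec.tabulate P) (AllPairs-tabulate⁺ distinct-keys)
        (x , good)              = colouring l ps sorted
        (z , same)              = t x
    in ≤-trans (^-monoˡ-≤ 6 (disc≤supNorm (adjacency P L) z)) (maxFin^≤ 5 D _ λ d →
         subst (λ a → ∣ a ∣ ^ 6 ≤ K) (sym (trans (sumFin-χ N P (L d) z) (same (L d)))) (good d))

-- Numerical constants

-- The bound of one round is Δ = 150000 s with s⁶ ≤ 64 n, and (1 - 1 / 192)⁶ ≥ 31 / 32, the proportion of
-- points that a round may leave uncoloured.
constant : ℕ
constant = 150000 * 2 * 192

abstract

  16≤150000 : 16 ≤ 150000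
  16≤150000 = ≤ᵇ⇒≤ 16 150000 _

  kraft-constant : 46080 * 32 ≤ 2 ^ 24
  kraft-constant = ≤ᵇ⇒≤ (46080 * 32) (2 ^ 24) _

  -- This determines the size of `M`: with `A = 24` the least admissible value is 149317.
  cost-constant : (24 + 8) * 21772800 * 32 ≤ 150000 * 150000
  cost-constant = ≤ᵇ⇒≤ ((24 + 8) * 21772800 * 32) (150000 * 150000) _

  -- Bernoulli's inequality with 6 / 192 = 1 / 32.
  decay : 192 ^ 6 * 31 ≤ 191 ^ 6 * 32
  decay = ≤ᵇ⇒≤ (192 ^ 6 * 31) (191 ^ 6 * 32) _

theoremA1 : ∃ λ (C : ℕ) → (0 < C) ×
    ((R : RealField) (N D : ℕ)
    (P : Fin N → Plane.Point R) → Plane.Distinct R P →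
    (L : Fin D → Plane.Line R) →
    disc (Plane.adjacency R P L) ^ 6 ≤ C ^ 6 * N)
theoremA1 = constant , s≤s z≤n , λ R N D P distinct L →
  discrepancy-bound R P L distinct (constant ^ 6 * N)
    (λ l ps sorted → Colouring.colouring R 24 150000 191 16≤150000 kraft-constant cost-constant decay L l ps sorted)
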